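{- Let $v\geq2$, let $W$ be a $\operatorname{BGW}(v,d,\lambda)$, and let $A=\begin{bmatrix}O&W\\ W^{\top}&O\end{bmatrix}$. Then, for each $a\in\{0,1\}$, the hypergraph $\mathfrak H_A(2v,4,a)$ is a $\operatorname{PBIBD}(2v,4;\lambda_1^{(a)},\lambda_2^{(a)},\lambda_3^{(a)})$ on $\mathcal X_2$, where $$\lambda_1^{(a)}=(1-a)\left(\binom{2v}{4}-\frac{\lambda(d-1)}{2}\right)+(2a-1)\bigl(d^2+d(v-2)-2\lambda(d-1)\bigr),$$ $$\lambda_2^{(a)}=(1-a)\left(\binom{2v}{4}-\frac{\lambda^2}{4}\right)+(2a-1)(d^2-\lambda^2),$$ $$\lambda_3^{(a)}=(1-a)\binom{2v}{4}+(2a-1)d^2.$$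
   Context: For positive integers $t,v,k,\lambda$, a $t$-$(v,k,\lambda)$ design (or $t$-design) is a $k$-uniform hypergraph on a $v$-element vertex set such that any set of $t$ vertices appear together in precisely $\lambda$ hyperedges. A $2$-design is symmetric if its number of hyperedges equals its number of vertices. The incidence matrix $N$ of a hypergraph is the $\{0,1\}$-matrix with rows indexed by vertices and columns by hyperedges, with $N_{x,b}=1$ iff $x\in b$. A balanced generalised weighing matrix $\operatorname{BGW}(v,d,\lambda)$ is a $v\times v$ $\{0,\pm1\}$-matrix $W$ with $WW^{\top}=dI$ such that the matrix $N$ obtained from $W$ by replacing $-1$ with $1$ is the incidence matrix of a symmetric $2$-$(v,d,\lambda)$ design. $\mathcal X_2=([2v],\{R_i\}_{i=0}^3)$ is the $3$-class symmetric association scheme on $[2v]=\{1,\dots,2v\}$ with $(x,y)\in R_i$ iff $(A_i)_{xy}=1$, where $A_0=I_{2v}$, $A_1=\begin{bmatrix}O & N \\ N^{\top} & O\end{bmatrix}$, $A_2=I_2\otimes(J_v-I_v)$, $A_3=\begin{bmatrix}O & J-N \\ J-N^{\top} & O\end{bmatrix}$; here $J$ is the all-ones matrix and $O$ the zero matrix. For an $m\times m$ matrix $A$, $\mathfrak H_A(m,k,a)$ is the $k$-uniform hypergraph on $[m]=\{1,\dots,m\}$ whose hyperedges are the $k$-subsets $\alpha\subset[m]$ with $\det(A[\alpha])=a$, where $A[\alpha]$ is the principal submatrix of $A$ indexed by $\alpha$. A $\operatorname{PBIBD}(m,k;\lambda_1,\lambda_2,\lambda_3)$ (partially balanced incomplete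 block design) on a symmetric association scheme $([m],\{R_i\}_{i=0}^3)$ is a $k$-uniform $1$-design on $[m]$ such that, for each $i\in\{1,2,3\}$ and each $(x,y)\in R_i$, the pair $\{x,y\}$ is contained in exactly $\lambda_i$ hyperedges.
   Formalization: In the formulas for a=0 the binomial coefficient C(2v,4) is replaced by C(2v-2,2), the number of 4-subsets through a given pair; as printed they fail, e.g. for BGW(4,3,2) they give λ_3=61 although only 15 four-subsets contain a pair. -}

module Defs where

open import Level using (0ℓ)
open import Data.Bool.Base using (if_then_else_)
open import Data.Nat.Base as ℕ using (ℕ; zero; suc)
open import Data.Nat.Combinatorics using (_C_)
open import Data.Integer.Base as ℤ using (ℤ; +_; -[1+_]; 0ℤ; 1ℤ; -1ℤ)
import Data.Integer.Properties as ℤₚ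
import Data.Nat.Properties as ℕₚ
open import Data.Rational.Base as Rat using (ℚ; 1ℚ)
open import Data.Fin.Base using (Fin; zero; suc; splitAt; punchIn; toℕ)
open import Data.Fin.Patterns using (0F; 1F; 2F; 3F)
import Data.Fin.Properties as Fin
open import Data.Fin.Subset using (Subset; inside; outside; ∣_∣; _∈_; _∉_; _⊆_; _∪_; ⁅_⁆)
open import Data.Fin.Subset.Properties using (_⊆?_)
open import Data.List.Base using (List; []; _∷_; [_]; _++_; map; filter; length; allFin)
open import Data.Vec.Base using ([]; _∷_)
open import Data.Product.Base using (Σ; ∃; ∃₂; ∃-syntax; _×_; _,_)
open import Data.Sum.Base using (_⊎_; inj₁; inj₂)
open import Function.Bundles using (_⇔_)
open import Function.Definitions using (Injective)
open import Relation.Binary.Core using (Rel)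
import Relation.Binary.Definitions as B
open import Relation.Binary.PropositionalEquality using (_≡_)
open import Relation.Nullary.Decidable using (does; _×-dec_)
open import Relation.Unary using (Pred; Decidable)
open import Algebra.Properties.Semiring.Sum ℤₚ.+-*-semiring using (sum)

private
  variable
    m n c : ℕ

------------------------------------------------------------------------
-- Matrices

Matrix : ℕ → ℕ → Set
Matrix m n = Fin m → Fin n → ℤ

_ᵀ : Matrix m n → Matrix n m
(A ᵀ) i j = A j i

_·_ : ∀ {l} → Matrix l m → Matrix m n → Matrix l n
(A · B) i j = sum (λ k → A i k ℤ.* B k j)

O : Matrix m n
O _ _ = 0ℤ

J : Matrix m n
J _ _ = 1ℤ

I : Matrix n n
I i j = if does (i Fin.≟ j) then 1ℤ else 0ℤ

_⊖_ : Matrix m n → Matrix m n → Matrix m n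
(A ⊖ B) i j = A i j ℤ.- B i j

-- block P Q R S  is  [ P  Q ; R  S ].
block : ∀ {m n p q} → Matrix m p → Matrix m q → Matrix n p → Matrix n q →
        Matrix (m ℕ.+ n) (p ℕ.+ q)
block {m} {n} {p} {q} P Q R S i j with splitAt m i | splitAt p j
... | inj₁ x | inj₁ y = P x y
... | inj₁ x | inj₂ y = Q x y
... | inj₂ x | inj₁ y = R x y
... | inj₂ x | inj₂ y = S x y

bipartite : Matrix m n → Matrix (m ℕ.+ n) (m ℕ.+ n)
bipartite W = block O W (W ᵀ) O

-- Laplace expansion along the first row.
det : Matrix n n → ℤ
det {zero}  A = 1ℤ
det {suc n} A =
  sum (λ j → (-1ℤ ℤ.^ toℕ j) ℤ.* A zero j ℤ.* det (λ r s → A (suc r) (punchIn j s)))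

-- The increasing enumeration of the elements of a subset.
nth : (α : Subset n) → Fin ∣ α ∣ → Fin n
nth (inside  ∷ α) zero    = zero
nth (inside  ∷ α) (suc i) = suc (nth α i)
nth (outside ∷ α) i       = suc (nth α i)

principal : Matrix n n → (α : Subset n) → Matrix ∣ α ∣ ∣ α ∣
principal A α i j = A (nth α i) (nth α j)

------------------------------------------------------------------------
-- Hypergraphs and designs

-- The hyperedges form a set of subsets, so there are no repeated hyperedges.
record Hypergraph (n : ℕ) : Set₁ where
  field
    Edge  : Pred (Subset n) 0ℓ
    edge? : Decidable Edge

open Hypergraph public

subsets : ∀ n → List (Subset n)
subsets zero    = [ [] ]
subsets (suc n) = map (inside ∷_) (subsets n) ++ map (outside ∷_) (subsets n)

size : Hypergraph n → ℕ
size H = length (filter (edge? H) (subsets _))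

-- The number of hyperedges containing every element of S.
degree : Hypergraph n → Subset n → ℕ
degree H S = length (filter (λ e → edge? H e ×-dec S ⊆? e) (subsets _))

Uniform : ℕ → Hypergraph n → Set
Uniform k H = ∀ e → Edge H e → ∣ e ∣ ≡ k

record IsDesign (t v k l : ℕ) (H : Hypergraph v) : Set where
  field
    t-positive : 0 ℕ.< t
    v-positive : 0 ℕ.< v
    k-positive : 0 ℕ.< k
    l-positive : 0 ℕ.< l
    uniform    : Uniform k H
    balanced   : ∀ S → ∣ S ∣ ≡ t → degree H S ≡ l

record IsSymmetric2Design (v k l : ℕ) (H : Hypergraph v) : Set where
  field
    isDesign  : IsDesign 2 v k l H
    symmetric : size H ≡ v

-- The columns of N are indexed by the hyperedges of H by means of an
-- enumeration `edge` of the latter.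
record IsIncidenceMatrix (H : Hypergraph m) (N : Matrix m n) : Set where
  field
    edge       : Fin n → Subset m
    injective  : Injective _≡_ _≡_ edge
    isEdge     : ∀ b → Edge H (edge b)
    exhaustive : ∀ e → Edge H e → ∃[ b ] edge b ≡ e
    incident   : ∀ x b → x ∈ edge b → N x b ≡ 1ℤ
    ¬incident  : ∀ x b → x ∉ edge b → N x b ≡ 0ℤ

𝓗 : Matrix m m → ℕ → ℤ → Hypergraph m
𝓗 A k a = record
  { Edge  = λ α → ∣ α ∣ ≡ k × det (principal A α) ≡ a
  ; edge? = λ α → (∣ α ∣ ℕₚ.≟ k) ×-dec (det (principal A α) ℤₚ.≟ a)
  }

------------------------------------------------------------------------
-- Balanced generalised weighing matrices

-- Replaces -1 with 1.
unsign : ℤ → ℤ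
unsign -[1+ 0 ] = 1ℤ
unsign i        = i

unsigned : Matrix m n → Matrix m n
unsigned W i j = unsign (W i j)

record IsBGW (v d l : ℕ) (W : Matrix v v) : Set₁ where
  field
    entries  : ∀ i j → W i j ≡ 0ℤ ⊎ W i j ≡ 1ℤ ⊎ W i j ≡ -1ℤ
    weighing : ∀ i j → (W · (W ᵀ)) i j ≡ + d ℤ.* I i j
    design   : Σ (Hypergraph v) λ H →
               IsSymmetric2Design v d l H × IsIncidenceMatrix H (unsigned W)

------------------------------------------------------------------------
-- Association schemes

-- Relations R₀ , … , R_c on Fin n.
record Relations (c n : ℕ) : Set₁ where
  field
    R  : Fin (suc c) → Rel (Fin n) 0ℓ
    R? : ∀ i → B.Decidable (R i)

open Relations public

record IsSymmetricAssociationScheme (X : Relations c n) : Set where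
  field
    identity : ∀ x y → R X zero x y ⇔ x ≡ y
    nonempty : ∀ i → ∃₂ λ x y → R X i x y
    covering : ∀ x y → ∃[ i ] R X i x y
    disjoint : ∀ i j x y → R X i x y → R X j x y → i ≡ j
    symm     : ∀ i x y → R X i x y → R X i y x
    p        : Fin (suc c) → Fin (suc c) → Fin (suc c) → ℕ
    regular  : ∀ i j k x y → R X k x y →
               length (filter (λ z → R? X i x z ×-dec R? X j z y) (allFin n)) ≡ p i j k

fromMatrices : (Fin (suc c) → Matrix n n) → Relations c n
fromMatrices A = record
  { R  = λ i x y → A i x y ≡ 1ℤ
  ; R? = λ i x y → A i x y ℤₚ.≟ 1ℤ
  }

𝓧₂-matrix : ∀ {v} → Matrix v v → Fin 4 → Matrix (v ℕ.+ v) (v ℕ.+ v)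
𝓧₂-matrix     N 0F = I
𝓧₂-matrix     N 1F = bipartite N
𝓧₂-matrix {v} N 2F = block (J ⊖ I) (O {v} {v}) O (J ⊖ I)
𝓧₂-matrix     N 3F = block O (J ⊖ N) (J ⊖ (N ᵀ)) O

𝓧₂ : ∀ {v} → Matrix v v → Relations 3 (v ℕ.+ v)
𝓧₂ N = fromMatrices (𝓧₂-matrix N)

record IsPBIBD (m k l₁ l₂ l₃ : ℕ) (X : Relations 3 m) (H : Hypergraph m) : Set where
  field
    scheme   : IsSymmetricAssociationScheme X
    1-design : ∃[ r ] IsDesign 1 m k r H
    pairs₁   : ∀ x y → R X 1F x y → degree H (⁅ x ⁆ ∪ ⁅ y ⁆) ≡ l₁
    pairs₂   : ∀ x y → R X 2F x y → degree H (⁅ x ⁆ ∪ ⁅ y ⁆) ≡ l₂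
    pairs₃   : ∀ x y → R X 3F x y → degree H (⁅ x ⁆ ∪ ⁅ y ⁆) ≡ l₃

------------------------------------------------------------------------
-- The parameters

fromℕ : ℕ → ℚ
fromℕ n = + n Rat./ 1

fromℤ : ℤ → ℚ
fromℤ i = i Rat./ 1

-- The leading binomial coefficient is C(2v-2,2), the number of 4-subsets of
-- [2v] through a given pair.  (With C(2v,4), the number of all 4-subsets, the
-- formulas for a = 0 would already fail for v = 4, d = 3, l = 2, where they
-- exceed the number of 4-subsets through a pair.)
module _ (v d l : ℕ) (a : ℤ) where
  open Rat using (_+_; _*_; _-_; _/_)

  private
    B α V D L : ℚ
    B = fromℕ ((2 ℕ.* v ℕ.∸ 2) C 2)
    α = fromℤ a
    V = fromℕ v
    D = fromℕ d
    L = fromℕ l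

  λ₁ : ℚ
  λ₁ = (1ℚ - α) * (B - L * (D - 1ℚ) * (+ 1 / 2))
     + (fromℕ 2 * α - 1ℚ) * (D * D + D * (V - fromℕ 2) - fromℕ 2 * L * (D - 1ℚ))

  λ₂ : ℚ
  λ₂ = (1ℚ - α) * (B - L * L * (+ 1 / 4))
     + (fromℕ 2 * α - 1ℚ) * (D * D - L * L)

  λ₃ : ℚ
  λ₃ = (1ℚ - α) * B + (fromℕ 2 * α - 1ℚ) * (D * D)

{-# OPTIONS --safe #-}
module Submission where

-- A principal submatrix of A on two rows and two columns of W has determinant
-- det(M)², where M is the corresponding 2 × 2 minor of W, and every other
-- principal 4 × 4 submatrix is singular.  With det M = p - q and p, q ∈ {0,1,-1},
-- the indicators of det(M)² = 1 and det(M)² = 4 are p² + q² - 2p²q² and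
-- (p²q² - pq)/2, so the hyperedges through a pair of vertices are counted by sums
-- of products of entries of W and of W ∘ W, which only involve row and column
-- sums and Gram matrices.  The rows of W have these by hypothesis; the columns
-- inherit them because WWᵀ and WᵀW have the same norm, trace and, where needed,
-- the same sum of entries.  The case a = 0 follows by complementation.

open import Defs
open import Level using (0ℓ)
open import Data.Bool.Base using (Bool; true; false; _∧_; _xor_; if_then_else_)
import Data.Bool.Properties as Bool
open import Data.Nat.Base as ℕ using (ℕ; zero; suc)
import Data.Nat.Properties as ℕₚ
open import Data.Nat.Combinatorics using (_C_; nCk+nC[k+1]≡[n+1]C[k+1])
open import Data.Integer.Base as ℤ
  using (ℤ; +_; -[1+_]; 0ℤ; 1ℤ; -1ℤ; _+_; _*_; _-_; -_; _^_; _≤_)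
import Data.Integer.Properties as ℤₚ
open import Data.Integer.Tactic.RingSolver using (solve-∀)
open import Data.Rational.Base as Rat using (ℚ; 1ℚ)
import Data.Rational.Literals as ℚ
import Data.Rational.Properties as ℚₚ
import Data.Rational.Solver as ℚ
open import Data.Fin.Base using (Fin; zero; suc; _↑ˡ_; _↑ʳ_; join; splitAt; punchIn; cast; toℕ)
open import Data.Fin.Patterns using (0F; 1F; 2F; 3F)
import Data.Fin.Properties as Fin
open import Data.Fin.Subset using (Subset; inside; outside; ∣_∣; _⊆_; _∪_; ⁅_⁆; ∁; ⊥; ⊤)
open import Data.Fin.Subset.Properties
  using (_⊆?_; p⊆q⇒∣p∣≤∣q∣; ∪-comm; p⊆p∪q; ∪-identityˡ; ∪-identityʳ; ∣⁅x⁆∣≡1; ∣∁p∣≡n∸∣p∣;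
         x∈⁅y⁆⇒x≡y; ∣p∣≤n; ∣p∣≡n⇒p≡⊤)
open import Data.List.Base as List using (List; []; _∷_; filter; length; allFin)
import Data.List.Membership.Propositional as List
import Data.List.Membership.Propositional.Properties as List
import Data.List.Properties as List
open import Data.List.Relation.Unary.Any using (here)
open import Data.Vec.Base as Vec using ([]; _∷_; lookup)
import Data.Vec.Properties as Vec
open import Data.Product.Base using (∃₂; ∃-syntax; _×_; _,_; proj₁; proj₂)
open import Data.Sum.Base using (_⊎_; inj₁; inj₂)
open import Function.Base using (_∘_; id)
open import Function.Bundles using (mk⇔)
open import Relation.Binary.PropositionalEquality
  using (_≡_; _≢_; _≗_; refl; sym; trans; cong; cong₂; subst; module ≡-Reasoning)
open import Relation.Nullary using (¬_; Dec; yes; no; does; contradiction)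
open import Relation.Nullary.Decidable using (_×-dec_; dec-true; dec-false; does-⇔)
open import Relation.Unary using (Pred; Decidable)
open import Algebra.Properties.Semiring.Sum ℤₚ.+-*-semiring
  using (sum; sum-syntax; sum-cong-≗; sum-replicate-zero; ∑-distrib-+; ∑-comm;
         *-distribˡ-sum; *-distribʳ-sum)

open ≡-Reasoning

private
  variable
    m n k : ℕ

-- The formulas have denominators 2 and 4 while degrees are natural numbers, so the counting takes
-- place in ℤ on twofold or fourfold degrees, and ℚ appears only when the results are compared with
-- `λ₁`, `λ₂` and `λ₃`. The witnesses for these indices are the degrees of representative pairs, one
-- from each class, so integrality needs no argument of its own. Sums over 2-subsets are turned into
-- sums over ordered pairs, because there the expanded minors can be summed one variable at a time.
-- The passage from rows to columns avoids inverting `W`: over ℤ, a vanishing sum of squares is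
-- enough. Positivity is a second obligation beside the counting. A 1-design must have positive
-- degree and every class must be nonempty; the latter needs 0 < d < v. For a = 1 the degree d² of a
-- pair in the third class settles the former. For a = 0 one vertex on one side and three on the
-- other form a hyperedge once v ≥ 3, and v = 2 is impossible by flag counting.

+-interchange : ∀ a b c d → (a + b) + (c + d) ≡ (a + c) + (b + d)
+-interchange = solve-∀

*-interchange : ∀ a b c d → (a * b) * (c * d) ≡ (a * c) * (b * d)
*-interchange = solve-∀

-- Indicators and finite sums

𝟙 : Bool → ℤ
𝟙 b = if b then 1ℤ else 0ℤ

𝟙-∧ : ∀ b c → 𝟙 (b ∧ c) ≡ 𝟙 b * 𝟙 c
𝟙-∧ true  true  = refl
𝟙-∧ true  false = refl
𝟙-∧ false _     = refl

sum-zero : {f : Fin n → ℤ} → (∀ i → f i ≡ 0ℤ) → sum f ≡ 0ℤ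
sum-zero {n} f≡0 = trans (sum-cong-≗ f≡0) (sum-replicate-zero n)

sum-++ : ∀ m {n} (f : Fin (m ℕ.+ n) → ℤ) →
         sum f ≡ sum (λ i → f (i ↑ˡ n)) + sum (λ j → f (m ↑ʳ j))
sum-++ zero    f = sym (ℤₚ.+-identityˡ _)
sum-++ (suc m) {n} f = trans
  (cong (_+_ (f zero)) (sum-++ m (f ∘ suc)))
  (sym (ℤₚ.+-assoc (f zero) (sum (λ i → f (suc (i ↑ˡ n)))) (sum (λ j → f (suc m ↑ʳ j)))))

sum-const : ∀ n c → sum {n} (λ _ → c) ≡ + n * c
sum-const zero    c = refl
sum-const (suc n) c = begin
  c + sum {n} (λ _ → c) ≡⟨ cong (_+_ c) (sum-const n c) ⟩
  c + + n * c           ≡⟨ lemma c (+ n) ⟩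
  (1ℤ + + n) * c        ∎
  where
  lemma : ∀ c n → c + n * c ≡ (1ℤ + n) * c
  lemma = solve-∀

sum-I : (x : Fin n) (f : Fin n → ℤ) → sum (λ y → I x y * f y) ≡ f x
sum-I zero    f = trans (cong (_+_ (1ℤ * f zero)) (sum-zero {f = λ y → 0ℤ * f (suc y)} λ _ → refl)) (lemma (f zero))
  where
  lemma : ∀ a → 1ℤ * a + 0ℤ ≡ a
  lemma = solve-∀
sum-I (suc x) f = trans (ℤₚ.+-identityˡ _) (sum-I x (f ∘ suc))

length-filter-allFin : {P : Pred (Fin n) 0ℓ} (P? : Decidable P) →
                       + length (filter P? (allFin n)) ≡ sum (λ i → 𝟙 (does (P? i)))
length-filter-allFin {n} {P} P? = go n id
  where
  go : ∀ m (f : Fin m → Fin n) →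
       + length (filter P? (List.tabulate f)) ≡ sum (λ i → 𝟙 (does (P? (f i))))
  go zero    f = refl
  go (suc m) f with does (P? (f zero))
  ... | true  = cong (_+_ 1ℤ) (go m (f ∘ suc))
  ... | false = trans (go m (f ∘ suc)) (sym (ℤₚ.+-identityˡ _))

-- Sums over all subsets

-- Follows the recursion of `subsets`, so that a degree becomes such a sum and linearity is proved
-- by induction on the ground set.
sumₛ : (Subset n → ℤ) → ℤ
sumₛ {zero}  f = f []
sumₛ {suc n} f = sumₛ (f ∘ (inside ∷_)) + sumₛ (f ∘ (outside ∷_))

sumₛ-cong : {f g : Subset n → ℤ} → f ≗ g → sumₛ f ≡ sumₛ g
sumₛ-cong {zero}  f≗g = f≗g []
sumₛ-cong {suc n} f≗g = cong₂ _+_ (sumₛ-cong (f≗g ∘ (inside ∷_))) (sumₛ-cong (f≗g ∘ (outside ∷_)))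

sumₛ-zero : {f : Subset n → ℤ} → (∀ α → f α ≡ 0ℤ) → sumₛ f ≡ 0ℤ
sumₛ-zero {zero}  f≡0 = f≡0 []
sumₛ-zero {suc n} f≡0 = cong₂ _+_ (sumₛ-zero (f≡0 ∘ (inside ∷_))) (sumₛ-zero (f≡0 ∘ (outside ∷_)))

sumₛ-distrib-+ : (f g : Subset n → ℤ) → sumₛ (λ α → f α + g α) ≡ sumₛ f + sumₛ g
sumₛ-distrib-+ {zero}  f g = refl
sumₛ-distrib-+ {suc n} f g =
  trans (cong₂ _+_ (sumₛ-distrib-+ (f ∘ (inside ∷_)) (g ∘ (inside ∷_)))
                   (sumₛ-distrib-+ (f ∘ (outside ∷_)) (g ∘ (outside ∷_))))
        (+-interchange (sumₛ (f ∘ (inside ∷_))) (sumₛ (g ∘ (inside ∷_))) (sumₛ (f ∘ (outside ∷_))) _)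

*-distribˡ-sumₛ : ∀ c (f : Subset n → ℤ) → c * sumₛ f ≡ sumₛ (λ α → c * f α)
*-distribˡ-sumₛ {zero}  c f = refl
*-distribˡ-sumₛ {suc n} c f =
  trans (ℤₚ.*-distribˡ-+ c (sumₛ (f ∘ (inside ∷_))) (sumₛ (f ∘ (outside ∷_))))
        (cong₂ _+_ (*-distribˡ-sumₛ c (f ∘ (inside ∷_))) (*-distribˡ-sumₛ c (f ∘ (outside ∷_))))

sumₛ-++ : ∀ m {n} (f : Subset (m ℕ.+ n) → ℤ) →
          sumₛ f ≡ sumₛ {m} (λ β → sumₛ {n} (λ γ → f (β Vec.++ γ)))
sumₛ-++ zero    f = refl
sumₛ-++ (suc m) f = cong₂ _+_ (sumₛ-++ m (f ∘ (inside ∷_))) (sumₛ-++ m (f ∘ (outside ∷_)))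

sumₛ-comm : ∀ {m n} (f : Subset m → Subset n → ℤ) →
            sumₛ (λ β → sumₛ (f β)) ≡ sumₛ (λ γ → sumₛ (λ β → f β γ))
sumₛ-comm {zero}  f = refl
sumₛ-comm {suc m} f =
  trans (cong₂ _+_ (sumₛ-comm (f ∘ (inside ∷_))) (sumₛ-comm (f ∘ (outside ∷_))))
        (sym (sumₛ-distrib-+ (λ γ → sumₛ (λ β → f (inside ∷ β) γ)) (λ γ → sumₛ (λ β → f (outside ∷ β) γ))))

sumₛ-sum-comm : ∀ {m n} (f : Subset m → Fin n → ℤ) →
                sumₛ (λ β → sum (f β)) ≡ sum (λ x → sumₛ (λ β → f β x))
sumₛ-sum-comm {zero}  f = refl
sumₛ-sum-comm {suc m} f =
  trans (cong₂ _+_ (sumₛ-sum-comm (f ∘ (inside ∷_))) (sumₛ-sum-comm (f ∘ (outside ∷_))))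
        (sym (∑-distrib-+ (λ x → sumₛ (λ β → f (inside ∷ β) x)) (λ x → sumₛ (λ β → f (outside ∷ β) x))))

length-filter-map : ∀ {A B : Set} {P : Pred B 0ℓ} (P? : Decidable P) (f : A → B) xs →
                    length (filter P? (List.map f xs)) ≡ length (filter (P? ∘ f) xs)
length-filter-map P? f []       = refl
length-filter-map P? f (x ∷ xs) with does (P? (f x))
... | true  = cong suc (length-filter-map P? f xs)
... | false = length-filter-map P? f xs

length-filter-subsets : {P : Pred (Subset n) 0ℓ} (P? : Decidable P) →
                        + length (filter P? (subsets n)) ≡ sumₛ (λ α → 𝟙 (does (P? α)))
length-filter-subsets {zero}  P? with does (P? [])
... | true  = refl
... | false = refl
length-filter-subsets {suc n} P? = begin
  + length (filter P? (List.map (inside ∷_) (subsets n) List.++ List.map (outside ∷_) (subsets n)))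
    ≡⟨ cong (+_ ∘ length) (List.filter-++ P? (List.map (inside ∷_) (subsets n)) _) ⟩
  + length (filter P? (List.map (inside ∷_) (subsets n)) List.++ filter P? (List.map (outside ∷_) (subsets n)))
    ≡⟨ cong +_ (List.length-++ (filter P? (List.map (inside ∷_) (subsets n)))) ⟩
  + length (filter P? (List.map (inside ∷_) (subsets n))) + + length (filter P? (List.map (outside ∷_) (subsets n)))
    ≡⟨ cong₂ _+_ (trans (cong +_ (length-filter-map P? (inside ∷_) (subsets n)))
                        (length-filter-subsets (P? ∘ (inside ∷_))))
                 (trans (cong +_ (length-filter-map P? (outside ∷_) (subsets n)))
                        (length-filter-subsets (P? ∘ (outside ∷_)))) ⟩
  sumₛ (λ α → 𝟙 (does (P? α))) ∎

-- Sums over the subsets of size one and two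

-- A list version of `nth`: its length is visible to pattern matching, whereas the domain of `nth α`
-- depends on `∣ α ∣`.
elements : Subset n → List (Fin n)
elements []            = []
elements (inside  ∷ α) = zero ∷ List.map suc (elements α)
elements (outside ∷ α) = List.map suc (elements α)

length-elements : (α : Subset n) → length (elements α) ≡ ∣ α ∣
length-elements []            = refl
length-elements (inside  ∷ α) = cong suc (trans (List.length-map suc (elements α)) (length-elements α))
length-elements (outside ∷ α) = trans (List.length-map suc (elements α)) (length-elements α)

-- Encodes a summand over `k`-subsets as a function on all lists, so that sums over `k`-subsets
-- remain sums over all subsets.
SupportedOnLength : ℕ → (List (Fin n) → ℤ) → Set
SupportedOnLength k g = ∀ xs → length xs ≢ k → g xs ≡ 0ℤ

supported-map : ∀ {g : List (Fin (suc n)) → ℤ} → SupportedOnLength k g →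
                SupportedOnLength k (g ∘ List.map suc)
supported-map g-supp xs |xs|≢k =
  g-supp _ (|xs|≢k ∘ trans (sym (List.length-map suc xs)))

supported-∷ : ∀ {g : List (Fin (suc n)) → ℤ} → SupportedOnLength (suc k) g →
              SupportedOnLength k (λ xs → g (zero ∷ List.map suc xs))
supported-∷ g-supp xs |xs|≢k =
  g-supp _ (|xs|≢k ∘ trans (sym (List.length-map suc xs)) ∘ ℕₚ.suc-injective)

module _ where
  private
    a*0≡0 : ∀ a → a * 0ℤ ≡ 0ℤ
    a*0≡0 = solve-∀

    1*a+0 : ∀ a → 1ℤ * a + 0ℤ ≡ a
    1*a+0 = solve-∀

  ∈-supported₀ : ∀ {g : List (Fin n) → ℤ} → SupportedOnLength 0 g →
                 ∀ x β → 𝟙 (lookup β x) * g (elements β) ≡ 0ℤ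
  ∈-supported₀ g-supp x       (inside  ∷ β) =
    trans (cong (𝟙 (lookup (inside ∷ β) x) *_) (g-supp (elements (inside ∷ β)) λ ()))
          (a*0≡0 (𝟙 (lookup (inside ∷ β) x)))
  ∈-supported₀ g-supp zero    (outside ∷ β) = refl
  ∈-supported₀ g-supp (suc x) (outside ∷ β) = ∈-supported₀ (supported-map g-supp) x β

  sumₛ-supported₀ : ∀ {g : List (Fin n) → ℤ} → SupportedOnLength 0 g →
                    sumₛ (g ∘ elements) ≡ g []
  sumₛ-supported₀ {zero}  g-supp = refl
  sumₛ-supported₀ {suc n} g-supp = trans
    (cong₂ _+_ (sumₛ-zero {n} λ β → g-supp (zero ∷ List.map suc (elements β)) λ ())
               (sumₛ-supported₀ (supported-map g-supp)))
    (ℤₚ.+-identityˡ _)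

  sumₛ-supported₁ : ∀ {g : List (Fin n) → ℤ} → SupportedOnLength 1 g →
                    sumₛ (g ∘ elements) ≡ sum (λ x → g (x ∷ []))
  sumₛ-supported₁ {zero}  g-supp = g-supp [] λ ()
  sumₛ-supported₁ {suc n} g-supp =
    cong₂ _+_ (sumₛ-supported₀ (supported-∷ g-supp)) (sumₛ-supported₁ (supported-map g-supp))

  sumₛ-∈-supported₁ : ∀ {g : List (Fin n) → ℤ} → SupportedOnLength 1 g →
                      ∀ x → sumₛ (λ β → 𝟙 (lookup β x) * g (elements β)) ≡ g (x ∷ [])
  sumₛ-∈-supported₁ {suc n} {g} g-supp zero = begin
    sumₛ {n} (λ β → 1ℤ * g (zero ∷ List.map suc (elements β))) + sumₛ {n} (λ _ → 0ℤ)
      ≡⟨ cong₂ _+_ (sym (*-distribˡ-sumₛ {n} 1ℤ _)) (sumₛ-zero {n} λ _ → refl) ⟩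
    1ℤ * sumₛ {n} (λ β → g (zero ∷ List.map suc (elements β))) + 0ℤ
      ≡⟨ 1*a+0 (sumₛ {n} (λ β → g (zero ∷ List.map suc (elements β)))) ⟩
    sumₛ {n} (λ β → g (zero ∷ List.map suc (elements β)))
      ≡⟨ sumₛ-supported₀ (supported-∷ g-supp) ⟩
    g (zero ∷ []) ∎
  sumₛ-∈-supported₁ {suc n} g-supp (suc x) = trans
    (cong₂ _+_ (sumₛ-zero (∈-supported₀ (supported-∷ g-supp) x))
               (sumₛ-∈-supported₁ (supported-map g-supp) x))
    (ℤₚ.+-identityˡ _)

  -- A subset with one element cannot contain both `x` and `y`.
  ∈∈-supported₁ : ∀ {g : List (Fin n) → ℤ} → SupportedOnLength 1 g → ∀ {x y} → x ≢ y →
                  ∀ β → 𝟙 (lookup β x) * (𝟙 (lookup β y) * g (elements β)) ≡ 0ℤ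
  ∈∈-supported₁ g-supp {zero}  {zero}  x≢y β = contradiction refl x≢y
  ∈∈-supported₁ g-supp {zero}  {suc y} x≢y (inside  ∷ β) =
    cong (1ℤ *_) (∈-supported₀ (supported-∷ g-supp) y β)
  ∈∈-supported₁ g-supp {zero}  {suc y} x≢y (outside ∷ β) = refl
  ∈∈-supported₁ g-supp {suc x} {zero}  x≢y (inside  ∷ β) =
    trans (cong (𝟙 (lookup β x) *_) (ℤₚ.*-identityˡ _)) (∈-supported₀ (supported-∷ g-supp) x β)
  ∈∈-supported₁ g-supp {suc x} {zero}  x≢y (outside ∷ β) = a*0≡0 (𝟙 (lookup β x))
  ∈∈-supported₁ g-supp {suc x} {suc y} x≢y (inside  ∷ β) =
    trans (cong (𝟙 (lookup β x) *_) (∈-supported₀ (supported-∷ g-supp) y β)) (a*0≡0 (𝟙 (lookup β x)))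
  ∈∈-supported₁ g-supp {suc x} {suc y} x≢y (outside ∷ β) =
    ∈∈-supported₁ (supported-map g-supp) (x≢y ∘ cong suc) β

  -- Functions of unordered pairs: no sign changes under exchange, and the zero diagonal lets
  -- ordered pairs run over all of `Fin n × Fin n`.
  record Alternating (g : List (Fin n) → ℤ) : Set where
    field
      supported : SupportedOnLength 2 g
      symmetric : ∀ x y → g (x ∷ y ∷ []) ≡ g (y ∷ x ∷ [])
      diagonal  : ∀ x → g (x ∷ x ∷ []) ≡ 0ℤ

  open Alternating public

  alternating-map : ∀ {g : List (Fin (suc n)) → ℤ} → Alternating g → Alternating (g ∘ List.map suc)
  alternating-map g-alt = record
    { supported = supported-map (supported g-alt)
    ; symmetric = λ x y → symmetric g-alt (suc x) (suc y)
    ; diagonal  = λ x → diagonal g-alt (suc x)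
    }

  -- Each 2-subset arises from two ordered pairs, and the diagonal contributes nothing.
  sumₛ-pairs : ∀ {g : List (Fin n) → ℤ} → Alternating g →
               + 2 * sumₛ (g ∘ elements) ≡ ∑[ x < n ] ∑[ y < n ] g (x ∷ y ∷ [])
  sumₛ-pairs {zero}  g-alt = cong (+ 2 *_) (supported g-alt [] λ ())
  sumₛ-pairs {suc n} {g} g-alt = begin
    + 2 * (sumₛ {n} (λ β → g (zero ∷ List.map suc (elements β))) + sumₛ {n} (λ β → g (List.map suc (elements β))))
      ≡⟨ cong (λ s → + 2 * (s + sumₛ {n} (λ β → g (List.map suc (elements β)))))
              (sumₛ-supported₁ (supported-∷ (supported g-alt))) ⟩
    + 2 * (s₀ + sumₛ {n} (λ β → g (List.map suc (elements β))))
      -- The `0ℤ` reserves the place of the diagonal term at `zero`; the two copies of `s₀` are the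
      -- pairs with `zero` in front and with `zero` behind.
      ≡⟨ lemma s₀ _ ⟩
    (0ℤ + s₀) + (s₀ + + 2 * sumₛ {n} (λ β → g (List.map suc (elements β))))
      ≡⟨ cong₂ (λ a b → (a + s₀) + b) (sym (diagonal g-alt zero))
           (cong₂ _+_ (sum-cong-≗ (λ y → symmetric g-alt zero (suc y))) (sumₛ-pairs (alternating-map g-alt))) ⟩
    (g (zero ∷ zero ∷ []) + s₀)
      + (∑[ x < n ] g (suc x ∷ zero ∷ []) + ∑[ x < n ] ∑[ y < n ] g (suc x ∷ suc y ∷ []))
      ≡⟨ cong (_+_ (g (zero ∷ zero ∷ []) + s₀))
           (sym (∑-distrib-+ {n} (λ x → g (suc x ∷ zero ∷ [])) (λ x → ∑[ y < n ] g (suc x ∷ suc y ∷ [])))) ⟩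
    ∑[ x < suc n ] ∑[ y < suc n ] g (x ∷ y ∷ []) ∎
    where
    s₀ = ∑[ y < n ] g (zero ∷ suc y ∷ [])
    lemma : ∀ a b → + 2 * (a + b) ≡ (0ℤ + a) + (a + + 2 * b)
    lemma = solve-∀

  -- No factor 2 here: the prescribed element `x` is put in front, which orders the pair.
  sumₛ-∈-pairs : ∀ {g : List (Fin n) → ℤ} → Alternating g →
                 ∀ x → sumₛ (λ β → 𝟙 (lookup β x) * g (elements β)) ≡ ∑[ y < n ] g (x ∷ y ∷ [])
  sumₛ-∈-pairs {suc n} {g} g-alt zero = begin
    sumₛ {n} (λ β → 1ℤ * g (zero ∷ List.map suc (elements β))) + sumₛ {n} (λ _ → 0ℤ)
      ≡⟨ cong₂ _+_ (sym (*-distribˡ-sumₛ {n} 1ℤ _)) (sumₛ-zero {n} λ _ → refl) ⟩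
    1ℤ * sumₛ {n} (λ β → g (zero ∷ List.map suc (elements β))) + 0ℤ
      ≡⟨ cong (λ s → 1ℤ * s + 0ℤ) (sumₛ-supported₁ (supported-∷ (supported g-alt))) ⟩
    1ℤ * ∑[ y < n ] g (zero ∷ suc y ∷ []) + 0ℤ
      ≡⟨ lemma (∑[ y < n ] g (zero ∷ suc y ∷ [])) ⟩
    0ℤ + ∑[ y < n ] g (zero ∷ suc y ∷ [])
      ≡⟨ cong (_+ ∑[ y < n ] g (zero ∷ suc y ∷ [])) (diagonal g-alt zero) ⟨
    ∑[ y < suc n ] g (zero ∷ y ∷ []) ∎
    where
    lemma : ∀ a → 1ℤ * a + 0ℤ ≡ 0ℤ + a
    lemma = solve-∀
  sumₛ-∈-pairs {suc n} g-alt (suc x) =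
    cong₂ _+_ (trans (sumₛ-∈-supported₁ (supported-∷ (supported g-alt)) x) (symmetric g-alt zero (suc x)))
              (sumₛ-∈-pairs (alternating-map g-alt) x)

  sumₛ-∈∈-pairs : ∀ {g : List (Fin n) → ℤ} → Alternating g → ∀ {x y} → x ≢ y →
                  sumₛ (λ β → 𝟙 (lookup β x) * (𝟙 (lookup β y) * g (elements β))) ≡ g (x ∷ y ∷ [])
  sumₛ-∈∈-pairs g-alt {zero} {zero} x≢y = contradiction refl x≢y
  sumₛ-∈∈-pairs {suc n} {g} g-alt {zero} {suc y} x≢y = begin
    sumₛ {n} (λ β → 1ℤ * (𝟙 (lookup β y) * g (zero ∷ List.map suc (elements β)))) + sumₛ {n} (λ _ → 0ℤ)
      ≡⟨ cong₂ _+_ (sym (*-distribˡ-sumₛ {n} 1ℤ _)) (sumₛ-zero {n} λ _ → refl) ⟩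
    1ℤ * sumₛ {n} (λ β → 𝟙 (lookup β y) * g (zero ∷ List.map suc (elements β))) + 0ℤ
      ≡⟨ 1*a+0 (sumₛ {n} (λ β → 𝟙 (lookup β y) * g (zero ∷ List.map suc (elements β)))) ⟩
    sumₛ {n} (λ β → 𝟙 (lookup β y) * g (zero ∷ List.map suc (elements β)))
      ≡⟨ sumₛ-∈-supported₁ (supported-∷ (supported g-alt)) y ⟩
    g (zero ∷ suc y ∷ []) ∎
  sumₛ-∈∈-pairs {suc n} {g} g-alt {suc x} {zero} x≢y = begin
    sumₛ {n} (λ β → 𝟙 (lookup β x) * (1ℤ * g (zero ∷ List.map suc (elements β))))
      + sumₛ {n} (λ β → 𝟙 (lookup β x) * 0ℤ)
      ≡⟨ cong₂ _+_ (sumₛ-cong {n} λ β → cong (𝟙 (lookup β x) *_) (ℤₚ.*-identityˡ _))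
                   (sumₛ-zero λ β → a*0≡0 (𝟙 (lookup β x))) ⟩
    sumₛ {n} (λ β → 𝟙 (lookup β x) * g (zero ∷ List.map suc (elements β))) + 0ℤ
      ≡⟨ ℤₚ.+-identityʳ _ ⟩
    sumₛ {n} (λ β → 𝟙 (lookup β x) * g (zero ∷ List.map suc (elements β)))
      ≡⟨ sumₛ-∈-supported₁ (supported-∷ (supported g-alt)) x ⟩
    g (zero ∷ suc x ∷ [])
      ≡⟨ symmetric g-alt zero (suc x) ⟩
    g (suc x ∷ zero ∷ []) ∎
  sumₛ-∈∈-pairs g-alt {suc x} {suc y} x≢y = trans
    (cong₂ _+_ (sumₛ-zero (∈∈-supported₁ (supported-∷ (supported g-alt)) (x≢y ∘ cong suc)))
               (sumₛ-∈∈-pairs (alternating-map g-alt) (x≢y ∘ cong suc)))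
    (ℤₚ.+-identityˡ _)

-- Determinants of principal submatrices

det-cong : ∀ n {A B : Matrix n n} → (∀ i j → A i j ≡ B i j) → det A ≡ det B
det-cong zero    A≡B = refl
det-cong (suc n) A≡B = sum-cong-≗ λ j →
  cong₂ _*_ (cong (_*_ (-1ℤ ^ toℕ j)) (A≡B zero j)) (det-cong n λ r s → A≡B (suc r) (punchIn j s))

-- Needed because `length (elements α)` and `∣ α ∣` agree only propositionally.
det-cast : (eq : m ≡ n) {A : Matrix m m} {B : Matrix n n} →
           (∀ i j → A i j ≡ B (cast eq i) (cast eq j)) → det A ≡ det B
det-cast {m} refl {B = B} A≡B =
  det-cong m λ i j → trans (A≡B i j) (cong₂ B (Fin.cast-is-id refl i) (Fin.cast-is-id refl j))

detOn : ∀ {X : Set} → (X → X → ℤ) → List X → ℤ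
detOn A xs = det {length xs} λ i j → A (List.lookup xs i) (List.lookup xs j)

lookup-map : ∀ {A B : Set} (f : A → B) xs i →
             List.lookup (List.map f xs) i ≡ f (List.lookup xs (cast (List.length-map f xs) i))
lookup-map f (x ∷ xs) zero    = refl
lookup-map f (x ∷ xs) (suc i) = lookup-map f xs i

detOn-map : ∀ {X Y : Set} (A : Y → Y → ℤ) (f : X → Y) xs →
            detOn A (List.map f xs) ≡ detOn (λ x y → A (f x) (f y)) xs
detOn-map A f xs = det-cast (List.length-map f xs) λ i j →
  cong₂ A (lookup-map f xs i) (lookup-map f xs j)

lookup-elements : ∀ (α : Subset n) i →
                  List.lookup (elements α) i ≡ nth α (cast (length-elements α) i)
-- The recursive call of `lookup-elements` under `suc`, common to both head cases. Its equality is
-- irrelevant, so it accepts either proof that `cast` carries there.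
lookup-map-elements : ∀ (α : Subset n) .(eq : length (List.map suc (elements α)) ≡ ∣ α ∣) i →
                      List.lookup (List.map suc (elements α)) i ≡ suc (nth α (cast eq i))

lookup-elements (inside  ∷ α) zero    = refl
lookup-elements (inside  ∷ α) (suc i) = lookup-map-elements α _ i
lookup-elements (outside ∷ α) i       = lookup-map-elements α _ i

lookup-map-elements α eq i = begin
  List.lookup (List.map suc (elements α)) i
    ≡⟨ lookup-map suc (elements α) i ⟩
  suc (List.lookup (elements α) (cast |map| i))
    ≡⟨ cong suc (lookup-elements α (cast |map| i)) ⟩
  suc (nth α (cast (length-elements α) (cast |map| i)))
    ≡⟨ cong (suc ∘ nth α) (Fin.cast-trans |map| (length-elements α) i) ⟩
  suc (nth α (cast eq i)) ∎
  where
  |map| = List.length-map suc (elements α)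

det-principal : (A : Matrix n n) (α : Subset n) → det (principal A α) ≡ detOn A (elements α)
det-principal A α = sym (det-cast (length-elements α) λ i j →
  cong₂ A (lookup-elements α i) (lookup-elements α j))

elements-++ : ∀ {m n} (β : Subset m) (γ : Subset n) →
              elements (β Vec.++ γ) ≡ List.map (_↑ˡ n) (elements β) List.++ List.map (m ↑ʳ_) (elements γ)
map-suc-elements-++ : ∀ {m n} (β : Subset m) (γ : Subset n) →
              List.map suc (elements (β Vec.++ γ))
                ≡ List.map (_↑ˡ n) (List.map suc (elements β)) List.++ List.map (suc m ↑ʳ_) (elements γ)

elements-++ []            γ = sym (List.map-id (elements γ))
elements-++ (inside  ∷ β) γ = cong (zero ∷_) (map-suc-elements-++ β γ)
elements-++ (outside ∷ β) γ = map-suc-elements-++ β γ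

map-suc-elements-++ {m} {n} β γ = begin
  List.map suc (elements (β Vec.++ γ))
    ≡⟨ cong (List.map suc) (elements-++ β γ) ⟩
  List.map suc (List.map (_↑ˡ n) (elements β) List.++ List.map (m ↑ʳ_) (elements γ))
    ≡⟨ List.map-++ suc (List.map (_↑ˡ n) (elements β)) _ ⟩
  List.map suc (List.map (_↑ˡ n) (elements β)) List.++ List.map suc (List.map (m ↑ʳ_) (elements γ))
    ≡⟨ cong₂ List._++_ (trans (sym (List.map-∘ (elements β))) (List.map-∘ (elements β)))
                       (sym (List.map-∘ (elements γ))) ⟩
  List.map (_↑ˡ n) (List.map suc (elements β)) List.++ List.map (suc m ↑ʳ_) (elements γ) ∎

-- Tagging each vertex with its side lets the entries of a principal submatrix compute, with no
-- `splitAt` left.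
merge : List (Fin m) → List (Fin n) → List (Fin m ⊎ Fin n)
merge xs ys = List.map inj₁ xs List.++ List.map inj₂ ys

elements-merge : ∀ {m n} (β : Subset m) (γ : Subset n) →
                 elements (β Vec.++ γ) ≡ List.map (join m n) (merge (elements β) (elements γ))
elements-merge {m} {n} β γ = begin
  elements (β Vec.++ γ)
    ≡⟨ elements-++ β γ ⟩
  List.map (_↑ˡ n) (elements β) List.++ List.map (m ↑ʳ_) (elements γ)
    ≡⟨ cong₂ List._++_ (List.map-∘ (elements β)) (List.map-∘ (elements γ)) ⟩
  List.map (join m n) (List.map inj₁ (elements β)) List.++ List.map (join m n) (List.map inj₂ (elements γ))
    ≡⟨ List.map-++ (join m n) (List.map inj₁ (elements β)) _ ⟨
  List.map (join m n) (merge (elements β) (elements γ)) ∎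

blockEntry : ∀ {m n p q} → Matrix m p → Matrix m q → Matrix n p → Matrix n q →
             Fin m ⊎ Fin n → Fin p ⊎ Fin q → ℤ
blockEntry P Q R S (inj₁ x) (inj₁ y) = P x y
blockEntry P Q R S (inj₁ x) (inj₂ y) = Q x y
blockEntry P Q R S (inj₂ x) (inj₁ y) = R x y
blockEntry P Q R S (inj₂ x) (inj₂ y) = S x y

block-join : ∀ {m n p q} (P : Matrix m p) (Q : Matrix m q) (R : Matrix n p) (S : Matrix n q) s t →
             block P Q R S (join m n s) (join p q t) ≡ blockEntry P Q R S s t
block-join {m} {n} {p} {q} P Q R S s t
  with splitAt m (join m n s) | Fin.splitAt-join m n s | splitAt p (join p q t) | Fin.splitAt-join p q t
block-join P Q R S (inj₁ x) (inj₁ y) | _ | refl | _ | refl = refl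
block-join P Q R S (inj₁ x) (inj₂ y) | _ | refl | _ | refl = refl
block-join P Q R S (inj₂ x) (inj₁ y) | _ | refl | _ | refl = refl
block-join P Q R S (inj₂ x) (inj₂ y) | _ | refl | _ | refl = refl

bipartiteEntry : Matrix m n → Fin m ⊎ Fin n → Fin m ⊎ Fin n → ℤ
bipartiteEntry W = blockEntry O W (W ᵀ) O

det-principal-bipartite : (W : Matrix m n) (β : Subset m) (γ : Subset n) →
  det (principal (bipartite W) (β Vec.++ γ)) ≡ detOn (bipartiteEntry W) (merge (elements β) (elements γ))
det-principal-bipartite {m} {n} W β γ = begin
  det (principal (bipartite W) (β Vec.++ γ))
    ≡⟨ det-principal (bipartite W) (β Vec.++ γ) ⟩
  detOn (bipartite W) (elements (β Vec.++ γ))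
    ≡⟨ cong (detOn (bipartite W)) (elements-merge β γ) ⟩
  detOn (bipartite W) (List.map (join m n) zs)
    ≡⟨ detOn-map (bipartite W) (join m n) zs ⟩
  detOn (λ s t → bipartite W (join m n s) (join m n t)) zs
    ≡⟨ det-cong (length zs) (λ i j → block-join O W (W ᵀ) O (List.lookup zs i) (List.lookup zs j)) ⟩
  detOn (bipartiteEntry W) zs ∎
  where
  zs = merge (elements β) (elements γ)

det₂ : (A : Matrix 2 2) → det A ≡ A 0F 0F * A 1F 1F - A 0F 1F * A 1F 0F
det₂ A = lemma (A 0F 0F) (A 0F 1F) (A 1F 0F) (A 1F 1F)
  where
  lemma : ∀ a b c d → 1ℤ * a * (1ℤ * d * 1ℤ + 0ℤ) + (-1ℤ * b * (1ℤ * c * 1ℤ + 0ℤ) + 0ℤ) ≡ a * d - b * c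
  lemma = solve-∀

det₃ : (A : Matrix 3 3) →
       det A ≡ A 0F 0F * (A 1F 1F * A 2F 2F - A 1F 2F * A 2F 1F)
             - A 0F 1F * (A 1F 0F * A 2F 2F - A 1F 2F * A 2F 0F)
             + A 0F 2F * (A 1F 0F * A 2F 1F - A 1F 1F * A 2F 0F)
det₃ A = begin
  det A
    ≡⟨ sum-cong-≗ (λ j → cong (_*_ (-1ℤ ^ toℕ j * A 0F j)) (det₂ (λ r s → A (suc r) (punchIn j s)))) ⟩
  1ℤ * A 0F 0F * p + (-1ℤ * A 0F 1F * q + (1ℤ * A 0F 2F * r + 0ℤ))
    ≡⟨ lemma (A 0F 0F) (A 0F 1F) (A 0F 2F) p q r ⟩
  A 0F 0F * p - A 0F 1F * q + A 0F 2F * r ∎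
  where
  p = A 1F 1F * A 2F 2F - A 1F 2F * A 2F 1F
  q = A 1F 0F * A 2F 2F - A 1F 2F * A 2F 0F
  r = A 1F 0F * A 2F 1F - A 1F 1F * A 2F 0F
  lemma : ∀ a b c p q r → 1ℤ * a * p + (-1ℤ * b * q + (1ℤ * c * r + 0ℤ)) ≡ a * p - b * q + c * r
  lemma = solve-∀

-- The minors stay unevaluated. As `0ℤ * m` reduces to `0ℤ`, the minors at zero entries of the first
-- row vanish by computation, and only the others have to be expanded.
det₄ : (A : Matrix 4 4) → let minor j = det (λ r s → A (suc r) (punchIn j s)) in
       det A ≡ A 0F 0F * minor 0F - A 0F 1F * minor 1F + A 0F 2F * minor 2F - A 0F 3F * minor 3F
det₄ A = lemma (A 0F 0F) (A 0F 1F) (A 0F 2F) (A 0F 3F) (minor 0F) (minor 1F) (minor 2F) (minor 3F)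
  where
  minor : Fin 4 → ℤ
  minor j = det (λ r s → A (suc r) (punchIn j s))
  lemma : ∀ a b c d p q r s →
          1ℤ * a * p + (-1ℤ * b * q + (1ℤ * c * r + (-1ℤ * d * s + 0ℤ))) ≡ a * p - b * q + c * r - d * s
  lemma = solve-∀

module _ (W : Matrix m n) where

  private
    D : List (Fin m) → List (Fin n) → ℤ
    D xs ys = detOn (bipartiteEntry W) (merge xs ys)

  -- The submatrix is zero, and its Laplace expansion normalises.
  det-bipartite-4-0 : ∀ x₁ x₂ x₃ x₄ → D (x₁ ∷ x₂ ∷ x₃ ∷ x₄ ∷ []) [] ≡ 0ℤ
  det-bipartite-4-0 x₁ x₂ x₃ x₄ = refl

  det-bipartite-0-4 : ∀ y₁ y₂ y₃ y₄ → D [] (y₁ ∷ y₂ ∷ y₃ ∷ y₄ ∷ []) ≡ 0ℤ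
  det-bipartite-0-4 y₁ y₂ y₃ y₄ = refl

  -- Three rows are supported in the single column of `y`. Hence only the last minor can survive the
  -- expansion, and it has two zero rows.
  det-bipartite-3-1 : ∀ x₁ x₂ x₃ y → D (x₁ ∷ x₂ ∷ x₃ ∷ []) (y ∷ []) ≡ 0ℤ
  det-bipartite-3-1 x₁ x₂ x₃ y = trans (det₄ A) (trans
    (cong (λ d → 0ℤ - W x₁ y * d) (det₃ (λ r s → A (suc r) (punchIn 3F s))))
    (lemma (W x₁ y)))
    where
    A : Matrix 4 4
    A i j = bipartiteEntry W (List.lookup zs i) (List.lookup zs j)
      where zs = merge (x₁ ∷ x₂ ∷ x₃ ∷ []) (y ∷ [])
    lemma : ∀ a → 0ℤ - a * 0ℤ ≡ 0ℤ
    lemma = solve-∀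

  -- The rows of `y₁`, `y₂`, `y₃` are supported in the column of `x`, so every minor that meets a
  -- nonzero entry of the first row has rank at most one.
  det-bipartite-1-3 : ∀ x y₁ y₂ y₃ → D (x ∷ []) (y₁ ∷ y₂ ∷ y₃ ∷ []) ≡ 0ℤ
  det-bipartite-1-3 x y₁ y₂ y₃ = trans (det₄ A) (trans
    (cong₂ _-_ (cong₂ (λ d e → 0ℤ - W x y₁ * d + W x y₂ * e)
      (det₃ (λ r s → A (suc r) (punchIn 1F s))) (det₃ (λ r s → A (suc r) (punchIn 2F s))))
      (cong (_*_ (W x y₃)) (det₃ (λ r s → A (suc r) (punchIn 3F s)))))
    (lemma (W x y₁) (W x y₂) (W x y₃)))
    where
    A : Matrix 4 4
    A i j = bipartiteEntry W (List.lookup zs i) (List.lookup zs j)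
      where zs = merge (x ∷ []) (y₁ ∷ y₂ ∷ y₃ ∷ [])
    lemma : ∀ a b c → 0ℤ - a * (a * 0ℤ - 0ℤ + 0ℤ) + b * (a * 0ℤ - 0ℤ + 0ℤ) - c * (a * 0ℤ - 0ℤ + 0ℤ) ≡ 0ℤ
    lemma = solve-∀

  -- Moving the two blocks `M` and its transpose to the diagonal exchanges two pairs of columns, an
  -- even permutation, so the square carries the sign plus.
  det-bipartite-2-2 : ∀ x x′ y y′ →
    D (x ∷ x′ ∷ []) (y ∷ y′ ∷ []) ≡ (W x y * W x′ y′ - W x y′ * W x′ y) * (W x y * W x′ y′ - W x y′ * W x′ y)
  det-bipartite-2-2 x x′ y y′ = trans (det₄ A) (trans
    (cong₂ (λ d e → 0ℤ + W x y * d - W x y′ * e)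
      (det₃ (λ r s → A (suc r) (punchIn 2F s))) (det₃ (λ r s → A (suc r) (punchIn 3F s))))
    (lemma (W x y) (W x y′) (W x′ y) (W x′ y′)))
    where
    A : Matrix 4 4
    A i j = bipartiteEntry W (List.lookup zs i) (List.lookup zs j)
      where zs = merge (x ∷ x′ ∷ []) (y ∷ y′ ∷ [])
    lemma : ∀ a b c d →
      0ℤ + a * (0ℤ - 0ℤ + d * (a * d - c * b)) - b * (0ℤ - 0ℤ + c * (a * d - c * b)) ≡ (a * d - b * c) * (a * d - b * c)
    lemma = solve-∀

-- Counting the hyperedges through a set

⊥-⊆? : (α : Subset n) → does (⊥ ⊆? α) ≡ true
⊥-⊆? []      = refl
⊥-⊆? (_ ∷ α) = ⊥-⊆? α

⁅⁆-⊆? : ∀ x (α : Subset n) → does (⁅ x ⁆ ⊆? α) ≡ lookup α x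
⁅⁆-⊆? zero    (inside  ∷ α) = ⊥-⊆? α
⁅⁆-⊆? zero    (outside ∷ α) = refl
⁅⁆-⊆? (suc x) (_       ∷ α) = ⁅⁆-⊆? x α

∪-⊆? : ∀ (p q α : Subset n) → does ((p ∪ q) ⊆? α) ≡ does (p ⊆? α) ∧ does (q ⊆? α)
∪-⊆? []            []            []            = refl
∪-⊆? (inside  ∷ p) (_       ∷ q) (outside ∷ α) = refl
∪-⊆? (outside ∷ p) (inside  ∷ q) (outside ∷ α) = sym (Bool.∧-zeroʳ (does (p ⊆? α)))
∪-⊆? (outside ∷ p) (outside ∷ q) (_       ∷ α) = ∪-⊆? p q α
∪-⊆? (inside  ∷ p) (inside  ∷ q) (inside  ∷ α) = ∪-⊆? p q α
∪-⊆? (inside  ∷ p) (outside ∷ q) (inside  ∷ α) = ∪-⊆? p q α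
∪-⊆? (outside ∷ p) (inside  ∷ q) (inside  ∷ α) = ∪-⊆? p q α

𝟙-⁅⁆-⊆? : ∀ x (α : Subset n) → 𝟙 (does (⁅ x ⁆ ⊆? α)) ≡ 𝟙 (lookup α x)
𝟙-⁅⁆-⊆? x α = cong 𝟙 (⁅⁆-⊆? x α)

𝟙-pair-⊆? : ∀ x y (α : Subset n) → 𝟙 (does ((⁅ x ⁆ ∪ ⁅ y ⁆) ⊆? α)) ≡ 𝟙 (lookup α x) * 𝟙 (lookup α y)
𝟙-pair-⊆? x y α = trans
  (cong 𝟙 (trans (∪-⊆? ⁅ x ⁆ ⁅ y ⁆ α) (cong₂ _∧_ (⁅⁆-⊆? x α) (⁅⁆-⊆? y α))))
  (𝟙-∧ (lookup α x) (lookup α y))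

-- A superset is `S` with `j` elements of `∁ S` added: positions inside `S` are forced, and a
-- position outside gives Pascal's rule. For `j` = 0 an added element is impossible, since the rest
-- would be a superset of `S` of smaller size.
count-supersets : ∀ (S : Subset n) j →
  sumₛ (λ α → 𝟙 (does (S ⊆? α)) * 𝟙 (does (∣ α ∣ ℕₚ.≟ ∣ S ∣ ℕ.+ j))) ≡ + (∣ ∁ S ∣ C j)
count-supersets []                    zero    = refl
count-supersets []                    (suc j) = refl
count-supersets {suc n} (inside  ∷ S) j       = trans
  (cong₂ _+_ (count-supersets S j) (sumₛ-zero {n} λ _ → refl))
  (ℤₚ.+-identityʳ _)
count-supersets {suc n} (outside ∷ S) zero    = trans
  (cong₂ _+_ (sumₛ-zero too-small) (count-supersets S 0))
  (ℤₚ.+-identityˡ _)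
  where
  too-small : ∀ α → 𝟙 (does (S ⊆? α)) * 𝟙 (does (suc ∣ α ∣ ℕₚ.≟ ∣ S ∣ ℕ.+ 0)) ≡ 0ℤ
  too-small α with S ⊆? α
  ... | no  _   = refl
  ... | yes S⊆α = cong (λ b → 1ℤ * 𝟙 b) (dec-false (suc ∣ α ∣ ℕₚ.≟ ∣ S ∣ ℕ.+ 0) λ eq →
    ℕₚ.<-irrefl refl (ℕₚ.≤-trans (ℕₚ.≤-reflexive (trans eq (ℕₚ.+-identityʳ _))) (p⊆q⇒∣p∣≤∣q∣ S⊆α)))
count-supersets {suc n} (outside ∷ S) (suc j) = begin
  sumₛ {n} (λ α → 𝟙 (does (S ⊆? α)) * 𝟙 (does (suc ∣ α ∣ ℕₚ.≟ ∣ S ∣ ℕ.+ suc j)))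
    + sumₛ {n} (λ α → 𝟙 (does (S ⊆? α)) * 𝟙 (does (∣ α ∣ ℕₚ.≟ ∣ S ∣ ℕ.+ suc j)))
    ≡⟨ cong₂ _+_ (trans (sumₛ-cong λ α → cong (λ k → 𝟙 (does (S ⊆? α)) * 𝟙 (does (suc ∣ α ∣ ℕₚ.≟ k)))
                                                (ℕₚ.+-suc ∣ S ∣ j))
                        (count-supersets S j))
                 (count-supersets S (suc j)) ⟩
  + (∣ ∁ S ∣ C j) + + (∣ ∁ S ∣ C suc j)
    ≡⟨ cong +_ (nCk+nC[k+1]≡[n+1]C[k+1] ∣ ∁ S ∣ j) ⟩
  + (suc ∣ ∁ S ∣ C suc j) ∎

-- The indicator of a determinant value as a function of two rows and two columns

Quad : ℕ → ℕ → Set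
Quad m n = Fin m → Fin m → Fin n → Fin n → ℤ

-- The default `0ℤ` is the determinant of every 4-subset that does not split evenly, and it makes
-- the function supported on length two in each argument.
onPairs : Quad m n → List (Fin m) → List (Fin n) → ℤ
onPairs F (x ∷ x′ ∷ []) (y ∷ y′ ∷ []) = F x x′ y y′
onPairs F _             _             = 0ℤ

Ternary : ℤ → Set
Ternary i = i ≡ 0ℤ ⊎ i ≡ 1ℤ ⊎ i ≡ -1ℤ

ternary-* : ∀ {i j} → Ternary i → Ternary j → Ternary (i * j)
ternary-* (inj₁ refl)        _                  = inj₁ refl
ternary-* (inj₂ (inj₁ refl)) (inj₁ refl)        = inj₁ refl
ternary-* (inj₂ (inj₁ refl)) (inj₂ (inj₁ refl)) = inj₂ (inj₁ refl)
ternary-* (inj₂ (inj₁ refl)) (inj₂ (inj₂ refl)) = inj₂ (inj₂ refl)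
ternary-* (inj₂ (inj₂ refl)) (inj₁ refl)        = inj₁ refl
ternary-* (inj₂ (inj₂ refl)) (inj₂ (inj₁ refl)) = inj₂ (inj₂ refl)
ternary-* (inj₂ (inj₂ refl)) (inj₂ (inj₂ refl)) = inj₂ (inj₁ refl)

-- For p, q ∈ {0,1,-1} the square of p - q is 0, 1 or 4; unit p q indicates the
-- value 1 and four p q is twice the indicator of the value 4.
unit four : ℤ → ℤ → ℤ
unit p q = p * p + q * q - + 2 * ((p * p) * (q * q))
four p q = (p * p) * (q * q) - p * q

-- Of t sets of four vertices let f₁ have determinant 1, f₄/2 have determinant 4
-- and all others determinant 0.  Then weigh a t f₄ f₁ is twice the number of those
-- with determinant a, for a = 0 and a = 1.
weigh : ℤ → ℤ → ℤ → ℤ → ℤ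
weigh a t f₄ f₁ = (1ℤ - a) * (+ 2 * t - f₄) + (+ 2 * a - 1ℤ) * (+ 2 * f₁)

-- The square of `p - q` is 1 when exactly one of `p`, `q` vanishes, 4 when they are opposite units,
-- and 0 otherwise. Both sides are doubled because `four` is twice an indicator; the eighteen cases
-- compute.
indicator-minor : ∀ {a} → a ≡ 0ℤ ⊎ a ≡ 1ℤ → ∀ {p q} → Ternary p → Ternary q →
  + 2 * 𝟙 (does ((p - q) * (p - q) ℤₚ.≟ a)) ≡ weigh a 1ℤ (four p q) (unit p q)
indicator-minor (inj₁ refl) (inj₁ refl)        (inj₁ refl)        = refl
indicator-minor (inj₁ refl) (inj₁ refl)        (inj₂ (inj₁ refl)) = refl
indicator-minor (inj₁ refl) (inj₁ refl)        (inj₂ (inj₂ refl)) = refl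
indicator-minor (inj₁ refl) (inj₂ (inj₁ refl)) (inj₁ refl)        = refl
indicator-minor (inj₁ refl) (inj₂ (inj₁ refl)) (inj₂ (inj₁ refl)) = refl
indicator-minor (inj₁ refl) (inj₂ (inj₁ refl)) (inj₂ (inj₂ refl)) = refl
indicator-minor (inj₁ refl) (inj₂ (inj₂ refl)) (inj₁ refl)        = refl
indicator-minor (inj₁ refl) (inj₂ (inj₂ refl)) (inj₂ (inj₁ refl)) = refl
indicator-minor (inj₁ refl) (inj₂ (inj₂ refl)) (inj₂ (inj₂ refl)) = refl
indicator-minor (inj₂ refl) (inj₁ refl)        (inj₁ refl)        = refl
indicator-minor (inj₂ refl) (inj₁ refl)        (inj₂ (inj₁ refl)) = refl
indicator-minor (inj₂ refl) (inj₁ refl)        (inj₂ (inj₂ refl)) = refl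
indicator-minor (inj₂ refl) (inj₂ (inj₁ refl)) (inj₁ refl)        = refl
indicator-minor (inj₂ refl) (inj₂ (inj₁ refl)) (inj₂ (inj₁ refl)) = refl
indicator-minor (inj₂ refl) (inj₂ (inj₁ refl)) (inj₂ (inj₂ refl)) = refl
indicator-minor (inj₂ refl) (inj₂ (inj₂ refl)) (inj₁ refl)        = refl
indicator-minor (inj₂ refl) (inj₂ (inj₂ refl)) (inj₂ (inj₁ refl)) = refl
indicator-minor (inj₂ refl) (inj₂ (inj₂ refl)) (inj₂ (inj₂ refl)) = refl

module _ (W : Matrix m n) where

  unitMinor fourMinor : Quad m n
  unitMinor x x′ y y′ = unit (W x y * W x′ y′) (W x y′ * W x′ y)
  fourMinor x x′ y y′ = four (W x y * W x′ y′) (W x y′ * W x′ y)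

  private
    squaredMinor : List (Fin m) → List (Fin n) → ℤ
    squaredMinor = onPairs λ x x′ y y′ →
      (W x y * W x′ y′ - W x y′ * W x′ y) * (W x y * W x′ y′ - W x y′ * W x′ y)

  detOn-bipartite : ∀ xs ys → length (merge xs ys) ≡ 4 →
                    detOn (bipartiteEntry W) (merge xs ys) ≡ squaredMinor xs ys
  detOn-bipartite []                       []                           ()
  detOn-bipartite []                       (_ ∷ [])                     ()
  detOn-bipartite []                       (_ ∷ _ ∷ [])                 ()
  detOn-bipartite []                       (_ ∷ _ ∷ _ ∷ [])             ()
  detOn-bipartite []                       (a ∷ b ∷ c ∷ d ∷ [])         _ = det-bipartite-0-4 W a b c d
  detOn-bipartite []                       (_ ∷ _ ∷ _ ∷ _ ∷ _ ∷ _)      ()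
  detOn-bipartite (_ ∷ [])                 []                           ()
  detOn-bipartite (_ ∷ [])                 (_ ∷ [])                     ()
  detOn-bipartite (_ ∷ [])                 (_ ∷ _ ∷ [])                 ()
  detOn-bipartite (a ∷ [])                 (b ∷ c ∷ d ∷ [])             _ = det-bipartite-1-3 W a b c d
  detOn-bipartite (_ ∷ [])                 (_ ∷ _ ∷ _ ∷ _ ∷ _)          ()
  detOn-bipartite (_ ∷ _ ∷ [])             []                           ()
  detOn-bipartite (_ ∷ _ ∷ [])             (_ ∷ [])                     ()
  detOn-bipartite (x ∷ x′ ∷ [])            (y ∷ y′ ∷ [])                _ = det-bipartite-2-2 W x x′ y y′
  detOn-bipartite (_ ∷ _ ∷ [])             (_ ∷ _ ∷ _ ∷ _)              ()
  detOn-bipartite (_ ∷ _ ∷ _ ∷ [])         []                           ()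
  detOn-bipartite (a ∷ b ∷ c ∷ [])         (d ∷ [])                     _ = det-bipartite-3-1 W a b c d
  detOn-bipartite (_ ∷ _ ∷ _ ∷ [])         (_ ∷ _ ∷ _)                  ()
  detOn-bipartite (a ∷ b ∷ c ∷ d ∷ [])     []                           _ = det-bipartite-4-0 W a b c d
  detOn-bipartite (_ ∷ _ ∷ _ ∷ _ ∷ [])     (_ ∷ _)                      ()
  detOn-bipartite (_ ∷ _ ∷ _ ∷ _ ∷ _ ∷ _)  _                            ()

  module _ (W-ternary : ∀ i j → Ternary (W i j)) {a : ℤ} (a∈01 : a ≡ 0ℤ ⊎ a ≡ 1ℤ) where

    private
      Claim : ℤ → List (Fin m) → List (Fin n) → Set
      Claim d xs ys =
        let 𝟙₄ = 𝟙 (does (length (merge xs ys) ℕₚ.≟ 4)) in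
        + 2 * (𝟙₄ * 𝟙 (does (d ℤₚ.≟ a))) ≡ weigh a 𝟙₄ (onPairs fourMinor xs ys) (onPairs unitMinor xs ys)

      -- With `b` telling whether the size is 4, this covers both reasons for zero weights: a wrong
      -- size, where all terms vanish, and a singular 4-subset, counted by `t` alone.
      det-vanishes : ∀ b d → (b ≡ true → d ≡ 0ℤ) →
                     + 2 * (𝟙 b * 𝟙 (does (d ℤₚ.≟ a))) ≡ weigh a (𝟙 b) 0ℤ 0ℤ
      det-vanishes false d _   = lemma a
        where
        lemma : ∀ a → 0ℤ ≡ (1ℤ - a) * (+ 2 * 0ℤ - 0ℤ) + (+ 2 * a - 1ℤ) * (+ 2 * 0ℤ)
        lemma = solve-∀
      det-vanishes true  d d≡0 = trans (cong (λ d → + 2 * (1ℤ * 𝟙 (does (d ℤₚ.≟ a)))) (d≡0 refl)) (go a∈01)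
        where
        go : ∀ {a} → a ≡ 0ℤ ⊎ a ≡ 1ℤ → + 2 * (1ℤ * 𝟙 (does (0ℤ ℤₚ.≟ a))) ≡ weigh a 1ℤ 0ℤ 0ℤ
        go (inj₁ refl) = refl
        go (inj₂ refl) = refl

      off-pairs : ∀ d (xs : List (Fin m)) (ys : List (Fin n)) → (length (merge xs ys) ≡ 4 → d ≡ 0ℤ) →
                  let 𝟙₄ = 𝟙 (does (length (merge xs ys) ℕₚ.≟ 4)) in
                  + 2 * (𝟙₄ * 𝟙 (does (d ℤₚ.≟ a))) ≡ weigh a 𝟙₄ 0ℤ 0ℤ
      off-pairs d xs ys d≡0 = det-vanishes (does (length (merge xs ys) ℕₚ.≟ 4)) d
        (d≡0 ∘ dec-does⁻ (length (merge xs ys) ℕₚ.≟ 4))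
        where
        dec-does⁻ : ∀ {P : Set} (p? : Dec P) → does p? ≡ true → P
        dec-does⁻ (yes p) _ = p

      -- The determinant is generalised to `d`, so that splitting the lists does not unfold it; its
      -- value is used only at size 4.
      claim : ∀ d xs ys → (length (merge xs ys) ≡ 4 → d ≡ squaredMinor xs ys) → Claim d xs ys
      claim d []                    ys                      = off-pairs d [] ys
      claim d xs@(_ ∷ [])           ys                      = off-pairs d xs ys
      claim d xs@(_ ∷ _ ∷ [])       []                      = off-pairs d xs []
      claim d xs@(_ ∷ _ ∷ [])       ys@(_ ∷ [])             = off-pairs d xs ys
      claim d (x ∷ x′ ∷ [])         (y ∷ y′ ∷ [])           = λ d≡v →
        let p = W x y * W x′ y′
            q = W x y′ * W x′ y in trans
        (cong (λ d → + 2 * (1ℤ * 𝟙 (does (d ℤₚ.≟ a)))) (d≡v refl))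
        (trans (cong (+ 2 *_) (ℤₚ.*-identityˡ (𝟙 (does ((p - q) * (p - q) ℤₚ.≟ a)))))
               (indicator-minor a∈01 (ternary-* (W-ternary x y) (W-ternary x′ y′))
                                     (ternary-* (W-ternary x y′) (W-ternary x′ y))))
      claim d xs@(_ ∷ _ ∷ [])       ys@(_ ∷ _ ∷ _ ∷ _)      = off-pairs d xs ys
      claim d xs@(_ ∷ _ ∷ _ ∷ _)    ys                      = off-pairs d xs ys

    indicator-det : ∀ xs ys → Claim (detOn (bipartiteEntry W) (merge xs ys)) xs ys
    indicator-det xs ys = claim (detOn (bipartiteEntry W) (merge xs ys)) xs ys (detOn-bipartite xs ys)

sumOnPairs : Quad m n → Subset (m ℕ.+ n) → ℤ
sumOnPairs {m} {n} F S =
  sumₛ {m} λ β → sumₛ {n} λ γ → 𝟙 (does (S ⊆? β Vec.++ γ)) * onPairs F (elements β) (elements γ)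

∣++∣≡length-merge : ∀ (β : Subset m) (γ : Subset n) →
                    ∣ β Vec.++ γ ∣ ≡ length (merge (elements β) (elements γ))
∣++∣≡length-merge {m} {n} β γ = trans (sym (length-elements (β Vec.++ γ)))
  (trans (cong length (elements-merge β γ)) (List.length-map (join m n) (merge (elements β) (elements γ))))

sumₛ-linear : ∀ a b c (f g h : Subset n → ℤ) →
  sumₛ (λ α → a * f α + b * g α + c * h α) ≡ a * sumₛ f + b * sumₛ g + c * sumₛ h
sumₛ-linear a b c f g h = trans
  (sumₛ-distrib-+ (λ α → a * f α + b * g α) (λ α → c * h α))
  (cong₂ _+_ (trans (sumₛ-distrib-+ (λ α → a * f α) (λ α → b * g α))
                    (sym (cong₂ _+_ (*-distribˡ-sumₛ a f) (*-distribˡ-sumₛ b g))))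
             (sym (*-distribˡ-sumₛ c h)))

module _ (W : Matrix m n) (W-ternary : ∀ i j → Ternary (W i j)) {a : ℤ} (a∈01 : a ≡ 0ℤ ⊎ a ≡ 1ℤ) where

  private
    F₁ = unitMinor W
    F₄ = fourMinor W

    c₁ c₂ c₃ : ℤ
    c₁ = (1ℤ - a) * + 2
    c₂ = - (1ℤ - a)
    c₃ = (+ 2 * a - 1ℤ) * + 2

    weigh-linear : ∀ a t f₄ f₁ →
      (1ℤ - a) * (+ 2 * t - f₄) + (+ 2 * a - 1ℤ) * (+ 2 * f₁)
        ≡ (1ℤ - a) * + 2 * t + (- (1ℤ - a)) * f₄ + (+ 2 * a - 1ℤ) * + 2 * f₁
    weigh-linear = solve-∀

    weigh-scale : ∀ s a t f₄ f₁ →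
      s * ((1ℤ - a) * (+ 2 * t - f₄) + (+ 2 * a - 1ℤ) * (+ 2 * f₁))
        ≡ (1ℤ - a) * + 2 * (s * t) + (- (1ℤ - a)) * (s * f₄) + (+ 2 * a - 1ℤ) * + 2 * (s * f₁)
    weigh-scale = solve-∀

    2*[b*s] : ∀ b s → + 2 * (b * s) ≡ s * (+ 2 * b)
    2*[b*s] = solve-∀

  module _ (S : Subset (m ℕ.+ n)) (j : ℕ) (|S|+j≡4 : ∣ S ∣ ℕ.+ j ≡ 4) where

    private
      t f₁ f₄ : Subset m → Subset n → ℤ
      t  β γ = 𝟙 (does (S ⊆? β Vec.++ γ)) * 𝟙 (does (∣ β Vec.++ γ ∣ ℕₚ.≟ 4))
      f₁ β γ = 𝟙 (does (S ⊆? β Vec.++ γ)) * onPairs F₁ (elements β) (elements γ)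
      f₄ β γ = 𝟙 (does (S ⊆? β Vec.++ γ)) * onPairs F₄ (elements β) (elements γ)

      pointwise : ∀ β γ →
        + 2 * 𝟙 (does (edge? (𝓗 (bipartite W) 4 a) (β Vec.++ γ) ×-dec S ⊆? β Vec.++ γ))
          ≡ c₁ * t β γ + c₂ * f₄ β γ + c₃ * f₁ β γ
      pointwise β γ = begin
        + 2 * 𝟙 ((does (∣ α ∣ ℕₚ.≟ 4) ∧ does (det (principal (bipartite W) α) ℤₚ.≟ a)) ∧ does (S ⊆? α))
          ≡⟨ cong (+ 2 *_) (trans (𝟙-∧ (does (∣ α ∣ ℕₚ.≟ 4) ∧ does (det (principal (bipartite W) α) ℤₚ.≟ a)) _)
               (cong (_* s) (𝟙-∧ (does (∣ α ∣ ℕₚ.≟ 4)) _))) ⟩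
        + 2 * (𝟙 (does (∣ α ∣ ℕₚ.≟ 4)) * 𝟙 (does (det (principal (bipartite W) α) ℤₚ.≟ a)) * s)
          ≡⟨ 2*[b*s] (𝟙 (does (∣ α ∣ ℕₚ.≟ 4)) * 𝟙 (does (det (principal (bipartite W) α) ℤₚ.≟ a))) s ⟩
        s * (+ 2 * (𝟙 (does (∣ α ∣ ℕₚ.≟ 4)) * 𝟙 (does (det (principal (bipartite W) α) ℤₚ.≟ a))))
          ≡⟨ cong (s *_) (trans
               (cong₂ (λ l d → + 2 * (𝟙 (does (l ℕₚ.≟ 4)) * 𝟙 (does (d ℤₚ.≟ a))))
                 (∣++∣≡length-merge β γ) (det-principal-bipartite W β γ))
               (indicator-det W W-ternary a∈01 (elements β) (elements γ))) ⟩
        s * weigh a (𝟙 (does (length (merge (elements β) (elements γ)) ℕₚ.≟ 4))) w₄ w₁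
          ≡⟨ cong (λ l → s * weigh a (𝟙 (does (l ℕₚ.≟ 4))) w₄ w₁) (∣++∣≡length-merge β γ) ⟨
        s * weigh a (𝟙 (does (∣ α ∣ ℕₚ.≟ 4))) w₄ w₁
          ≡⟨ weigh-scale s a (𝟙 (does (∣ α ∣ ℕₚ.≟ 4))) w₄ w₁ ⟩
        c₁ * t β γ + c₂ * f₄ β γ + c₃ * f₁ β γ ∎
        where
        α  = β Vec.++ γ
        s  = 𝟙 (does (S ⊆? α))
        w₄ = onPairs F₄ (elements β) (elements γ)
        w₁ = onPairs F₁ (elements β) (elements γ)

    -- `weigh` is linear in its last three arguments, so the pointwise identity can be summed over
    -- all supersets of `S`; the coefficients `c₁`, `c₂`, `c₃` are those of this linear form.
    degree-𝓗 : + 2 * + degree (𝓗 (bipartite W) 4 a) S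
                 ≡ weigh a (+ (∣ ∁ S ∣ C j)) (sumOnPairs F₄ S) (sumOnPairs F₁ S)
    degree-𝓗 = begin
      + 2 * + degree (𝓗 (bipartite W) 4 a) S
        ≡⟨ cong (+ 2 *_) (length-filter-subsets (λ e → edge? (𝓗 (bipartite W) 4 a) e ×-dec S ⊆? e)) ⟩
      + 2 * sumₛ {m ℕ.+ n} (λ α → E α)
        ≡⟨ *-distribˡ-sumₛ (+ 2) E ⟩
      sumₛ {m ℕ.+ n} (λ α → + 2 * E α)
        ≡⟨ sumₛ-++ m (λ α → + 2 * E α) ⟩
      sumₛ {m} (λ β → sumₛ {n} (λ γ → + 2 * E (β Vec.++ γ)))
        ≡⟨ sumₛ-cong {m} (λ β → trans (sumₛ-cong {n} (pointwise β)) (sumₛ-linear c₁ c₂ c₃ (t β) (f₄ β) (f₁ β))) ⟩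
      sumₛ {m} (λ β → c₁ * sumₛ {n} (t β) + c₂ * sumₛ {n} (f₄ β) + c₃ * sumₛ {n} (f₁ β))
        ≡⟨ sumₛ-linear {m} c₁ c₂ c₃ (λ β → sumₛ (t β)) (λ β → sumₛ (f₄ β)) (λ β → sumₛ (f₁ β)) ⟩
      c₁ * sumₛ {m} (λ β → sumₛ {n} (t β)) + c₂ * sumOnPairs F₄ S + c₃ * sumOnPairs F₁ S
        ≡⟨ cong (λ T → c₁ * T + c₂ * sumOnPairs F₄ S + c₃ * sumOnPairs F₁ S) total ⟩
      c₁ * + (∣ ∁ S ∣ C j) + c₂ * sumOnPairs F₄ S + c₃ * sumOnPairs F₁ S
        ≡⟨ weigh-linear a (+ (∣ ∁ S ∣ C j)) (sumOnPairs F₄ S) (sumOnPairs F₁ S) ⟨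
      weigh a (+ (∣ ∁ S ∣ C j)) (sumOnPairs F₄ S) (sumOnPairs F₁ S) ∎
      where
      E : Subset (m ℕ.+ n) → ℤ
      E α = 𝟙 (does (edge? (𝓗 (bipartite W) 4 a) α ×-dec S ⊆? α))

      total : sumₛ {m} (λ β → sumₛ {n} (t β)) ≡ + (∣ ∁ S ∣ C j)
      total = begin
        sumₛ {m} (λ β → sumₛ {n} (t β))
          ≡⟨ sumₛ-++ m (λ α → 𝟙 (does (S ⊆? α)) * 𝟙 (does (∣ α ∣ ℕₚ.≟ 4))) ⟨
        sumₛ {m ℕ.+ n} (λ α → 𝟙 (does (S ⊆? α)) * 𝟙 (does (∣ α ∣ ℕₚ.≟ 4)))
          ≡⟨ cong (λ l → sumₛ (λ α → 𝟙 (does (S ⊆? α)) * 𝟙 (does (∣ α ∣ ℕₚ.≟ l)))) |S|+j≡4 ⟨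
        sumₛ {m ℕ.+ n} (λ α → 𝟙 (does (S ⊆? α)) * 𝟙 (does (∣ α ∣ ℕₚ.≟ ∣ S ∣ ℕ.+ j)))
          ≡⟨ count-supersets S j ⟩
        + (∣ ∁ S ∣ C j) ∎

-- From subsets to ordered pairs of rows and of columns

record AlternatingQuad (F : Quad m n) : Set where
  field
    row-symmetric : ∀ x x′ y y′ → F x x′ y y′ ≡ F x′ x y y′
    row-diagonal  : ∀ x y y′ → F x x y y′ ≡ 0ℤ
    col-symmetric : ∀ x x′ y y′ → F x x′ y y′ ≡ F x x′ y′ y
    col-diagonal  : ∀ x x′ y → F x x′ y y ≡ 0ℤ

open AlternatingQuad

swap : Quad m n → Quad n m
swap F y y′ x x′ = F x x′ y y′

swap-alternating : {F : Quad m n} → AlternatingQuad F → AlternatingQuad (swap F)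
swap-alternating F-alt = record
  { row-symmetric = λ y y′ x x′ → col-symmetric F-alt x x′ y y′
  ; row-diagonal  = λ y x x′ → col-diagonal F-alt x x′ y
  ; col-symmetric = λ y y′ x x′ → row-symmetric F-alt x x′ y y′
  ; col-diagonal  = λ y y′ x → row-diagonal F-alt x y y′
  }

onPairs-swap : (F : Quad m n) → ∀ xs ys → onPairs (swap F) ys xs ≡ onPairs F xs ys
onPairs-swap F []              []              = refl
onPairs-swap F []              (_ ∷ [])        = refl
onPairs-swap F []              (_ ∷ _ ∷ [])    = refl
onPairs-swap F []              (_ ∷ _ ∷ _ ∷ _) = refl
onPairs-swap F (_ ∷ [])        []              = refl
onPairs-swap F (_ ∷ [])        (_ ∷ [])        = refl
onPairs-swap F (_ ∷ [])        (_ ∷ _ ∷ [])    = refl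
onPairs-swap F (_ ∷ [])        (_ ∷ _ ∷ _ ∷ _) = refl
onPairs-swap F (_ ∷ _ ∷ [])    []              = refl
onPairs-swap F (_ ∷ _ ∷ [])    (_ ∷ [])        = refl
onPairs-swap F (_ ∷ _ ∷ [])    (_ ∷ _ ∷ [])    = refl
onPairs-swap F (_ ∷ _ ∷ [])    (_ ∷ _ ∷ _ ∷ _) = refl
onPairs-swap F (_ ∷ _ ∷ _ ∷ _) []              = refl
onPairs-swap F (_ ∷ _ ∷ _ ∷ _) (_ ∷ [])        = refl
onPairs-swap F (_ ∷ _ ∷ _ ∷ _) (_ ∷ _ ∷ [])    = refl
onPairs-swap F (_ ∷ _ ∷ _ ∷ _) (_ ∷ _ ∷ _ ∷ _) = refl

onPairs-alternatingˡ : {F : Quad m n} → AlternatingQuad F → ∀ ys → Alternating (λ xs → onPairs F xs ys)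
onPairs-alternatingˡ {m} {n} {F} F-alt ys = record
  { supported = supp
  ; symmetric = λ x x′ → sym-ys x x′ ys
  ; diagonal  = λ x → diag x ys
  }
  where
  supp : SupportedOnLength 2 (λ xs → onPairs F xs ys)
  supp []              _ = refl
  supp (_ ∷ [])        _ = refl
  supp (_ ∷ _ ∷ [])    |xs|≢2 = contradiction refl |xs|≢2
  supp (_ ∷ _ ∷ _ ∷ _) _ = refl

  sym-ys : ∀ x x′ ys → onPairs F (x ∷ x′ ∷ []) ys ≡ onPairs F (x′ ∷ x ∷ []) ys
  sym-ys x x′ []              = refl
  sym-ys x x′ (_ ∷ [])        = refl
  sym-ys x x′ (y ∷ y′ ∷ [])   = row-symmetric F-alt x x′ y y′
  sym-ys x x′ (_ ∷ _ ∷ _ ∷ _) = refl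

  diag : ∀ x ys → onPairs F (x ∷ x ∷ []) ys ≡ 0ℤ
  diag x []              = refl
  diag x (_ ∷ [])        = refl
  diag x (y ∷ y′ ∷ [])   = row-diagonal F-alt x y y′
  diag x (_ ∷ _ ∷ _ ∷ _) = refl

alternating-cong : {f g : List (Fin n) → ℤ} → f ≗ g → Alternating f → Alternating g
alternating-cong f≗g f-alt = record
  { supported = λ xs |xs|≢2 → trans (sym (f≗g xs)) (supported f-alt xs |xs|≢2)
  ; symmetric = λ x y → trans (sym (f≗g _)) (trans (symmetric f-alt x y) (f≗g _))
  ; diagonal  = λ x → trans (sym (f≗g _)) (diagonal f-alt x)
  }

onPairs-alternatingʳ : {F : Quad m n} → AlternatingQuad F → ∀ xs → Alternating (onPairs F xs)
onPairs-alternatingʳ {F = F} F-alt xs =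
  alternating-cong (onPairs-swap F xs) (onPairs-alternatingˡ (swap-alternating F-alt) xs)

sum-alternating : {g : Fin k → List (Fin n) → ℤ} → (∀ i → Alternating (g i)) →
                  Alternating (λ xs → ∑[ i < k ] g i xs)
sum-alternating g-alt = record
  { supported = λ xs |xs|≢2 → sum-zero λ i → supported (g-alt i) xs |xs|≢2
  ; symmetric = λ x y → sum-cong-≗ λ i → symmetric (g-alt i) x y
  ; diagonal  = λ x → sum-zero λ i → diagonal (g-alt i) x
  }

module _ {F : Quad m n} (F-alt : AlternatingQuad F) where

  private
    w : Subset m → Subset n → ℤ
    w β γ = onPairs F (elements β) (elements γ)

    g : List (Fin m) → ℤ
    g xs = ∑[ y < n ] ∑[ y′ < n ] onPairs F xs (y ∷ y′ ∷ [])

    g-alt : Alternating g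
    g-alt = sum-alternating λ y → sum-alternating λ y′ → onPairs-alternatingˡ F-alt (y ∷ y′ ∷ [])

    2*[a*b] : ∀ a b → + 2 * (a * b) ≡ a * (+ 2 * b)
    2*[a*b] = solve-∀

    -- The weight depends only on the row part, so the 2-subsets of columns can be replaced by
    -- ordered pairs; this is what the factor 2 pays for.
    sum-weighted : ∀ (μ : Subset m → ℤ) →
      + 2 * sumₛ {m} (λ β → sumₛ {n} (λ γ → μ β * w β γ)) ≡ sumₛ {m} (λ β → μ β * g (elements β))
    sum-weighted μ = begin
      + 2 * sumₛ {m} (λ β → sumₛ {n} (λ γ → μ β * w β γ))
        ≡⟨ *-distribˡ-sumₛ (+ 2) (λ β → sumₛ {n} (λ γ → μ β * w β γ)) ⟩
      sumₛ {m} (λ β → + 2 * sumₛ {n} (λ γ → μ β * w β γ))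
        ≡⟨ sumₛ-cong (λ β → trans (cong (+ 2 *_) (sym (*-distribˡ-sumₛ (μ β) (w β)))) (2*[a*b] (μ β) (sumₛ (w β)))) ⟩
      sumₛ {m} (λ β → μ β * (+ 2 * sumₛ {n} (w β)))
        ≡⟨ sumₛ-cong (λ β → cong (μ β *_) (sumₛ-pairs (onPairs-alternatingʳ F-alt (elements β)))) ⟩
      sumₛ {m} (λ β → μ β * g (elements β)) ∎

  -- The row pair is ordered by its prescribed member `x`; only the column pair is free, hence a
  -- single factor 2.
  sumOnPairs-left : ∀ x → + 2 * sumOnPairs F ⁅ x ↑ˡ n ⁆ ≡ ∑[ x′ < m ] ∑[ y < n ] ∑[ y′ < n ] F x x′ y y′
  sumOnPairs-left x = begin
    + 2 * sumOnPairs F ⁅ x ↑ˡ n ⁆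
      ≡⟨ cong (+ 2 *_) (sumₛ-cong λ β → sumₛ-cong λ γ → cong (_* w β γ)
           (trans (𝟙-⁅⁆-⊆? (x ↑ˡ n) (β Vec.++ γ)) (cong 𝟙 (Vec.lookup-++ˡ β γ x)))) ⟩
    + 2 * sumₛ {m} (λ β → sumₛ {n} (λ γ → 𝟙 (lookup β x) * w β γ))
      ≡⟨ sum-weighted (λ β → 𝟙 (lookup β x)) ⟩
    sumₛ {m} (λ β → 𝟙 (lookup β x) * g (elements β))
      ≡⟨ sumₛ-∈-pairs g-alt x ⟩
    ∑[ x′ < m ] g (x ∷ x′ ∷ []) ∎

  sumOnPairs-left-left : ∀ {x x′} → x ≢ x′ →
    + 2 * sumOnPairs F (⁅ x ↑ˡ n ⁆ ∪ ⁅ x′ ↑ˡ n ⁆) ≡ ∑[ y < n ] ∑[ y′ < n ] F x x′ y y′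
  sumOnPairs-left-left {x} {x′} x≢x′ = begin
    + 2 * sumOnPairs F (⁅ x ↑ˡ n ⁆ ∪ ⁅ x′ ↑ˡ n ⁆)
      ≡⟨ cong (+ 2 *_) (sumₛ-cong λ β → sumₛ-cong λ γ → cong (_* w β γ)
           (trans (𝟙-pair-⊆? (x ↑ˡ n) (x′ ↑ˡ n) (β Vec.++ γ))
                  (cong₂ (λ b c → 𝟙 b * 𝟙 c) (Vec.lookup-++ˡ β γ x) (Vec.lookup-++ˡ β γ x′)))) ⟩
    + 2 * sumₛ {m} (λ β → sumₛ {n} (λ γ → 𝟙 (lookup β x) * 𝟙 (lookup β x′) * w β γ))
      ≡⟨ sum-weighted (λ β → 𝟙 (lookup β x) * 𝟙 (lookup β x′)) ⟩
    sumₛ {m} (λ β → 𝟙 (lookup β x) * 𝟙 (lookup β x′) * g (elements β))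
      ≡⟨ sumₛ-cong (λ β → ℤₚ.*-assoc (𝟙 (lookup β x)) (𝟙 (lookup β x′)) (g (elements β))) ⟩
    sumₛ {m} (λ β → 𝟙 (lookup β x) * (𝟙 (lookup β x′) * g (elements β)))
      ≡⟨ sumₛ-∈∈-pairs g-alt x≢x′ ⟩
    g (x ∷ x′ ∷ []) ∎

  -- Both pairs are ordered by a prescribed member, so no doubling occurs.
  sumOnPairs-left-right : ∀ x y →
    sumOnPairs F (⁅ x ↑ˡ n ⁆ ∪ ⁅ m ↑ʳ y ⁆) ≡ ∑[ x′ < m ] ∑[ y′ < n ] F x x′ y y′
  sumOnPairs-left-right x y = begin
    sumOnPairs F (⁅ x ↑ˡ n ⁆ ∪ ⁅ m ↑ʳ y ⁆)
      ≡⟨ sumₛ-cong (λ β → sumₛ-cong λ γ → trans (cong (_* w β γ)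
           (trans (𝟙-pair-⊆? (x ↑ˡ n) (m ↑ʳ y) (β Vec.++ γ))
                  (cong₂ (λ b c → 𝟙 b * 𝟙 c) (Vec.lookup-++ˡ β γ x) (Vec.lookup-++ʳ β γ y))))
           (ℤₚ.*-assoc (𝟙 (lookup β x)) (𝟙 (lookup γ y)) (w β γ))) ⟩
    sumₛ {m} (λ β → sumₛ {n} (λ γ → 𝟙 (lookup β x) * (𝟙 (lookup γ y) * w β γ)))
      ≡⟨ sumₛ-cong (λ β → trans (sym (*-distribˡ-sumₛ (𝟙 (lookup β x)) (λ γ → 𝟙 (lookup γ y) * w β γ)))
           (cong (𝟙 (lookup β x) *_) (sumₛ-∈-pairs (onPairs-alternatingʳ F-alt (elements β)) y))) ⟩
    sumₛ {m} (λ β → 𝟙 (lookup β x) * ∑[ y′ < n ] onPairs F (elements β) (y ∷ y′ ∷ []))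
      ≡⟨ sumₛ-∈-pairs (sum-alternating λ y′ → onPairs-alternatingˡ F-alt (y ∷ y′ ∷ [])) x ⟩
    ∑[ x′ < m ] ∑[ y′ < n ] F x x′ y y′ ∎

-- Exchanges the two sides of the bipartition, so the counts through columns follow from those
-- through rows.
sumOnPairs-swap : (F : Quad m n) (S : Subset (m ℕ.+ n)) (S′ : Subset (n ℕ.+ m)) →
  (∀ β γ → 𝟙 (does (S ⊆? β Vec.++ γ)) ≡ 𝟙 (does (S′ ⊆? γ Vec.++ β))) →
  sumOnPairs F S ≡ sumOnPairs (swap F) S′
sumOnPairs-swap {m} {n} F S S′ S≈S′ = trans
  (sumₛ-cong λ β → sumₛ-cong λ γ →
    cong₂ _*_ (S≈S′ β γ) (sym (onPairs-swap F (elements β) (elements γ))))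
  (sumₛ-comm {m} {n} λ β γ → 𝟙 (does (S′ ⊆? γ Vec.++ β)) * onPairs (swap F) (elements γ) (elements β))

module _ {F : Quad m n} (F-alt : AlternatingQuad F) where

  sumOnPairs-right : ∀ y → + 2 * sumOnPairs F ⁅ m ↑ʳ y ⁆ ≡ ∑[ y′ < n ] ∑[ x < m ] ∑[ x′ < m ] F x x′ y y′
  sumOnPairs-right y = trans
    (cong (+ 2 *_) (sumOnPairs-swap F ⁅ m ↑ʳ y ⁆ ⁅ y ↑ˡ m ⁆ λ β γ → begin
      𝟙 (does (⁅ m ↑ʳ y ⁆ ⊆? β Vec.++ γ)) ≡⟨ 𝟙-⁅⁆-⊆? (m ↑ʳ y) (β Vec.++ γ) ⟩
      𝟙 (lookup (β Vec.++ γ) (m ↑ʳ y))    ≡⟨ cong 𝟙 (Vec.lookup-++ʳ β γ y) ⟩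
      𝟙 (lookup γ y)                      ≡⟨ cong 𝟙 (Vec.lookup-++ˡ γ β y) ⟨
      𝟙 (lookup (γ Vec.++ β) (y ↑ˡ m))    ≡⟨ 𝟙-⁅⁆-⊆? (y ↑ˡ m) (γ Vec.++ β) ⟨
      𝟙 (does (⁅ y ↑ˡ m ⁆ ⊆? γ Vec.++ β)) ∎))
    (sumOnPairs-left (swap-alternating F-alt) y)

  sumOnPairs-right-right : ∀ {y y′} → y ≢ y′ →
    + 2 * sumOnPairs F (⁅ m ↑ʳ y ⁆ ∪ ⁅ m ↑ʳ y′ ⁆) ≡ ∑[ x < m ] ∑[ x′ < m ] F x x′ y y′
  sumOnPairs-right-right {y} {y′} y≢y′ = trans
    (cong (+ 2 *_) (sumOnPairs-swap F (⁅ m ↑ʳ y ⁆ ∪ ⁅ m ↑ʳ y′ ⁆) (⁅ y ↑ˡ m ⁆ ∪ ⁅ y′ ↑ˡ m ⁆) λ β γ → begin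
      𝟙 (does ((⁅ m ↑ʳ y ⁆ ∪ ⁅ m ↑ʳ y′ ⁆) ⊆? β Vec.++ γ))
        ≡⟨ 𝟙-pair-⊆? (m ↑ʳ y) (m ↑ʳ y′) (β Vec.++ γ) ⟩
      𝟙 (lookup (β Vec.++ γ) (m ↑ʳ y)) * 𝟙 (lookup (β Vec.++ γ) (m ↑ʳ y′))
        ≡⟨ cong₂ (λ b c → 𝟙 b * 𝟙 c) (Vec.lookup-++ʳ β γ y) (Vec.lookup-++ʳ β γ y′) ⟩
      𝟙 (lookup γ y) * 𝟙 (lookup γ y′)
        ≡⟨ cong₂ (λ b c → 𝟙 b * 𝟙 c) (Vec.lookup-++ˡ γ β y) (Vec.lookup-++ˡ γ β y′) ⟨
      𝟙 (lookup (γ Vec.++ β) (y ↑ˡ m)) * 𝟙 (lookup (γ Vec.++ β) (y′ ↑ˡ m))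
        ≡⟨ 𝟙-pair-⊆? (y ↑ˡ m) (y′ ↑ˡ m) (γ Vec.++ β) ⟨
      𝟙 (does ((⁅ y ↑ˡ m ⁆ ∪ ⁅ y′ ↑ˡ m ⁆) ⊆? γ Vec.++ β)) ∎))
    (sumOnPairs-left-left (swap-alternating F-alt) y≢y′)

module _ (W : Matrix m n) (W-ternary : ∀ i j → Ternary (W i j)) where

  private
    unit-comm : ∀ p q → p * p + q * q - + 2 * ((p * p) * (q * q)) ≡ q * q + p * p - + 2 * ((q * q) * (p * p))
    unit-comm = solve-∀

    four-comm : ∀ p q → (p * p) * (q * q) - p * q ≡ (q * q) * (p * p) - q * p
    four-comm = solve-∀

    unit-diagonal : ∀ {p} → Ternary p → unit p p ≡ 0ℤ
    unit-diagonal (inj₁ refl)        = refl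
    unit-diagonal (inj₂ (inj₁ refl)) = refl
    unit-diagonal (inj₂ (inj₂ refl)) = refl

    four-diagonal : ∀ {p} → Ternary p → four p p ≡ 0ℤ
    four-diagonal (inj₁ refl)        = refl
    four-diagonal (inj₂ (inj₁ refl)) = refl
    four-diagonal (inj₂ (inj₂ refl)) = refl

    -- Exchanging two rows or two columns exchanges the two products of the minor, and a repeated
    -- line makes them equal. For `unit` and `four` the diagonal value is a multiple of p² - p⁴,
    -- which is zero on ternary values.
    minor-alternating : ∀ {f : ℤ → ℤ → ℤ} → (∀ p q → f p q ≡ f q p) → (∀ {p} → Ternary p → f p p ≡ 0ℤ) →
      AlternatingQuad (λ x x′ y y′ → f (W x y * W x′ y′) (W x y′ * W x′ y))
    minor-alternating {f} f-comm f-diag = record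
      { row-symmetric = λ x x′ y y′ → trans (f-comm (W x y * W x′ y′) (W x y′ * W x′ y))
          (cong₂ f (ℤₚ.*-comm (W x y′) (W x′ y)) (ℤₚ.*-comm (W x y) (W x′ y′)))
      ; row-diagonal  = λ x y y′ → trans
          (cong (f (W x y * W x y′)) (ℤₚ.*-comm (W x y′) (W x y)))
          (f-diag (ternary-* (W-ternary x y) (W-ternary x y′)))
      ; col-symmetric = λ x x′ y y′ → f-comm (W x y * W x′ y′) (W x y′ * W x′ y)
      ; col-diagonal  = λ x x′ y → f-diag (ternary-* (W-ternary x y) (W-ternary x′ y))
      }

  unitMinor-alternating : AlternatingQuad (unitMinor W)
  unitMinor-alternating = minor-alternating {unit} unit-comm unit-diagonal

  fourMinor-alternating : AlternatingQuad (fourMinor W)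
  fourMinor-alternating = minor-alternating {four} four-comm four-diagonal

-- Double sums

sum₂ : (Fin m → Fin n → ℤ) → ℤ
sum₂ f = sum λ i → sum (f i)

sum₂-cong : {f g : Fin m → Fin n → ℤ} → (∀ i j → f i j ≡ g i j) → sum₂ f ≡ sum₂ g
sum₂-cong f≡g = sum-cong-≗ λ i → sum-cong-≗ (f≡g i)

sum-linear : ∀ (f : Fin n → ℤ) c g → ∑[ i < n ] (f i + c * g i) ≡ sum f + c * sum g
sum-linear f c g = trans (∑-distrib-+ f (λ i → c * g i)) (cong (_+_ (sum f)) (sym (*-distribˡ-sum c g)))

sum₂-distrib-+ : (f g : Fin m → Fin n → ℤ) → sum₂ (λ i j → f i j + g i j) ≡ sum₂ f + sum₂ g
sum₂-distrib-+ f g =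
  trans (sum-cong-≗ λ i → ∑-distrib-+ (f i) (g i)) (∑-distrib-+ (λ i → sum (f i)) (λ i → sum (g i)))

sum₂-linear : ∀ (f : Fin m → Fin n → ℤ) c g → sum₂ (λ i j → f i j + c * g i j) ≡ sum₂ f + c * sum₂ g
sum₂-linear f c g =
  trans (sum-cong-≗ λ i → sum-linear (f i) c (g i)) (sum-linear (λ i → sum (f i)) c (λ i → sum (g i)))

sum-*-sum : (f : Fin m → ℤ) (g : Fin n → ℤ) → sum₂ (λ i j → f i * g j) ≡ sum f * sum g
sum-*-sum f g = trans (sum-cong-≗ λ i → sym (*-distribˡ-sum (f i) g)) (sym (*-distribʳ-sum (sum g) f))

sum-nonneg : (f : Fin n → ℤ) → (∀ i → 0ℤ ≤ f i) → 0ℤ ≤ sum f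
sum-nonneg {zero}  f 0≤f = ℤₚ.≤-refl
sum-nonneg {suc n} f 0≤f = ℤₚ.+-mono-≤ (0≤f zero) (sum-nonneg (f ∘ suc) (0≤f ∘ suc))

sum-nonneg≡0 : (f : Fin n → ℤ) → (∀ i → 0ℤ ≤ f i) → sum f ≡ 0ℤ → ∀ i → f i ≡ 0ℤ
sum-nonneg≡0 {suc n} f 0≤f Σ≡0 = λ where
    zero    → f₀≡0
    (suc i) → sum-nonneg≡0 (f ∘ suc) (0≤f ∘ suc) Σ₊≡0 i
  where
  Σ₊ = sum (f ∘ suc)
  f₀≡0 : f zero ≡ 0ℤ
  f₀≡0 = ℤₚ.≤-antisym
    (ℤₚ.≤-trans (ℤₚ.≤-trans (ℤₚ.≤-reflexive (sym (ℤₚ.+-identityʳ (f zero))))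
                            (ℤₚ.+-monoʳ-≤ (f zero) (sum-nonneg (f ∘ suc) (0≤f ∘ suc))))
                (ℤₚ.≤-reflexive Σ≡0))
    (0≤f zero)
  Σ₊≡0 : Σ₊ ≡ 0ℤ
  Σ₊≡0 = trans (sym (ℤₚ.+-identityˡ Σ₊)) (trans (cong (_+ Σ₊) (sym f₀≡0)) Σ≡0)

0≤i*i : ∀ i → 0ℤ ≤ i * i
0≤i*i (+ n)    = ℤₚ.≤-trans (ℤ.+≤+ ℕ.z≤n) (ℤₚ.≤-reflexive (ℤₚ.pos-* n n))
0≤i*i -[1+ n ] = ℤ.+≤+ ℕ.z≤n

i*i≡0⇒i≡0 : ∀ {i} → i * i ≡ 0ℤ → i ≡ 0ℤ
i*i≡0⇒i≡0 {i} i*i≡0 with ℤₚ.i*j≡0⇒i≡0∨j≡0 i i*i≡0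
... | inj₁ i≡0 = i≡0
... | inj₂ i≡0 = i≡0

I-refl : (x : Fin n) → I x x ≡ 1ℤ
I-refl x = cong 𝟙 (dec-true (x Fin.≟ x) refl)

I-≢ : {x y : Fin n} → x ≢ y → I x y ≡ 0ℤ
I-≢ {x = x} {y} x≢y = cong 𝟙 (dec-false (x Fin.≟ y) x≢y)

-- Gram matrices

rowGram colGram : Matrix n n → Matrix n n
rowGram P x x′ = sum λ y → P x y * P x′ y
colGram P y y′ = sum λ x → P x y * P x y′

-- The squared Frobenius distance of either Gram matrix of P to p I + q J is
-- determined by its Frobenius norm, its trace and the sum of its entries, and
-- the first two agree for both Gram matrices.
module _ (P : Matrix n n) (p q : ℤ)
         (q*sum : q * sum₂ (colGram P) ≡ q * sum₂ (rowGram P))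
         (rowGram≡ : ∀ x x′ → rowGram P x x′ ≡ p * I x x′ + q) where

  private
    X : Matrix n n
    X y y′ = p * I y y′ + q

    distance : Matrix n n → ℤ
    distance K = sum₂ λ y y′ → (K y y′ - X y y′) * (K y y′ - X y y′)

    norm trace : Matrix n n → ℤ
    norm K = sum₂ λ y y′ → K y y′ * K y y′
    trace K = sum λ y → K y y

    distance-expand : ∀ K → distance K ≡ sum₂ (λ y y′ → X y y′ * X y y′) + 1ℤ * norm K
                                         + (- (+ 2 * p)) * trace K + (- + 2) * (q * sum₂ K)
    distance-expand K = begin
      distance K
        ≡⟨ sum₂-cong (λ y y′ → lemma (K y y′) (I y y′) p q) ⟩
      sum₂ (λ y y′ → X y y′ * X y y′ + 1ℤ * (K y y′ * K y y′)
                     + (- (+ 2 * p)) * (I y y′ * K y y′) + (- (+ 2 * q)) * K y y′)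
        ≡⟨ sum₂-linear (λ y y′ → X y y′ * X y y′ + 1ℤ * (K y y′ * K y y′) + (- (+ 2 * p)) * (I y y′ * K y y′))
                       (- (+ 2 * q)) K ⟩
      sum₂ (λ y y′ → X y y′ * X y y′ + 1ℤ * (K y y′ * K y y′) + (- (+ 2 * p)) * (I y y′ * K y y′))
        + (- (+ 2 * q)) * sum₂ K
        ≡⟨ cong₂ _+_ (sum₂-linear (λ y y′ → X y y′ * X y y′ + 1ℤ * (K y y′ * K y y′)) (- (+ 2 * p))
                                  (λ y y′ → I y y′ * K y y′))
                     (lemma′ q (sum₂ K)) ⟩
      sum₂ (λ y y′ → X y y′ * X y y′ + 1ℤ * (K y y′ * K y y′))
        + (- (+ 2 * p)) * sum₂ (λ y y′ → I y y′ * K y y′) + (- + 2) * (q * sum₂ K)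
        ≡⟨ cong₂ (λ a b → a + (- (+ 2 * p)) * b + (- + 2) * (q * sum₂ K))
             (sum₂-linear (λ y y′ → X y y′ * X y y′) 1ℤ (λ y y′ → K y y′ * K y y′))
             (sum-cong-≗ λ y → sum-I y (K y)) ⟩
      sum₂ (λ y y′ → X y y′ * X y y′) + 1ℤ * norm K + (- (+ 2 * p)) * trace K + (- + 2) * (q * sum₂ K) ∎
      where
      lemma : ∀ k i p q → (k - (p * i + q)) * (k - (p * i + q)) ≡
              (p * i + q) * (p * i + q) + 1ℤ * (k * k) + (- (+ 2 * p)) * (i * k) + (- (+ 2 * q)) * k
      lemma = solve-∀
      lemma′ : ∀ q s → (- (+ 2 * q)) * s ≡ (- + 2) * (q * s)
      lemma′ = solve-∀

    -- Both norms are the sum of the same fourfold products over two rows and two columns; the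
    -- exchanges of sums collect the factors by column pair or by row pair.
    norm-gram : norm (colGram P) ≡ norm (rowGram P)
    norm-gram = begin
      ∑[ y < n ] ∑[ y′ < n ] (colGram P y y′ * colGram P y y′)
        ≡⟨ sum₂-cong (λ y y′ → sym (sum-*-sum (λ x → P x y * P x y′) (λ z → P z y * P z y′))) ⟩
      ∑[ y < n ] ∑[ y′ < n ] ∑[ x < n ] ∑[ z < n ] ((P x y * P x y′) * (P z y * P z y′))
        ≡⟨ sum-cong-≗ (λ y → ∑-comm λ y′ x → ∑[ z < n ] ((P x y * P x y′) * (P z y * P z y′))) ⟩
      ∑[ y < n ] ∑[ x < n ] ∑[ y′ < n ] ∑[ z < n ] ((P x y * P x y′) * (P z y * P z y′))
        ≡⟨ ∑-comm (λ y x → ∑[ y′ < n ] ∑[ z < n ] ((P x y * P x y′) * (P z y * P z y′))) ⟩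
      ∑[ x < n ] ∑[ y < n ] ∑[ y′ < n ] ∑[ z < n ] ((P x y * P x y′) * (P z y * P z y′))
        ≡⟨ sum₂-cong (λ x y → ∑-comm λ y′ z → (P x y * P x y′) * (P z y * P z y′)) ⟩
      ∑[ x < n ] ∑[ y < n ] ∑[ z < n ] ∑[ y′ < n ] ((P x y * P x y′) * (P z y * P z y′))
        ≡⟨ sum-cong-≗ (λ x → ∑-comm λ y z → ∑[ y′ < n ] ((P x y * P x y′) * (P z y * P z y′))) ⟩
      ∑[ x < n ] ∑[ z < n ] ∑[ y < n ] ∑[ y′ < n ] ((P x y * P x y′) * (P z y * P z y′))
        ≡⟨ sum₂-cong (λ x z → sum₂-cong λ y y′ → *-interchange (P x y) (P x y′) (P z y) (P z y′)) ⟩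
      ∑[ x < n ] ∑[ z < n ] ∑[ y < n ] ∑[ y′ < n ] ((P x y * P z y) * (P x y′ * P z y′))
        ≡⟨ sum₂-cong (λ x z → sum-*-sum (λ y → P x y * P z y) (λ y′ → P x y′ * P z y′)) ⟩
      ∑[ x < n ] ∑[ z < n ] (rowGram P x z * rowGram P x z) ∎

    trace-gram : trace (colGram P) ≡ trace (rowGram P)
    trace-gram = ∑-comm λ y x → P x y * P x y

    distance-rowGram : distance (rowGram P) ≡ 0ℤ
    distance-rowGram = sum-zero λ x → sum-zero λ x′ →
      cong (λ i → i * i) (trans (cong (_- X x x′) (rowGram≡ x x′)) (ℤₚ.+-inverseʳ (X x x′)))

    distance-colGram : distance (colGram P) ≡ 0ℤ
    distance-colGram = begin
      distance (colGram P)
        ≡⟨ distance-expand (colGram P) ⟩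
      sum₂ (λ y y′ → X y y′ * X y y′) + 1ℤ * norm (colGram P)
        + (- (+ 2 * p)) * trace (colGram P) + (- + 2) * (q * sum₂ (colGram P))
        ≡⟨ cong₂ (λ a b → sum₂ (λ y y′ → X y y′ * X y y′) + 1ℤ * norm (colGram P) + (- (+ 2 * p)) * a + (- + 2) * b)
             trace-gram q*sum ⟩
      sum₂ (λ y y′ → X y y′ * X y y′) + 1ℤ * norm (colGram P)
        + (- (+ 2 * p)) * trace (rowGram P) + (- + 2) * (q * sum₂ (rowGram P))
        ≡⟨ cong (λ a → sum₂ (λ y y′ → X y y′ * X y y′) + 1ℤ * a
                       + (- (+ 2 * p)) * trace (rowGram P) + (- + 2) * (q * sum₂ (rowGram P))) norm-gram ⟩
      sum₂ (λ y y′ → X y y′ * X y y′) + 1ℤ * norm (rowGram P)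
        + (- (+ 2 * p)) * trace (rowGram P) + (- + 2) * (q * sum₂ (rowGram P))
        ≡⟨ distance-expand (rowGram P) ⟨
      distance (rowGram P)
        ≡⟨ distance-rowGram ⟩
      0ℤ ∎

  -- The distance is a double sum of squares, so its vanishing is pushed to the inner sums and then
  -- to the single entries.
  colGram≡ : ∀ y y′ → colGram P y y′ ≡ p * I y y′ + q
  colGram≡ y y′ = ℤₚ.i-j≡0⇒i≡j (colGram P y y′) (X y y′) (i*i≡0⇒i≡0
    (sum-nonneg≡0 (λ y′ → square y y′) (λ y′ → 0≤i*i (colGram P y y′ - X y y′))
      (sum-nonneg≡0 (λ y → sum (square y)) (λ y → sum-nonneg (square y) λ y′ → 0≤i*i (colGram P y y′ - X y y′))
        distance-colGram y) y′))
    where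
    square : Matrix n n
    square y y′ = (colGram P y y′ - X y y′) * (colGram P y y′ - X y y′)

-- Summing over both row indices last shows that each column contributes the square of its sum.
sum₂-rowGram : (P : Matrix n n) {c : ℤ} → (∀ y → sum (λ x → P x y) ≡ c) →
               sum₂ (rowGram P) ≡ + n * (c * c)
sum₂-rowGram {n} P {c} col-sums = begin
  ∑[ x < n ] ∑[ x′ < n ] ∑[ y < n ] (P x y * P x′ y)
    ≡⟨ sum-cong-≗ (λ x → ∑-comm λ x′ y → P x y * P x′ y) ⟩
  ∑[ x < n ] ∑[ y < n ] ∑[ x′ < n ] (P x y * P x′ y)
    ≡⟨ ∑-comm (λ x y → ∑[ x′ < n ] (P x y * P x′ y)) ⟩
  ∑[ y < n ] ∑[ x < n ] ∑[ x′ < n ] (P x y * P x′ y)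
    ≡⟨ sum-cong-≗ (λ y → sum-*-sum (λ x → P x y) (λ x → P x y)) ⟩
  ∑[ y < n ] (sum (λ x → P x y) * sum (λ x → P x y))
    ≡⟨ sum-cong-≗ (λ y → cong₂ _*_ (col-sums y) (col-sums y)) ⟩
  ∑[ y < n ] (c * c)
    ≡⟨ sum-const n (c * c) ⟩
  + n * (c * c) ∎

-- Balanced generalised weighing matrices and their transposes

squares : Matrix m n → Matrix m n
squares W x y = W x y * W x y

-- The numerical content of a balanced generalised weighing matrix, freed from the hypergraph and
-- stated so that it passes to the transpose.
record IsBalanced {v : ℕ} (d l : ℤ) (W : Matrix v v) : Set where
  field
    ternary      : ∀ x y → Ternary (W x y)
    row-sum      : ∀ x → sum (λ y → squares W x y) ≡ d
    col-sum      : ∀ y → sum (λ x → squares W x y) ≡ d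
    gram         : ∀ x x′ → rowGram W x x′ ≡ d * I x x′
    squares-gram : ∀ x x′ → rowGram (squares W) x x′ ≡ (d - l) * I x x′ + l

open IsBalanced

-- For `gram` the constant term is 0, so the hypothesis on sums of entries reads 0 = 0. For
-- `squares-gram` both sums are v d², because rows and columns have the common sum d.
transpose : ∀ {v d l} {W : Matrix v v} → IsBalanced d l W → IsBalanced d l (W ᵀ)
transpose {v} {d} {l} {W} W-bal = record
  { ternary      = λ y x → ternary W-bal x y
  ; row-sum      = col-sum W-bal
  ; col-sum      = row-sum W-bal
  ; gram         = λ y y′ → trans
      (colGram≡ W d 0ℤ refl (λ x x′ → trans (gram W-bal x x′) (sym (ℤₚ.+-identityʳ (d * I x x′)))) y y′)
      (ℤₚ.+-identityʳ (d * I y y′))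
  ; squares-gram = colGram≡ (squares W) (d - l) l
      (cong (l *_) (trans (sum₂-rowGram (squares W ᵀ) (row-sum W-bal))
                          (sym (sum₂-rowGram (squares W) (col-sum W-bal)))))
      (squares-gram W-bal)
  }

ternary-square : ∀ {i} → Ternary i → i * i ≡ 0ℤ ⊎ i * i ≡ 1ℤ
ternary-square (inj₁ refl)        = inj₁ refl
ternary-square (inj₂ (inj₁ refl)) = inj₂ refl
ternary-square (inj₂ (inj₂ refl)) = inj₂ refl

-- Sums of minors through Gram matrices

module _ {v : ℕ} {d l : ℤ} {W : Matrix v v} (W-bal : IsBalanced d l W) where

  private
    N : Matrix v v
    N = squares W

    unit-expand : ∀ a b c e →
      (a * b) * (a * b) + (c * e) * (c * e) - + 2 * (((a * b) * (a * b)) * ((c * e) * (c * e)))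
        ≡ (a * a) * (b * b) + (e * e) * (c * c) + (- + 2) * (((a * a) * (e * e)) * ((c * c) * (b * b)))
    unit-expand = solve-∀

    four-expand : ∀ a b c e →
      ((a * b) * (a * b)) * ((c * e) * (c * e)) - (a * b) * (c * e)
        ≡ ((a * a) * (e * e)) * ((c * c) * (b * b)) + -1ℤ * ((a * e) * (c * b))
    four-expand = solve-∀

  -- With p and q the two products of the minor, p² and q² already separate `y` from `y′`; p²q² does
  -- so after regrouping by column, and each column factor sums to a Gram entry.
  sum-unitMinor-rows : ∀ x x′ → sum₂ (unitMinor W x x′) ≡
    d * d + d * d + (- + 2) * (rowGram N x x′ * rowGram N x x′)
  sum-unitMinor-rows x x′ = begin
    sum₂ (unitMinor W x x′)
      ≡⟨ sum₂-cong (λ y y′ → unit-expand (W x y) (W x′ y′) (W x y′) (W x′ y)) ⟩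
    sum₂ (λ y y′ → N x y * N x′ y′ + N x′ y * N x y′ + (- + 2) * ((N x y * N x′ y) * (N x y′ * N x′ y′)))
      ≡⟨ sum₂-linear (λ y y′ → N x y * N x′ y′ + N x′ y * N x y′) (- + 2)
                     (λ y y′ → (N x y * N x′ y) * (N x y′ * N x′ y′)) ⟩
    sum₂ (λ y y′ → N x y * N x′ y′ + N x′ y * N x y′) + (- + 2) * sum₂ (λ y y′ → (N x y * N x′ y) * (N x y′ * N x′ y′))
      ≡⟨ cong₂ (λ a b → a + (- + 2) * b)
           (trans (sum₂-distrib-+ (λ y y′ → N x y * N x′ y′) (λ y y′ → N x′ y * N x y′))
                  (cong₂ _+_ (trans (sum-*-sum (N x) (N x′)) (cong₂ _*_ (row-sum W-bal x) (row-sum W-bal x′)))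
                             (trans (sum-*-sum (N x′) (N x)) (cong₂ _*_ (row-sum W-bal x′) (row-sum W-bal x)))))
           (sum-*-sum (λ y → N x y * N x′ y) (λ y′ → N x y′ * N x′ y′)) ⟩
    d * d + d * d + (- + 2) * (rowGram N x x′ * rowGram N x x′) ∎

  -- Regrouped by column, pq is a product of two summands of the Gram matrix of `W` itself; this is
  -- where orthogonality of the rows enters.
  sum-fourMinor-rows : ∀ x x′ → sum₂ (fourMinor W x x′) ≡
    rowGram N x x′ * rowGram N x x′ + -1ℤ * (rowGram W x x′ * rowGram W x x′)
  sum-fourMinor-rows x x′ = begin
    sum₂ (fourMinor W x x′)
      ≡⟨ sum₂-cong (λ y y′ → four-expand (W x y) (W x′ y′) (W x y′) (W x′ y)) ⟩
    sum₂ (λ y y′ → (N x y * N x′ y) * (N x y′ * N x′ y′) + -1ℤ * ((W x y * W x′ y) * (W x y′ * W x′ y′)))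
      ≡⟨ sum₂-linear (λ y y′ → (N x y * N x′ y) * (N x y′ * N x′ y′)) -1ℤ
                     (λ y y′ → (W x y * W x′ y) * (W x y′ * W x′ y′)) ⟩
    sum₂ (λ y y′ → (N x y * N x′ y) * (N x y′ * N x′ y′))
      + -1ℤ * sum₂ (λ y y′ → (W x y * W x′ y) * (W x y′ * W x′ y′))
      ≡⟨ cong₂ (λ a b → a + -1ℤ * b) (sum-*-sum (λ y → N x y * N x′ y) (λ y′ → N x y′ * N x′ y′))
                                     (sum-*-sum (λ y → W x y * W x′ y) (λ y′ → W x y′ * W x′ y′)) ⟩
    rowGram N x x′ * rowGram N x x′ + -1ℤ * (rowGram W x x′ * rowGram W x x′) ∎

  private
    -- The sum is an entry of N Nᵀ N, where N Nᵀ = (d - l) I + l J and J N = d J.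
    sum-N-gram : ∀ x y → ∑[ x′ < v ] (N x′ y * rowGram N x x′) ≡ l * d + (d - l) * N x y
    sum-N-gram x y = begin
      ∑[ x′ < v ] (N x′ y * rowGram N x x′)
        ≡⟨ sum-cong-≗ (λ x′ → trans (cong (N x′ y *_) (squares-gram W-bal x x′)) (lemma (N x′ y) (I x x′) d l)) ⟩
      ∑[ x′ < v ] (l * N x′ y + (d - l) * (I x x′ * N x′ y))
        ≡⟨ sum-linear (λ x′ → l * N x′ y) (d - l) (λ x′ → I x x′ * N x′ y) ⟩
      ∑[ x′ < v ] (l * N x′ y) + (d - l) * ∑[ x′ < v ] (I x x′ * N x′ y)
        ≡⟨ cong₂ (λ a b → a + (d - l) * b)
             (trans (sym (*-distribˡ-sum l (λ x′ → N x′ y))) (cong (l *_) (col-sum W-bal y)))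
             (sum-I x (λ x′ → N x′ y)) ⟩
      l * d + (d - l) * N x y ∎
      where
      lemma : ∀ a i d l → a * ((d - l) * i + l) ≡ l * a + (d - l) * (i * a)
      lemma = solve-∀

    -- The same for W Wᵀ W with W Wᵀ = d I.
    sum-W-gram : ∀ x y → ∑[ x′ < v ] (W x′ y * rowGram W x x′) ≡ d * W x y
    sum-W-gram x y = begin
      ∑[ x′ < v ] (W x′ y * rowGram W x x′)
        ≡⟨ sum-cong-≗ (λ x′ → trans (cong (W x′ y *_) (gram W-bal x x′)) (lemma (W x′ y) (I x x′) d)) ⟩
      ∑[ x′ < v ] (d * (I x x′ * W x′ y))
        ≡⟨ *-distribˡ-sum d (λ x′ → I x x′ * W x′ y) ⟨
      d * ∑[ x′ < v ] (I x x′ * W x′ y)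
        ≡⟨ cong (d *_) (sum-I x (λ x′ → W x′ y)) ⟩
      d * W x y ∎
      where
      lemma : ∀ a i d → a * (d * i) ≡ d * (i * a)
      lemma = solve-∀

  -- With `x` and `y` fixed, the sum over `y′` turns p²q² into a Gram entry, and the sum over `x′`
  -- then gives an entry of N Nᵀ N.
  sum-unitMinor-cross : ∀ x y → sum₂ (λ x′ y′ → unitMinor W x x′ y y′) ≡
    + v * (N x y * d) + d * d + (- (+ 2 * N x y)) * (l * d + (d - l) * N x y)
  sum-unitMinor-cross x y = begin
    sum₂ (λ x′ y′ → unitMinor W x x′ y y′)
      ≡⟨ sum₂-cong (λ x′ y′ → trans (unit-expand (W x y) (W x′ y′) (W x y′) (W x′ y))
           (lemma (N x y) (N x′ y) (N x y′) (N x′ y′))) ⟩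
    sum₂ (λ x′ y′ → N x y * N x′ y′ + N x′ y * N x y′ + (- (+ 2 * N x y) * N x′ y) * (N x y′ * N x′ y′))
      ≡⟨ sum-cong-≗ inner ⟩
    ∑[ x′ < v ] (N x y * d + N x′ y * d + (- (+ 2 * N x y)) * (N x′ y * rowGram N x x′))
      ≡⟨ sum-linear (λ x′ → N x y * d + N x′ y * d) (- (+ 2 * N x y)) (λ x′ → N x′ y * rowGram N x x′) ⟩
    ∑[ x′ < v ] (N x y * d + N x′ y * d) + (- (+ 2 * N x y)) * ∑[ x′ < v ] (N x′ y * rowGram N x x′)
      ≡⟨ cong₂ (λ a b → a + (- (+ 2 * N x y)) * b)
           (trans (∑-distrib-+ (λ _ → N x y * d) (λ x′ → N x′ y * d))
                  (cong₂ _+_ (sum-const v (N x y * d))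
                             (trans (sym (*-distribʳ-sum d (λ x′ → N x′ y))) (cong (_* d) (col-sum W-bal y)))))
           (sum-N-gram x y) ⟩
    + v * (N x y * d) + d * d + (- (+ 2 * N x y)) * (l * d + (d - l) * N x y) ∎
    where
    lemma : ∀ a e c b → a * b + e * c + (- + 2) * ((a * e) * (c * b)) ≡ a * b + e * c + (- (+ 2 * a) * e) * (c * b)
    lemma = solve-∀

    inner : ∀ x′ →
      sum (λ y′ → N x y * N x′ y′ + N x′ y * N x y′ + (- (+ 2 * N x y) * N x′ y) * (N x y′ * N x′ y′))
        ≡ N x y * d + N x′ y * d + (- (+ 2 * N x y)) * (N x′ y * rowGram N x x′)
    inner x′ = trans
      (sum-linear (λ y′ → N x y * N x′ y′ + N x′ y * N x y′) (- (+ 2 * N x y) * N x′ y) (λ y′ → N x y′ * N x′ y′))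
      (cong₂ _+_ (trans (sum-linear (λ y′ → N x y * N x′ y′) (N x′ y) (N x))
                        (cong₂ (λ a b → a + N x′ y * b)
                          (trans (sym (*-distribˡ-sum (N x y) (N x′))) (cong (N x y *_) (row-sum W-bal x′)))
                          (row-sum W-bal x)))
                 (ℤₚ.*-assoc (- (+ 2 * N x y)) (N x′ y) (rowGram N x x′)))

  sum-fourMinor-cross : ∀ x y → sum₂ (λ x′ y′ → fourMinor W x x′ y y′) ≡
    N x y * (l * d + (d - l) * N x y) + (- W x y) * (d * W x y)
  sum-fourMinor-cross x y = begin
    sum₂ (λ x′ y′ → fourMinor W x x′ y y′)
      ≡⟨ sum₂-cong (λ x′ y′ → trans (four-expand (W x y) (W x′ y′) (W x y′) (W x′ y))
           (lemma (N x y * N x′ y) (W x y) (W x′ y) (N x y′ * N x′ y′) (W x y′ * W x′ y′))) ⟩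
    sum₂ (λ x′ y′ → (N x y * N x′ y) * (N x y′ * N x′ y′) + (- W x y * W x′ y) * (W x y′ * W x′ y′))
      ≡⟨ sum-cong-≗ inner ⟩
    ∑[ x′ < v ] (N x y * (N x′ y * rowGram N x x′) + (- W x y) * (W x′ y * rowGram W x x′))
      ≡⟨ sum-linear (λ x′ → N x y * (N x′ y * rowGram N x x′)) (- W x y) (λ x′ → W x′ y * rowGram W x x′) ⟩
    ∑[ x′ < v ] (N x y * (N x′ y * rowGram N x x′)) + (- W x y) * ∑[ x′ < v ] (W x′ y * rowGram W x x′)
      ≡⟨ cong₂ (λ a b → a + (- W x y) * b)
           (trans (sym (*-distribˡ-sum (N x y) (λ x′ → N x′ y * rowGram N x x′))) (cong (N x y *_) (sum-N-gram x y)))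
           (sum-W-gram x y) ⟩
    N x y * (l * d + (d - l) * N x y) + (- W x y) * (d * W x y) ∎
    where
    lemma : ∀ n a e p q → n * p + -1ℤ * ((a * e) * q) ≡ n * p + (- a * e) * q
    lemma = solve-∀

    inner : ∀ x′ →
      sum (λ y′ → (N x y * N x′ y) * (N x y′ * N x′ y′) + (- W x y * W x′ y) * (W x y′ * W x′ y′))
        ≡ N x y * (N x′ y * rowGram N x x′) + (- W x y) * (W x′ y * rowGram W x x′)
    inner x′ = trans
      (sum-linear (λ y′ → (N x y * N x′ y) * (N x y′ * N x′ y′)) (- W x y * W x′ y) (λ y′ → W x y′ * W x′ y′))
      (cong₂ _+_ (trans (sym (*-distribˡ-sum (N x y * N x′ y) (λ y′ → N x y′ * N x′ y′)))
                        (ℤₚ.*-assoc (N x y) (N x′ y) (rowGram N x x′)))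
                 (ℤₚ.*-assoc (- W x y) (W x′ y) (rowGram W x x′)))

-- From the symmetric design to row sums, column sums and Gram matrices

_≟ₛ_ : (α β : Subset n) → Dec (α ≡ β)
_≟ₛ_ = Vec.≡-dec Bool._≟_

sumₛ-δ : ∀ (β : Subset n) (g : Subset n → ℤ) → sumₛ (λ α → 𝟙 (does (β ≟ₛ α)) * g α) ≡ g β
sumₛ-δ []            g = ℤₚ.*-identityˡ (g [])
sumₛ-δ {suc n} (inside  ∷ β) g = trans
  (cong₂ _+_ (sumₛ-δ β (g ∘ (inside ∷_))) (sumₛ-zero {n} λ _ → refl)) (ℤₚ.+-identityʳ (g (inside ∷ β)))
sumₛ-δ {suc n} (outside ∷ β) g = trans
  (cong₂ _+_ (sumₛ-zero {n} λ _ → refl) (sumₛ-δ β (g ∘ (outside ∷_)))) (ℤₚ.+-identityˡ (g (outside ∷ β)))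

sum-lookup : (p : Subset n) → sum (λ x → 𝟙 (lookup p x)) ≡ + ∣ p ∣
sum-lookup []            = refl
sum-lookup (inside  ∷ p) = cong (_+_ 1ℤ) (sum-lookup p)
sum-lookup (outside ∷ p) = trans (ℤₚ.+-identityˡ _) (sum-lookup p)

∣pair∣≡2 : ∀ {x y : Fin n} → x ≢ y → ∣ ⁅ x ⁆ ∪ ⁅ y ⁆ ∣ ≡ 2
∣pair∣≡2 {x = zero}  {zero}  x≢y = contradiction refl x≢y
∣pair∣≡2 {x = zero}  {suc y} x≢y = cong suc (trans (cong ∣_∣ (∪-identityˡ ⁅ y ⁆)) (∣⁅x⁆∣≡1 y))
∣pair∣≡2 {x = suc x} {zero}  x≢y = cong suc (trans (cong ∣_∣ (∪-identityʳ ⁅ x ⁆)) (∣⁅x⁆∣≡1 x))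
∣pair∣≡2 {x = suc x} {suc y} x≢y = ∣pair∣≡2 (x≢y ∘ cong suc)

module _ {H : Hypergraph m} {N : Matrix m n} (incidence : IsIncidenceMatrix H N) where

  open IsIncidenceMatrix incidence

  incidence-lookup : ∀ x b → N x b ≡ 𝟙 (lookup (edge b) x)
  incidence-lookup x b with lookup (edge b) x in eq
  ... | true  = incident x b (Vec.lookup⇒[]= x (edge b) eq)
  ... | false = ¬incident x b λ x∈e → contradiction (trans (sym (Vec.[]=⇒lookup x∈e)) eq) λ ()

  private
    -- An edge has a column because `edge` is exhaustive and only one because it is injective; a
    -- non-edge has none.
    edge-indicator : ∀ α → 𝟙 (does (edge? H α)) ≡ ∑[ b < n ] 𝟙 (does (edge b ≟ₛ α))
    edge-indicator α with edge? H α
    ... | no  α∉H = sym (sum-zero λ b → cong 𝟙 (dec-false (edge b ≟ₛ α) λ eq → α∉H (subst (Edge H) eq (isEdge b))))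
    ... | yes α∈H with exhaustive α α∈H
    ...   | b₀ , refl = sym (trans (sum-cong-≗ λ b → trans (cong 𝟙 (δ b)) (sym (ℤₚ.*-identityʳ (I b₀ b))))
                                   (sum-I b₀ λ _ → 1ℤ))
      where
      δ : ∀ b → does (edge b ≟ₛ edge b₀) ≡ does (b₀ Fin.≟ b)
      δ b = does-⇔ (mk⇔ (sym ∘ injective) (cong edge ∘ sym)) (edge b ≟ₛ edge b₀) (b₀ Fin.≟ b)

  sum-edges : ∀ (g : Subset m → ℤ) → sumₛ (λ α → 𝟙 (does (edge? H α)) * g α) ≡ ∑[ b < n ] g (edge b)
  sum-edges g = begin
    sumₛ (λ α → 𝟙 (does (edge? H α)) * g α)
      ≡⟨ sumₛ-cong (λ α → trans (cong (_* g α) (edge-indicator α)) (*-distribʳ-sum (g α) (λ b → 𝟙 (does (edge b ≟ₛ α))))) ⟩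
    sumₛ (λ α → ∑[ b < n ] (𝟙 (does (edge b ≟ₛ α)) * g α))
      ≡⟨ sumₛ-sum-comm (λ α b → 𝟙 (does (edge b ≟ₛ α)) * g α) ⟩
    ∑[ b < n ] sumₛ (λ α → 𝟙 (does (edge b ≟ₛ α)) * g α)
      ≡⟨ sum-cong-≗ (λ b → sumₛ-δ (edge b) g) ⟩
    ∑[ b < n ] g (edge b) ∎

  degree-pair : ∀ x y → + degree H (⁅ x ⁆ ∪ ⁅ y ⁆) ≡ ∑[ b < n ] (N x b * N y b)
  degree-pair x y = begin
    + degree H (⁅ x ⁆ ∪ ⁅ y ⁆)
      ≡⟨ length-filter-subsets (λ e → edge? H e ×-dec (⁅ x ⁆ ∪ ⁅ y ⁆) ⊆? e) ⟩
    sumₛ (λ α → 𝟙 (does (edge? H α) ∧ does ((⁅ x ⁆ ∪ ⁅ y ⁆) ⊆? α)))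
      ≡⟨ sumₛ-cong (λ α → trans (𝟙-∧ (does (edge? H α)) (does ((⁅ x ⁆ ∪ ⁅ y ⁆) ⊆? α)))
                                (cong (𝟙 (does (edge? H α)) *_) (𝟙-pair-⊆? x y α))) ⟩
    sumₛ (λ α → 𝟙 (does (edge? H α)) * (𝟙 (lookup α x) * 𝟙 (lookup α y)))
      ≡⟨ sum-edges (λ α → 𝟙 (lookup α x) * 𝟙 (lookup α y)) ⟩
    ∑[ b < n ] (𝟙 (lookup (edge b) x) * 𝟙 (lookup (edge b) y))
      ≡⟨ sum-cong-≗ (λ b → sym (cong₂ _*_ (incidence-lookup x b) (incidence-lookup y b))) ⟩
    ∑[ b < n ] (N x b * N y b) ∎

unsign-ternary : ∀ {i} → Ternary i → unsign i ≡ i * i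
unsign-ternary (inj₁ refl)        = refl
unsign-ternary (inj₂ (inj₁ refl)) = refl
unsign-ternary (inj₂ (inj₂ refl)) = refl

module _ {v d l : ℕ} {W : Matrix v v} (W-bgw : IsBGW v d l W) where

  open IsBGW W-bgw

  private
    H : Hypergraph v
    H = proj₁ design

    incidence : IsIncidenceMatrix H (unsigned W)
    incidence = proj₂ (proj₂ design)

    open IsDesign (IsSymmetric2Design.isDesign (proj₁ (proj₂ design)))
    open IsIncidenceMatrix incidence

  unsigned≡squares : ∀ x y → unsigned W x y ≡ squares W x y
  unsigned≡squares x y = unsign-ternary (entries x y)

  block-size-positive : 0 ℕ.< d
  block-size-positive = k-positive

  index-positive : 0 ℕ.< l
  index-positive = l-positive

  -- Row sums come from the diagonal of W Wᵀ, column sums from the block size. The Gram matrix of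
  -- the squares takes its diagonal from the row sums, as ternary squares are idempotent, and the
  -- rest from the balance of the 2-design.
  balanced-BGW : IsBalanced (+ d) (+ l) W
  balanced-BGW = record
    { ternary      = entries
    ; row-sum      = row-sums
    ; col-sum      = λ y → begin
        sum (λ x → squares W x y)             ≡⟨ sum-cong-≗ (λ x → unsigned≡squares x y) ⟨
        sum (λ x → unsigned W x y)            ≡⟨ sum-cong-≗ (λ x → incidence-lookup incidence x y) ⟩
        sum (λ x → 𝟙 (lookup (edge y) x))     ≡⟨ sum-lookup (edge y) ⟩
        + ∣ edge y ∣                          ≡⟨ cong +_ (uniform (edge y) (isEdge y)) ⟩
        + d                                   ∎
    ; gram         = weighing
    ; squares-gram = squares-grams
    }
    where
    row-sums : ∀ x → sum (λ y → squares W x y) ≡ + d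
    row-sums x = trans (weighing x x) (trans (cong (+ d *_) (I-refl x)) (ℤₚ.*-identityʳ (+ d)))

    square-idem : ∀ {i} → Ternary i → (i * i) * (i * i) ≡ i * i
    square-idem (inj₁ refl)        = refl
    square-idem (inj₂ (inj₁ refl)) = refl
    square-idem (inj₂ (inj₂ refl)) = refl

    diagonal≡ : ∀ d l → d ≡ (d - l) * 1ℤ + l
    diagonal≡ = solve-∀

    off-diagonal≡ : ∀ d l → l ≡ (d - l) * 0ℤ + l
    off-diagonal≡ = solve-∀

    squares-grams : ∀ x x′ → rowGram (squares W) x x′ ≡ (+ d - + l) * I x x′ + + l
    squares-grams x x′ with x Fin.≟ x′
    ... | yes refl = trans (sum-cong-≗ λ y → square-idem (entries x y)) (trans (row-sums x) (diagonal≡ (+ d) (+ l)))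
    ... | no  x≢x′ = begin
      sum (λ y → squares W x y * squares W x′ y)
        ≡⟨ sum-cong-≗ (λ y → cong₂ _*_ (unsigned≡squares x y) (unsigned≡squares x′ y)) ⟨
      sum (λ y → unsigned W x y * unsigned W x′ y)
        ≡⟨ degree-pair incidence x x′ ⟨
      + degree H (⁅ x ⁆ ∪ ⁅ x′ ⁆)
        ≡⟨ cong +_ (balanced (⁅ x ⁆ ∪ ⁅ x′ ⁆) (∣pair∣≡2 x≢x′)) ⟩
      + l
        ≡⟨ off-diagonal≡ (+ d) (+ l) ⟩
      (+ d - + l) * 0ℤ + + l ∎

  -- Otherwise every edge is the full vertex set, but there are v ≥ 2 distinct edges.
  block-size<v : 2 ℕ.≤ v → d ℕ.< v
  block-size<v (ℕ.s≤s (ℕ.s≤s _)) = ℕₚ.≤∧≢⇒<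
    (subst (ℕ._≤ v) (uniform (edge 0F) (isEdge 0F)) (∣p∣≤n (edge 0F)))
    λ d≡v → contradiction (injective (trans (full d≡v 0F) (sym (full d≡v 1F)))) λ ()
    where
    full : d ≡ v → ∀ b → edge b ≡ ⊤
    full d≡v b = ∣p∣≡n⇒p≡⊤ (trans (uniform (edge b) (isEdge b)) d≡v)

module _ {v : ℕ} {d l : ℤ} {W : Matrix v v} (W-bal : IsBalanced d l W) where

  -- Row `x` of N Nᵀ is summed in two ways, through the column sums of N and through the known Gram
  -- matrix. This is the classical d(d - 1) = l(v - 1).
  flag-count : Fin v → d * d ≡ (d - l) * 1ℤ + + v * l
  flag-count x = begin
    d * d
      ≡⟨ trans (cong (_* d) (sym (row-sum W-bal x))) (*-distribʳ-sum d (squares W x)) ⟩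
    ∑[ y < v ] (squares W x y * d)
      ≡⟨ sum-cong-≗ (λ y → trans (cong (squares W x y *_) (sym (col-sum W-bal y)))
                                (*-distribˡ-sum (squares W x y) (λ x′ → squares W x′ y))) ⟩
    ∑[ y < v ] ∑[ x′ < v ] (squares W x y * squares W x′ y)
      ≡⟨ ∑-comm (λ y x′ → squares W x y * squares W x′ y) ⟩
    ∑[ x′ < v ] rowGram (squares W) x x′
      ≡⟨ sum-cong-≗ (λ x′ → trans (squares-gram W-bal x x′) (lemma (I x x′) (d - l) l)) ⟩
    ∑[ x′ < v ] (I x x′ * (d - l) + l)
      ≡⟨ ∑-distrib-+ (λ x′ → I x x′ * (d - l)) (λ _ → l) ⟩
    ∑[ x′ < v ] (I x x′ * (d - l)) + ∑[ x′ < v ] l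
      ≡⟨ cong₂ _+_ (trans (sum-I x (λ _ → d - l)) (sym (ℤₚ.*-identityʳ (d - l)))) (sum-const v l) ⟩
    (d - l) * 1ℤ + + v * l ∎
    where
    lemma : ∀ i e l → e * i + l ≡ i * e + l
    lemma = solve-∀

-- The association scheme

record IsIncidence {v : ℕ} (d l : ℤ) (N : Matrix v v) : Set where
  field
    zero-one    : ∀ x y → N x y ≡ 0ℤ ⊎ N x y ≡ 1ℤ
    row-sums    : ∀ x → sum (N x) ≡ d
    column-sums : ∀ y → sum (λ x → N x y) ≡ d
    row-grams   : ∀ x x′ → rowGram N x x′ ≡ (d - l) * I x x′ + l
    col-grams   : ∀ y y′ → colGram N y y′ ≡ (d - l) * I y y′ + l

-- vertex false and vertex true enumerate the two sides of the bipartition.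
vertex : ∀ {v} → Bool → Fin v → Fin (v ℕ.+ v)
vertex {v} false x = x ↑ˡ v
vertex {v} true  x = v ↑ʳ x

vertex-surjective : ∀ {v} (u : Fin (v ℕ.+ v)) → ∃₂ λ τ x → vertex {v} τ x ≡ u
vertex-surjective {v} u with splitAt v u | Fin.join-splitAt v v u
... | inj₁ x | eq = false , x , eq
... | inj₂ x | eq = true  , x , eq

on-vertices : ∀ {v} (P : Fin (v ℕ.+ v) → Fin (v ℕ.+ v) → Set) →
              (∀ τ x υ y → P (vertex {v} τ x) (vertex {v} υ y)) → ∀ u w → P u w
on-vertices {v} P f u w with vertex-surjective {v} u | vertex-surjective {v} w
... | τ , x , refl | υ , y , refl = f τ x υ y

sum-vertex : ∀ {v} (f : Fin (v ℕ.+ v) → ℤ) →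
             sum f ≡ ∑[ x < v ] f (vertex false x) + ∑[ x < v ] f (vertex true x)
sum-vertex {v} f = sum-++ v f

I-comm : (x y : Fin n) → I x y ≡ I y x
I-comm x y = cong 𝟙 (does-⇔ (mk⇔ sym sym) (x Fin.≟ y) (y Fin.≟ x))

module Scheme {v : ℕ} {d l : ℤ} {N : Matrix v v} (N-inc : IsIncidence d l N) where

  open IsIncidence N-inc

  -- The entries of A₀ + A₁; A₂ + A₃ is its complement in J. Together with the sides of its two
  -- vertices, such an entry determines the class of the pair.
  base : Bool → Fin v → Bool → Fin v → ℤ
  base false x false y = I x y
  base false x true  y = N x y
  base true  x false y = N y x
  base true  x true  y = I x y

  -- The (vertex τ x , vertex υ y) entry of A_i is  scale i * base τ x υ y + shift i
  -- if parity i = τ xor υ, and 0 otherwise.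
  parity : Fin 4 → Bool
  parity 0F = false
  parity 1F = true
  parity 2F = false
  parity 3F = true

  scale shift : Fin 4 → ℤ
  scale 0F = 1ℤ
  scale 1F = 1ℤ
  scale 2F = -1ℤ
  scale 3F = -1ℤ
  shift 0F = 0ℤ
  shift 1F = 0ℤ
  shift 2F = 1ℤ
  shift 3F = 1ℤ

  -- The value of base on the pairs in R_i.
  value : Fin 4 → ℤ
  value 0F = 1ℤ
  value 1F = 1ℤ
  value 2F = 0ℤ
  value 3F = 0ℤ

  entry : Fin 4 → Bool → ℤ → ℤ
  entry i o m = 𝟙 (does (parity i Bool.≟ o)) * (scale i * m + shift i)

  private
    A : Fin 4 → Matrix (v ℕ.+ v) (v ℕ.+ v)
    A = 𝓧₂-matrix N

    entry-0-1 : ∀ a → a ≡ 1ℤ * (1ℤ * a + 0ℤ)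
    entry-0-1 = solve-∀

    entry-2-3 : ∀ a → 1ℤ - a ≡ 1ℤ * (-1ℤ * a + 1ℤ)
    entry-2-3 = solve-∀

    ↑ˡ≢↑ʳ : (x y : Fin v) → x ↑ˡ v ≢ v ↑ʳ y
    ↑ˡ≢↑ʳ x y eq with trans (sym (Fin.splitAt-↑ˡ v x v)) (trans (cong (splitAt v) eq) (Fin.splitAt-↑ʳ v v y))
    ... | ()

  𝓧₂-entry : ∀ i τ x υ y → A i (vertex τ x) (vertex υ y) ≡ entry i (τ xor υ) (base τ x υ y)
  𝓧₂-entry 0F false x false y =
    trans (cong 𝟙 (does-⇔ (mk⇔ (Fin.↑ˡ-injective v x y) (cong (_↑ˡ v))) (x ↑ˡ v Fin.≟ y ↑ˡ v) (x Fin.≟ y))) (entry-0-1 (I x y))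
  𝓧₂-entry 0F false x true  y = I-≢ (↑ˡ≢↑ʳ x y)
  𝓧₂-entry 0F true  x false y = I-≢ (↑ˡ≢↑ʳ y x ∘ sym)
  𝓧₂-entry 0F true  x true  y =
    trans (cong 𝟙 (does-⇔ (mk⇔ (Fin.↑ʳ-injective v x y) (cong (v ↑ʳ_))) (v ↑ʳ x Fin.≟ v ↑ʳ y) (x Fin.≟ y))) (entry-0-1 (I x y))
  𝓧₂-entry 1F false x false y = block-join O N (N ᵀ) O (inj₁ x) (inj₁ y)
  𝓧₂-entry 1F false x true  y = trans (block-join O N (N ᵀ) O (inj₁ x) (inj₂ y)) (entry-0-1 (N x y))
  𝓧₂-entry 1F true  x false y = trans (block-join O N (N ᵀ) O (inj₂ x) (inj₁ y)) (entry-0-1 (N y x))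
  𝓧₂-entry 1F true  x true  y = block-join O N (N ᵀ) O (inj₂ x) (inj₂ y)
  𝓧₂-entry 2F false x false y = trans (block-join (J ⊖ I) (O {v} {v}) O (J ⊖ I) (inj₁ x) (inj₁ y)) (entry-2-3 (I x y))
  𝓧₂-entry 2F false x true  y = block-join (J ⊖ I) (O {v} {v}) O (J ⊖ I) (inj₁ x) (inj₂ y)
  𝓧₂-entry 2F true  x false y = block-join (J ⊖ I) (O {v} {v}) O (J ⊖ I) (inj₂ x) (inj₁ y)
  𝓧₂-entry 2F true  x true  y = trans (block-join (J ⊖ I) (O {v} {v}) O (J ⊖ I) (inj₂ x) (inj₂ y)) (entry-2-3 (I x y))
  𝓧₂-entry 3F false x false y = block-join O (J ⊖ N) (J ⊖ (N ᵀ)) O (inj₁ x) (inj₁ y)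
  𝓧₂-entry 3F false x true  y = trans (block-join O (J ⊖ N) (J ⊖ (N ᵀ)) O (inj₁ x) (inj₂ y)) (entry-2-3 (N x y))
  𝓧₂-entry 3F true  x false y = trans (block-join O (J ⊖ N) (J ⊖ (N ᵀ)) O (inj₂ x) (inj₁ y)) (entry-2-3 (N y x))
  𝓧₂-entry 3F true  x true  y = block-join O (J ⊖ N) (J ⊖ (N ᵀ)) O (inj₂ x) (inj₂ y)

  I-zero-one : (x y : Fin v) → I x y ≡ 0ℤ ⊎ I x y ≡ 1ℤ
  I-zero-one x y with does (x Fin.≟ y)
  ... | true  = inj₂ refl
  ... | false = inj₁ refl

  base-zero-one : ∀ τ x υ y → base τ x υ y ≡ 0ℤ ⊎ base τ x υ y ≡ 1ℤ
  base-zero-one false x false y = I-zero-one x y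
  base-zero-one false x true  y = zero-one x y
  base-zero-one true  x false y = zero-one y x
  base-zero-one true  x true  y = I-zero-one x y

  base-comm : ∀ τ x υ y → base τ x υ y ≡ base υ y τ x
  base-comm false x false y = I-comm x y
  base-comm false x true  y = refl
  base-comm true  x false y = refl
  base-comm true  x true  y = I-comm x y

  valency : Bool → ℤ
  valency false = 1ℤ
  valency true  = d

  sum-I-row : (x : Fin v) → sum (I x) ≡ 1ℤ
  sum-I-row x = trans (sum-cong-≗ λ y → sym (ℤₚ.*-identityʳ (I x y))) (sum-I x λ _ → 1ℤ)

  sum-base : ∀ τ x υ → sum (base τ x υ) ≡ valency (τ xor υ)
  sum-base false x false = sum-I-row x
  sum-base false x true  = row-sums x
  sum-base true  x false = column-sums x
  sum-base true  x true  = sum-I-row x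

  -- Products of the blocks I, N, Nᵀ are blocks again except for N Nᵀ and Nᵀ N, which are affine in
  -- I. This closure is what makes the intersection numbers constant.
  compose : Bool → Bool → ℤ → ℤ
  compose true true m = (d - l) * m + l
  compose _    _    m = m

  sum-base-base : ∀ τ x σ υ y →
    ∑[ z < v ] (base τ x σ z * base σ z υ y) ≡ compose (τ xor σ) (σ xor υ) (base τ x υ y)
  sum-base-base false x false false y = sum-I x (λ z → I z y)
  sum-base-base false x false true  y = sum-I x (λ z → N z y)
  sum-base-base false x true  false y = row-grams x y
  sum-base-base false x true  true  y =
    trans (sum-cong-≗ λ z → trans (ℤₚ.*-comm (N x z) (I z y)) (cong (_* N x z) (I-comm z y))) (sum-I y (N x))
  sum-base-base true  x false false y =
    trans (sum-cong-≗ λ z → trans (ℤₚ.*-comm (N z x) (I z y)) (cong (_* N z x) (I-comm z y))) (sum-I y (λ z → N z x))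
  sum-base-base true  x false true  y = col-grams x y
  sum-base-base true  x true  false y = sum-I x (λ z → N y z)
  sum-base-base true  x true  true  y = sum-I x (λ z → I z y)

  product : Fin 4 → Fin 4 → Bool → Bool → ℤ → ℤ
  product i j o o′ m = scale i * scale j * compose o o′ m + scale i * shift j * valency o
                       + shift i * scale j * valency o′ + + v * (shift i * shift j)

  -- The parity of `i` fixes the side of the middle vertex, so the count is one product or zero,
  -- according to whether the parity of `j` fits.
  intersection : Fin 4 → Fin 4 → Bool → ℤ → ℤ
  intersection i j o m = 𝟙 (does (parity j Bool.≟ parity i xor o)) * product i j (parity i) (parity j) m

  sum-linear-linear : ∀ a b a′ b′ (f g : Fin v → ℤ) →
    ∑[ z < v ] ((a * f z + b) * (a′ * g z + b′))
      ≡ a * a′ * ∑[ z < v ] (f z * g z) + a * b′ * sum f + b * a′ * sum g + + v * (b * b′)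
  sum-linear-linear a b a′ b′ f g = begin
    ∑[ z < v ] ((a * f z + b) * (a′ * g z + b′))
      ≡⟨ sum-cong-≗ (λ z → lemma a b a′ b′ (f z) (g z)) ⟩
    ∑[ z < v ] (b * b′ + (a * a′) * (f z * g z) + (a * b′) * f z + (b * a′) * g z)
      ≡⟨ sum-linear (λ z → b * b′ + (a * a′) * (f z * g z) + (a * b′) * f z) (b * a′) g ⟩
    ∑[ z < v ] (b * b′ + (a * a′) * (f z * g z) + (a * b′) * f z) + b * a′ * sum g
      ≡⟨ cong (_+ b * a′ * sum g) (trans
           (sum-linear (λ z → b * b′ + (a * a′) * (f z * g z)) (a * b′) f)
           (cong (_+ a * b′ * sum f) (trans
             (sum-linear (λ _ → b * b′) (a * a′) (λ z → f z * g z))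
             (cong (_+ a * a′ * ∑[ z < v ] (f z * g z)) (sum-const v (b * b′)))))) ⟩
    + v * (b * b′) + a * a′ * ∑[ z < v ] (f z * g z) + a * b′ * sum f + b * a′ * sum g
      ≡⟨ lemma′ (+ v * (b * b′)) (a * a′ * ∑[ z < v ] (f z * g z)) (a * b′ * sum f) (b * a′ * sum g) ⟩
    a * a′ * ∑[ z < v ] (f z * g z) + a * b′ * sum f + b * a′ * sum g + + v * (b * b′) ∎
    where
    lemma : ∀ a b a′ b′ f g →
      (a * f + b) * (a′ * g + b′) ≡ b * b′ + (a * a′) * (f * g) + (a * b′) * f + (b * a′) * g
    lemma = solve-∀
    lemma′ : ∀ p q r s → p + q + r + s ≡ q + r + s + p
    lemma′ = solve-∀

  private
    matches : Fin 4 → Fin 4 → Bool → Bool → ℤ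
    matches i j o o′ = 𝟙 (does (parity i Bool.≟ o)) * 𝟙 (does (parity j Bool.≟ o′))

    sum-side : ∀ i j τ x σ υ y →
      ∑[ z < v ] (entry i (τ xor σ) (base τ x σ z) * entry j (σ xor υ) (base σ z υ y))
        ≡ matches i j (τ xor σ) (σ xor υ) * product i j (parity i) (parity j) (base τ x υ y)
    sum-side i j τ x σ υ y = begin
      ∑[ z < v ] (entry i (τ xor σ) (base τ x σ z) * entry j (σ xor υ) (base σ z υ y))
        ≡⟨ sum-cong-≗ (λ z → *-interchange (𝟙 (does (parity i Bool.≟ τ xor σ))) (scale i * base τ x σ z + shift i)
                                          (𝟙 (does (parity j Bool.≟ σ xor υ))) (scale j * base σ z υ y + shift j)) ⟩
      ∑[ z < v ] (matches i j (τ xor σ) (σ xor υ) * term z)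
        ≡⟨ *-distribˡ-sum (matches i j (τ xor σ) (σ xor υ)) term ⟨
      matches i j (τ xor σ) (σ xor υ) * ∑[ z < v ] term z
        ≡⟨ cong (matches i j (τ xor σ) (σ xor υ) *_) (trans
             (sum-linear-linear (scale i) (shift i) (scale j) (shift j) (base τ x σ) (λ z → base σ z υ y))
             (cong₂ _+_ (cong₂ _+_ (cong₂ (λ p r → scale i * scale j * p + scale i * shift j * r)
                                           (sum-base-base τ x σ υ y) (sum-base τ x σ))
                                    (cong (shift i * scale j *_) column))
                        refl)) ⟩
      matches i j (τ xor σ) (σ xor υ) * product i j (τ xor σ) (σ xor υ) (base τ x υ y)
        -- If the indicators are nonzero the parities agree, otherwise both sides vanish. The
        -- cofactor thereby becomes independent of the side `σ`, so that the two sides can be added.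
        ≡⟨ on-match (parity i) (parity j) (τ xor σ) (σ xor υ) ⟩
      matches i j (τ xor σ) (σ xor υ) * product i j (parity i) (parity j) (base τ x υ y) ∎
      where
      term : Fin v → ℤ
      term z = (scale i * base τ x σ z + shift i) * (scale j * base σ z υ y + shift j)

      column : sum (λ z → base σ z υ y) ≡ valency (σ xor υ)
      column = trans (sum-cong-≗ λ z → base-comm σ z υ y)
                     (trans (sum-base υ y σ) (cong valency (Bool.xor-comm υ σ)))

      on-match : ∀ p q o o′ →
        𝟙 (does (p Bool.≟ o)) * 𝟙 (does (q Bool.≟ o′)) * product i j o o′ (base τ x υ y)
          ≡ 𝟙 (does (p Bool.≟ o)) * 𝟙 (does (q Bool.≟ o′)) * product i j p q (base τ x υ y)
      on-match false false false false = refl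
      on-match false false false true  = refl
      on-match false false true  _     = refl
      on-match false true  false false = refl
      on-match false true  false true  = refl
      on-match false true  true  _     = refl
      on-match true  false true  false = refl
      on-match true  false true  true  = refl
      on-match true  false false _     = refl
      on-match true  true  true  false = refl
      on-match true  true  true  true  = refl
      on-match true  true  false _     = refl

    sum-matches : ∀ p q τ υ →
      𝟙 (does (p Bool.≟ τ xor false)) * 𝟙 (does (q Bool.≟ false xor υ))
        + 𝟙 (does (p Bool.≟ τ xor true)) * 𝟙 (does (q Bool.≟ true xor υ))
        ≡ 𝟙 (does (q Bool.≟ p xor (τ xor υ)))
    sum-matches false false false false = refl
    sum-matches false false false true  = refl
    sum-matches false false true  false = refl
    sum-matches false false true  true  = refl
    sum-matches false true  false false = refl
    sum-matches false true  false true  = refl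
    sum-matches false true  true  false = refl
    sum-matches false true  true  true  = refl
    sum-matches true  false false false = refl
    sum-matches true  false false true  = refl
    sum-matches true  false true  false = refl
    sum-matches true  false true  true  = refl
    sum-matches true  true  false false = refl
    sum-matches true  true  false true  = refl
    sum-matches true  true  true  false = refl
    sum-matches true  true  true  true  = refl

    indicator-entry : ∀ i o {m} → m ≡ 0ℤ ⊎ m ≡ 1ℤ → 𝟙 (does (entry i o m ℤₚ.≟ 1ℤ)) ≡ entry i o m
    indicator-entry 0F false (inj₁ refl) = refl
    indicator-entry 0F false (inj₂ refl) = refl
    indicator-entry 0F true  _           = refl
    indicator-entry 1F false _           = refl
    indicator-entry 1F true  (inj₁ refl) = refl
    indicator-entry 1F true  (inj₂ refl) = refl
    indicator-entry 2F false (inj₁ refl) = refl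
    indicator-entry 2F false (inj₂ refl) = refl
    indicator-entry 2F true  _           = refl
    indicator-entry 3F false _           = refl
    indicator-entry 3F true  (inj₁ refl) = refl
    indicator-entry 3F true  (inj₂ refl) = refl

    indicator-𝓧₂ : ∀ i τ x υ y →
      𝟙 (does (R? (𝓧₂ N) i (vertex τ x) (vertex υ y))) ≡ entry i (τ xor υ) (base τ x υ y)
    indicator-𝓧₂ i τ x υ y = trans
      (cong (λ a → 𝟙 (does (a ℤₚ.≟ 1ℤ))) (𝓧₂-entry i τ x υ y))
      (indicator-entry i (τ xor υ) (base-zero-one τ x υ y))

  count-𝓧₂ : ∀ i j τ x υ y →
    + length (filter (λ z → R? (𝓧₂ N) i (vertex τ x) z ×-dec R? (𝓧₂ N) j z (vertex υ y)) (allFin (v ℕ.+ v)))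
      ≡ intersection i j (τ xor υ) (base τ x υ y)
  count-𝓧₂ i j τ x υ y = begin
    + length (filter (λ z → R? (𝓧₂ N) i (vertex τ x) z ×-dec R? (𝓧₂ N) j z (vertex υ y)) (allFin (v ℕ.+ v)))
      ≡⟨ length-filter-allFin (λ z → R? (𝓧₂ N) i (vertex τ x) z ×-dec R? (𝓧₂ N) j z (vertex υ y)) ⟩
    sum {v ℕ.+ v} f
      ≡⟨ sum-vertex {v} f ⟩
    ∑[ z < v ] f (vertex false z) + ∑[ z < v ] f (vertex true z)
      ≡⟨ cong₂ _+_ (side false) (side true) ⟩
    matches i j (τ xor false) (false xor υ) * K + matches i j (τ xor true) (true xor υ) * K
      ≡⟨ ℤₚ.*-distribʳ-+ K (matches i j (τ xor false) (false xor υ)) (matches i j (τ xor true) (true xor υ)) ⟨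
    (matches i j (τ xor false) (false xor υ) + matches i j (τ xor true) (true xor υ)) * K
      ≡⟨ cong (_* K) (sum-matches (parity i) (parity j) τ υ) ⟩
    intersection i j (τ xor υ) (base τ x υ y) ∎
    where
    f : Fin (v ℕ.+ v) → ℤ
    f z = 𝟙 (does (R? (𝓧₂ N) i (vertex τ x) z) ∧ does (R? (𝓧₂ N) j z (vertex υ y)))

    K : ℤ
    K = product i j (parity i) (parity j) (base τ x υ y)

    side : ∀ σ → ∑[ z < v ] f (vertex σ z) ≡ matches i j (τ xor σ) (σ xor υ) * K
    side σ = trans
      (sum-cong-≗ λ z → trans
        (𝟙-∧ (does (R? (𝓧₂ N) i (vertex τ x) (vertex σ z))) (does (R? (𝓧₂ N) j (vertex σ z) (vertex υ y))))
        (cong₂ _*_ (indicator-𝓧₂ i τ x σ z) (indicator-𝓧₂ j σ z υ y)))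
      (sum-side i j τ x σ υ y)

  private
    entry≡1 : ∀ i o {m} → m ≡ 0ℤ ⊎ m ≡ 1ℤ → entry i o m ≡ 1ℤ → parity i ≡ o × value i ≡ m
    entry≡1 0F false (inj₁ refl) ()
    entry≡1 0F false (inj₂ refl) _  = refl , refl
    entry≡1 0F true  _           ()
    entry≡1 1F false _           ()
    entry≡1 1F true  (inj₁ refl) ()
    entry≡1 1F true  (inj₂ refl) _  = refl , refl
    entry≡1 2F false (inj₁ refl) _  = refl , refl
    entry≡1 2F false (inj₂ refl) ()
    entry≡1 2F true  _           ()
    entry≡1 3F false _           ()
    entry≡1 3F true  (inj₁ refl) _  = refl , refl
    entry≡1 3F true  (inj₂ refl) ()

    class : ∀ o {m} → m ≡ 0ℤ ⊎ m ≡ 1ℤ → ∃[ i ] entry i o m ≡ 1ℤ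
    class false (inj₁ refl) = 2F , refl
    class false (inj₂ refl) = 0F , refl
    class true  (inj₁ refl) = 3F , refl
    class true  (inj₂ refl) = 1F , refl

    class-unique : ∀ i j → parity i ≡ parity j → value i ≡ value j → i ≡ j
    class-unique 0F 0F _ _ = refl
    class-unique 0F 1F ()
    class-unique 0F 2F _ ()
    class-unique 0F 3F ()
    class-unique 1F 0F ()
    class-unique 1F 1F _ _ = refl
    class-unique 1F 2F ()
    class-unique 1F 3F _ ()
    class-unique 2F 0F _ ()
    class-unique 2F 1F ()
    class-unique 2F 2F _ _ = refl
    class-unique 2F 3F ()
    class-unique 3F 0F ()
    class-unique 3F 1F _ ()
    class-unique 3F 2F ()
    class-unique 3F 3F _ _ = refl

  related⇒ : ∀ i τ x υ y → R (𝓧₂ N) i (vertex τ x) (vertex υ y) → parity i ≡ τ xor υ × value i ≡ base τ x υ y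
  related⇒ i τ x υ y r =
    entry≡1 i (τ xor υ) (base-zero-one τ x υ y) (trans (sym (𝓧₂-entry i τ x υ y)) r)

  isScheme : (∀ i → ∃₂ λ x y → R (𝓧₂ N) i x y) → IsSymmetricAssociationScheme (𝓧₂ N)
  isScheme inhabited = record
    { identity = λ x y → mk⇔ (I≡1 x y) (λ { refl → I-refl x })
    ; nonempty = inhabited
    ; covering = λ u w → on-vertices {v} (λ u w → ∃[ i ] R (𝓧₂ N) i u w) (λ τ x υ y →
        let i , eq = class (τ xor υ) (base-zero-one τ x υ y) in i , trans (𝓧₂-entry i τ x υ y) eq) u w
    ; disjoint = λ i j → on-vertices {v} (λ u w → R (𝓧₂ N) i u w → R (𝓧₂ N) j u w → i ≡ j) λ τ x υ y rᵢ rⱼ →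
        let pᵢ , vᵢ = related⇒ i τ x υ y rᵢ
            pⱼ , vⱼ = related⇒ j τ x υ y rⱼ in
        class-unique i j (trans pᵢ (sym pⱼ)) (trans vᵢ (sym vⱼ))
    ; symm     = λ i → on-vertices {v} (λ u w → R (𝓧₂ N) i u w → R (𝓧₂ N) i w u) λ τ x υ y r → begin
        A i (vertex υ y) (vertex τ x)      ≡⟨ 𝓧₂-entry i υ y τ x ⟩
        entry i (υ xor τ) (base υ y τ x)   ≡⟨ cong₂ (entry i) (Bool.xor-comm υ τ) (base-comm υ y τ x) ⟩
        entry i (τ xor υ) (base τ x υ y)   ≡⟨ 𝓧₂-entry i τ x υ y ⟨
        A i (vertex τ x) (vertex υ y)      ≡⟨ r ⟩
        1ℤ                                 ∎
    -- The absolute value only changes the type: at an actual pair of the class the integer is a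
    -- cardinality.
    ; p        = λ i j k → ℤ.∣ intersection i j (parity k) (value k) ∣
    ; regular  = λ i j k → on-vertices {v} (λ u w → R (𝓧₂ N) k u w →
        length (filter (λ z → R? (𝓧₂ N) i u z ×-dec R? (𝓧₂ N) j z w) (allFin (v ℕ.+ v)))
          ≡ ℤ.∣ intersection i j (parity k) (value k) ∣) λ τ x υ y r →
        let pₖ , vₖ = related⇒ k τ x υ y r in
        cong ℤ.∣_∣ (trans (count-𝓧₂ i j τ x υ y) (sym (cong₂ (intersection i j) pₖ vₖ)))
    }
    where
    I≡1 : (x y : Fin (v ℕ.+ v)) → I x y ≡ 1ℤ → x ≡ y
    I≡1 x y with x Fin.≟ y
    ... | yes x≡y = λ _ → x≡y
    ... | no  _   = λ ()

-- Rational parameters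

private
  -- Division by 1 normalises through a gcd, whereas the literal is already in lowest terms, so
  -- arithmetic on it reduces.
  fromℤ≡ : ∀ i → fromℤ i ≡ ℚ.fromℤ i
  fromℤ≡ i = ℚₚ.↥p/↧p≡p (ℚ.fromℤ i)

fromℤ-+ : ∀ i j → fromℤ (i + j) ≡ fromℤ i Rat.+ fromℤ j
fromℤ-+ i j = sym (trans (cong₂ Rat._+_ (fromℤ≡ i) (fromℤ≡ j))
  (cong (Rat._/ 1) (cong₂ _+_ (ℤₚ.*-identityʳ i) (ℤₚ.*-identityʳ j))))

fromℤ-* : ∀ i j → fromℤ (i * j) ≡ fromℤ i Rat.* fromℤ j
fromℤ-* i j = sym (cong₂ Rat._*_ (fromℤ≡ i) (fromℤ≡ j))

fromℤ-neg : ∀ i → fromℤ (- i) ≡ Rat.- fromℤ i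
fromℤ-neg (+ 0)       = refl
fromℤ-neg (+ (suc n)) = refl
fromℤ-neg -[1+ n ]    = sym (trans (cong Rat.-_ (fromℤ≡ -[1+ n ])) (sym (fromℤ≡ (+ suc n))))

fromℤ-- : ∀ i j → fromℤ (i - j) ≡ fromℤ i Rat.- fromℤ j
fromℤ-- i j = trans (fromℤ-+ i (- j)) (cong (fromℤ i Rat.+_) (fromℤ-neg j))

½ : ℚ
½ = + 1 Rat./ 2

-- The common shape of `λ₁`, `λ₂` and `λ₃`.
weighℚ : ℚ → ℚ → ℚ → ℚ
weighℚ α t f = (1ℚ Rat.- α) Rat.* t Rat.+ (fromℤ (+ 2) Rat.* α Rat.- 1ℚ) Rat.* f

fromℤ-weigh : ∀ {r a t f₄ f₁ F₁} → + 2 * r ≡ weigh a t f₄ f₁ → fromℤ f₁ ≡ F₁ →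
  fromℤ r ≡ weighℚ (fromℤ a) (fromℤ t Rat.- fromℤ f₄ Rat.* ½) F₁
fromℤ-weigh {r} {a} {t} {f₄} {f₁} {F₁} eq refl = begin
  fromℤ r
    ≡⟨ halve (fromℤ r) ⟩
  ½ Rat.* (fromℤ (+ 2) Rat.* fromℤ r)
    ≡⟨ cong (½ Rat.*_) (trans (sym (fromℤ-* (+ 2) r)) (cong fromℤ eq)) ⟩
  ½ Rat.* fromℤ (weigh a t f₄ f₁)
    ≡⟨ cong (½ Rat.*_) (begin
         fromℤ ((1ℤ - a) * (+ 2 * t - f₄) + (+ 2 * a - 1ℤ) * (+ 2 * f₁))
           ≡⟨ fromℤ-+ ((1ℤ - a) * (+ 2 * t - f₄)) ((+ 2 * a - 1ℤ) * (+ 2 * f₁)) ⟩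
         fromℤ ((1ℤ - a) * (+ 2 * t - f₄)) Rat.+ fromℤ ((+ 2 * a - 1ℤ) * (+ 2 * f₁))
           ≡⟨ cong₂ Rat._+_ (fromℤ-* (1ℤ - a) (+ 2 * t - f₄)) (fromℤ-* (+ 2 * a - 1ℤ) (+ 2 * f₁)) ⟩
         fromℤ (1ℤ - a) Rat.* fromℤ (+ 2 * t - f₄) Rat.+ fromℤ (+ 2 * a - 1ℤ) Rat.* fromℤ (+ 2 * f₁)
           ≡⟨ cong₂ Rat._+_
                (cong₂ Rat._*_ (fromℤ-- 1ℤ a) (trans (fromℤ-- (+ 2 * t) f₄) (cong (Rat._- fromℤ f₄) (fromℤ-* (+ 2) t))))
                (cong₂ Rat._*_ (trans (fromℤ-- (+ 2 * a) 1ℤ) (cong (Rat._- 1ℚ) (fromℤ-* (+ 2) a))) (fromℤ-* (+ 2) f₁)) ⟩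
         weighℚ (fromℤ a) (fromℤ (+ 2) Rat.* fromℤ t Rat.- fromℤ f₄) (fromℤ (+ 2) Rat.* fromℤ f₁) ∎) ⟩
  ½ Rat.* weighℚ (fromℤ a) (fromℤ (+ 2) Rat.* fromℤ t Rat.- fromℤ f₄) (fromℤ (+ 2) Rat.* fromℤ f₁)
    ≡⟨ distribute (fromℤ a) (fromℤ t) (fromℤ f₄) (fromℤ f₁) ⟩
  weighℚ (fromℤ a) (fromℤ t Rat.- fromℤ f₄ Rat.* ½) (fromℤ f₁) ∎
  where
  open ℚ.+-*-Solver
  halve : ∀ r → r ≡ ½ Rat.* (fromℤ (+ 2) Rat.* r)
  halve = solve 1 (λ r → r := con ½ :* (con (fromℤ (+ 2)) :* r)) refl
  distribute : ∀ a t f₄ f₁ →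
    ½ Rat.* ((1ℚ Rat.- a) Rat.* (fromℤ (+ 2) Rat.* t Rat.- f₄) Rat.+ (fromℤ (+ 2) Rat.* a Rat.- 1ℚ) Rat.* (fromℤ (+ 2) Rat.* f₁))
      ≡ (1ℚ Rat.- a) Rat.* (t Rat.- f₄ Rat.* ½) Rat.+ (fromℤ (+ 2) Rat.* a Rat.- 1ℚ) Rat.* f₁
  distribute = solve 4 (λ a t f₄ f₁ →
    con ½ :* ((con 1ℚ :- a) :* (con (fromℤ (+ 2)) :* t :- f₄) :+ (con (fromℤ (+ 2)) :* a :- con 1ℚ) :* (con (fromℤ (+ 2)) :* f₁))
      := (con 1ℚ :- a) :* (t :- f₄ :* con ½) :+ (con (fromℤ (+ 2)) :* a :- con 1ℚ) :* f₁) refl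

module _ (v d l : ℕ) (a : ℤ) where

  private
    B L D V : ℤ
    B = + ((v ℕ.+ v ℕ.∸ 2) C 2)
    L = + l
    D = + d
    V = + v

    B≡ : fromℤ B ≡ fromℕ ((2 ℕ.* v ℕ.∸ 2) C 2)
    B≡ = cong (λ k → fromℕ ((v ℕ.+ k ℕ.∸ 2) C 2)) (sym (ℕₚ.+-identityʳ v))

  -- Twice `λ₁` and `λ₃`, but four times `λ₂`: a pair on one side leaves the two vertices of the
  -- other side unordered, which costs a second doubling and accounts for the quarter in `λ₂`.
  param₁ param₂ param₃ : ℤ
  param₁ = weigh a B (L * (D - 1ℤ)) (D * D + D * (V - + 2) - + 2 * L * (D - 1ℤ))
  param₂ = weigh a (+ 2 * B) (L * L) (+ 2 * (D * D - L * L))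
  param₃ = weigh a B 0ℤ (D * D)

  param₁⇒λ₁ : ∀ k → + 2 * + k ≡ param₁ → fromℕ k ≡ λ₁ v d l a
  param₁⇒λ₁ k eq = trans
    (fromℤ-weigh {+ k} {a} {B} {L * (D - 1ℤ)} {D * D + D * (V - + 2) - + 2 * L * (D - 1ℤ)} eq F₁≡)
    (cong₂ (λ b f → weighℚ (fromℤ a) (b Rat.- f Rat.* ½) F₁) B≡ L[D-1])
    where
    F₁ : ℚ
    F₁ = fromℤ D Rat.* fromℤ D Rat.+ fromℤ D Rat.* (fromℤ V Rat.- fromℤ (+ 2))
           Rat.- fromℤ (+ 2) Rat.* fromℤ L Rat.* (fromℤ D Rat.- 1ℚ)

    L[D-1] : fromℤ (L * (D - 1ℤ)) ≡ fromℤ L Rat.* (fromℤ D Rat.- 1ℚ)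
    L[D-1] = trans (fromℤ-* L (D - 1ℤ)) (cong (fromℤ L Rat.*_) (fromℤ-- D 1ℤ))

    F₁≡ : fromℤ (D * D + D * (V - + 2) - + 2 * L * (D - 1ℤ)) ≡ F₁
    F₁≡ = trans (fromℤ-- (D * D + D * (V - + 2)) (+ 2 * L * (D - 1ℤ))) (cong₂ Rat._-_
      (trans (fromℤ-+ (D * D) (D * (V - + 2))) (cong₂ Rat._+_ (fromℤ-* D D)
        (trans (fromℤ-* D (V - + 2)) (cong (fromℤ D Rat.*_) (fromℤ-- V (+ 2))))))
      (trans (fromℤ-* (+ 2 * L) (D - 1ℤ)) (cong₂ Rat._*_ (fromℤ-* (+ 2) L) (fromℤ-- D 1ℤ))))

  param₂⇒λ₂ : ∀ k → + 2 * (+ 2 * + k) ≡ param₂ → fromℕ k ≡ λ₂ v d l a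
  param₂⇒λ₂ k eq = begin
    fromℕ k
      ≡⟨ halve (fromℕ k) ⟩
    ½ Rat.* (fromℤ (+ 2) Rat.* fromℕ k)
      ≡⟨ cong (½ Rat.*_) (trans (sym (fromℤ-* (+ 2) (+ k)))
           (fromℤ-weigh {+ 2 * + k} {a} {+ 2 * B} {L * L} {+ 2 * (D * D - L * L)} eq
             (trans (fromℤ-* (+ 2) (D * D - L * L)) (cong (fromℤ (+ 2) Rat.*_)
               (trans (fromℤ-- (D * D) (L * L)) (cong₂ Rat._-_ (fromℤ-* D D) (fromℤ-* L L))))))) ⟩
    ½ Rat.* weighℚ (fromℤ a) (fromℤ (+ 2 * B) Rat.- fromℤ (L * L) Rat.* ½) f
      ≡⟨ cong₂ (λ b g → ½ Rat.* weighℚ (fromℤ a) (b Rat.- g Rat.* ½) f)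
           (trans (fromℤ-* (+ 2) B) (cong (fromℤ (+ 2) Rat.*_) B≡)) (fromℤ-* L L) ⟩
    ½ Rat.* weighℚ (fromℤ a) (fromℤ (+ 2) Rat.* b Rat.- fromℤ L Rat.* fromℤ L Rat.* ½) f
      ≡⟨ distribute (fromℤ a) b (fromℤ L) (fromℤ D) ⟩
    λ₂ v d l a ∎
    where
    b = fromℕ ((2 ℕ.* v ℕ.∸ 2) C 2)
    f = fromℤ (+ 2) Rat.* (fromℤ D Rat.* fromℤ D Rat.- fromℤ L Rat.* fromℤ L)
    ¼ = + 1 Rat./ 4
    open ℚ.+-*-Solver
    halve : ∀ r → r ≡ ½ Rat.* (fromℤ (+ 2) Rat.* r)
    halve = solve 1 (λ r → r := con ½ :* (con (fromℤ (+ 2)) :* r)) refl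
    distribute : ∀ a b l d →
      ½ Rat.* ((1ℚ Rat.- a) Rat.* (fromℤ (+ 2) Rat.* b Rat.- l Rat.* l Rat.* ½)
               Rat.+ (fromℤ (+ 2) Rat.* a Rat.- 1ℚ) Rat.* (fromℤ (+ 2) Rat.* (d Rat.* d Rat.- l Rat.* l)))
        ≡ (1ℚ Rat.- a) Rat.* (b Rat.- l Rat.* l Rat.* ¼) Rat.+ (fromℤ (+ 2) Rat.* a Rat.- 1ℚ) Rat.* (d Rat.* d Rat.- l Rat.* l)
    distribute = solve 4 (λ a b l d →
      con ½ :* ((con 1ℚ :- a) :* (con (fromℤ (+ 2)) :* b :- l :* l :* con ½)
               :+ (con (fromℤ (+ 2)) :* a :- con 1ℚ) :* (con (fromℤ (+ 2)) :* (d :* d :- l :* l)))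
        := (con 1ℚ :- a) :* (b :- l :* l :* con ¼) :+ (con (fromℤ (+ 2)) :* a :- con 1ℚ) :* (d :* d :- l :* l)) refl

  param₃⇒λ₃ : ∀ k → + 2 * + k ≡ param₃ → fromℕ k ≡ λ₃ v d l a
  param₃⇒λ₃ k eq = trans
    (fromℤ-weigh {+ k} {a} {B} {0ℤ} {D * D} eq (fromℤ-* D D))
    (cong (λ b → weighℚ (fromℤ a) b (fromℤ D Rat.* fromℤ D)) (trans (ℚₚ.+-identityʳ (fromℤ B)) B≡))

-- Degrees

length-filter-mono : ∀ {A : Set} {P Q : Pred A 0ℓ} (P? : Decidable P) (Q? : Decidable Q) →
                     (∀ x → P x → Q x) → ∀ xs → length (filter P? xs) ℕ.≤ length (filter Q? xs)
length-filter-mono P? Q? P⇒Q [] = ℕ.z≤n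
length-filter-mono P? Q? P⇒Q (x ∷ xs) with P? x | Q? x
... | yes p | yes q = ℕ.s≤s (length-filter-mono P? Q? P⇒Q xs)
... | yes p | no ¬q = contradiction (P⇒Q x p) ¬q
... | no _  | yes _ = ℕₚ.m≤n⇒m≤1+n (length-filter-mono P? Q? P⇒Q xs)
... | no _  | no _  = length-filter-mono P? Q? P⇒Q xs

degree-antitone : (H : Hypergraph n) {S T : Subset n} → S ⊆ T → degree H T ℕ.≤ degree H S
degree-antitone {n} H {S} {T} S⊆T = length-filter-mono
  (λ e → edge? H e ×-dec T ⊆? e) (λ e → edge? H e ×-dec S ⊆? e)
  (λ e (e∈H , T⊆e) → e∈H , T⊆e ∘ S⊆T) (subsets n)

∈-subsets : (α : Subset n) → α List.∈ subsets n
∈-subsets []                    = here refl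
∈-subsets {suc n} (inside  ∷ α) = List.∈-++⁺ˡ (List.∈-map⁺ (inside ∷_) (∈-subsets α))
∈-subsets {suc n} (outside ∷ α) = List.∈-++⁺ʳ (List.map (inside ∷_) (subsets n)) (List.∈-map⁺ (outside ∷_) (∈-subsets α))

degree-positive : (H : Hypergraph n) {S α : Subset n} → Edge H α → S ⊆ α → 0 ℕ.< degree H S
degree-positive H {S} {α} α∈H S⊆α =
  List.filter-some (λ e → edge? H e ×-dec S ⊆? e) (List.lose (∈-subsets α) (α∈H , S⊆α))

∣p∣≡0⇒p≡⊥ : (p : Subset n) → ∣ p ∣ ≡ 0 → p ≡ ⊥
∣p∣≡0⇒p≡⊥ []            _  = refl
∣p∣≡0⇒p≡⊥ (outside ∷ p) eq = cong (outside ∷_) (∣p∣≡0⇒p≡⊥ p eq)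

∣p∣≡1⇒p≡⁅x⁆ : (p : Subset n) → ∣ p ∣ ≡ 1 → ∃[ x ] p ≡ ⁅ x ⁆
∣p∣≡1⇒p≡⁅x⁆ (inside  ∷ p) eq = zero , cong (inside ∷_) (∣p∣≡0⇒p≡⊥ p (ℕₚ.suc-injective eq))
∣p∣≡1⇒p≡⁅x⁆ (outside ∷ p) eq = let x , p≡⁅x⁆ = ∣p∣≡1⇒p≡⁅x⁆ p eq in suc x , cong (outside ∷_) p≡⁅x⁆

elements-⊥ : ∀ n → elements {n} ⊥ ≡ []
elements-⊥ zero    = refl
elements-⊥ (suc n) = cong (List.map suc) (elements-⊥ n)

-- A row of `I` is 1 once and 0 elsewhere; the value at 0 is counted `n` times and corrected, which
-- avoids subtracting from `n`.
sum-at-I : ∀ (h : ℤ → ℤ) (x : Fin n) → ∑[ y < n ] h (I x y) ≡ + n * h 0ℤ + (h 1ℤ - h 0ℤ)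
sum-at-I {n} h x = begin
  ∑[ y < n ] h (I x y)
    ≡⟨ sum-cong-≗ (λ y → interpolate (does (x Fin.≟ y))) ⟩
  ∑[ y < n ] (h 0ℤ + I x y * (h 1ℤ - h 0ℤ))
    ≡⟨ ∑-distrib-+ (λ _ → h 0ℤ) (λ y → I x y * (h 1ℤ - h 0ℤ)) ⟩
  ∑[ y < n ] h 0ℤ + ∑[ y < n ] (I x y * (h 1ℤ - h 0ℤ))
    ≡⟨ cong₂ _+_ (sum-const n (h 0ℤ)) (sum-I x (λ _ → h 1ℤ - h 0ℤ)) ⟩
  + n * h 0ℤ + (h 1ℤ - h 0ℤ) ∎
  where
  lemma₀ : ∀ a b → a ≡ a + 0ℤ * (b - a)
  lemma₀ = solve-∀
  lemma₁ : ∀ a b → b ≡ a + 1ℤ * (b - a)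
  lemma₁ = solve-∀
  interpolate : ∀ b → h (𝟙 b) ≡ h 0ℤ + 𝟙 b * (h 1ℤ - h 0ℤ)
  interpolate true  = lemma₁ (h 0ℤ) (h 1ℤ)
  interpolate false = lemma₀ (h 0ℤ) (h 1ℤ)

2*-injective : ∀ {i j : ℕ} → + 2 * + i ≡ + 2 * + j → i ≡ j
2*-injective {i} {j} eq = ℤₚ.+-injective (ℤₚ.*-cancelˡ-≡ (+ 2) (+ i) (+ j) eq)

4*-injective : ∀ {i j : ℕ} → + 2 * (+ 2 * + i) ≡ + 2 * (+ 2 * + j) → i ≡ j
4*-injective {i} {j} eq = 2*-injective (ℤₚ.*-cancelˡ-≡ (+ 2) (+ 2 * + i) (+ 2 * + j) eq)

double-weigh : ∀ a t f₄ f₁ → + 2 * weigh a t f₄ f₁ ≡ weigh a (+ 2 * t) (+ 2 * f₄) (+ 2 * f₁)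
double-weigh = lemma
  where
  lemma : ∀ a t f₄ f₁ → + 2 * ((1ℤ - a) * (+ 2 * t - f₄) + (+ 2 * a - 1ℤ) * (+ 2 * f₁))
                          ≡ (1ℤ - a) * (+ 2 * (+ 2 * t) - + 2 * f₄) + (+ 2 * a - 1ℤ) * (+ 2 * (+ 2 * f₁))
  lemma = solve-∀

-- The argument `i` stands for an entry of `I`: 0 gives the sum for two distinct lines, 1 the
-- diagonal term that occurs when one line is fixed and the other is summed.
unit-rows four-rows : ℤ → ℤ → ℤ → ℤ
unit-rows d l i = d * d + d * d + (- + 2) * (((d - l) * i + l) * ((d - l) * i + l))
four-rows d l i = ((d - l) * i + l) * ((d - l) * i + l) + -1ℤ * ((d * i) * (d * i))

module _ {v : ℕ} {d l : ℤ} {W : Matrix v v} (W-bal : IsBalanced d l W) where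

  sum-unitMinor-I : ∀ x x′ → sum₂ (unitMinor W x x′) ≡ unit-rows d l (I x x′)
  sum-unitMinor-I x x′ = trans (sum-unitMinor-rows W-bal x x′)
    (cong (λ g → d * d + d * d + (- + 2) * (g * g)) (squares-gram W-bal x x′))

  sum-fourMinor-I : ∀ x x′ → sum₂ (fourMinor W x x′) ≡ four-rows d l (I x x′)
  sum-fourMinor-I x x′ = trans (sum-fourMinor-rows W-bal x x′)
    (cong₂ (λ g h → g * g + -1ℤ * (h * h)) (squares-gram W-bal x x′) (gram W-bal x x′))

module _ {v : ℕ} {d l : ℤ} {W : Matrix v v} (W-bal : IsBalanced d l W) where

  -- Transposing `W` only reverses the factors of the second product in the minor.
  sum-unitMinor-columns : ∀ y y′ → sum₂ (λ x x′ → unitMinor W x x′ y y′) ≡ unit-rows d l (I y y′)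
  sum-unitMinor-columns y y′ = trans
    (sum₂-cong λ x x′ → cong (unit (W x y * W x′ y′)) (ℤₚ.*-comm (W x y′) (W x′ y)))
    (sum-unitMinor-I (transpose W-bal) y y′)

  sum-fourMinor-columns : ∀ y y′ → sum₂ (λ x x′ → fourMinor W x x′ y y′) ≡ four-rows d l (I y y′)
  sum-fourMinor-columns y y′ = trans
    (sum₂-cong λ x x′ → cong (four (W x y * W x′ y′)) (ℤₚ.*-comm (W x y′) (W x′ y)))
    (sum-fourMinor-I (transpose W-bal) y y′)

  private
    F₁-alt = unitMinor-alternating W (ternary W-bal)
    F₄-alt = fourMinor-alternating W (ternary W-bal)

  sumOnPairs-same-side : ∀ τ {x y} → x ≢ y →
    (+ 2 * sumOnPairs (unitMinor W) (⁅ vertex {v} τ x ⁆ ∪ ⁅ vertex {v} τ y ⁆) ≡ + 2 * (d * d - l * l)) ×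
    (+ 2 * sumOnPairs (fourMinor W) (⁅ vertex {v} τ x ⁆ ∪ ⁅ vertex {v} τ y ⁆) ≡ l * l)
  sumOnPairs-same-side τ {x} {y} x≢y = trans (units τ) unit-off , trans (fours τ) four-off
    where
    unit-off : unit-rows d l (I x y) ≡ + 2 * (d * d - l * l)
    unit-off = trans (cong (unit-rows d l) (I-≢ x≢y)) (lemma d l)
      where
      lemma : ∀ d l → d * d + d * d + (- + 2) * (((d - l) * 0ℤ + l) * ((d - l) * 0ℤ + l)) ≡ + 2 * (d * d - l * l)
      lemma = solve-∀
    four-off : four-rows d l (I x y) ≡ l * l
    four-off = trans (cong (four-rows d l) (I-≢ x≢y)) (lemma d l)
      where
      lemma : ∀ d l → ((d - l) * 0ℤ + l) * ((d - l) * 0ℤ + l) + -1ℤ * ((d * 0ℤ) * (d * 0ℤ)) ≡ l * l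
      lemma = solve-∀
    units : ∀ τ → + 2 * sumOnPairs (unitMinor W) (⁅ vertex {v} τ x ⁆ ∪ ⁅ vertex {v} τ y ⁆) ≡ unit-rows d l (I x y)
    units false = trans (sumOnPairs-left-left F₁-alt x≢y) (sum-unitMinor-I W-bal x y)
    units true  = trans (sumOnPairs-right-right F₁-alt x≢y) (sum-unitMinor-columns x y)
    fours : ∀ τ → + 2 * sumOnPairs (fourMinor W) (⁅ vertex {v} τ x ⁆ ∪ ⁅ vertex {v} τ y ⁆) ≡ four-rows d l (I x y)
    fours false = trans (sumOnPairs-left-left F₄-alt x≢y) (sum-fourMinor-I W-bal x y)
    fours true  = trans (sumOnPairs-right-right F₄-alt x≢y) (sum-fourMinor-columns x y)

  sumOnPairs-singleton : ∀ τ x →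
    (+ 2 * sumOnPairs (unitMinor W) ⁅ vertex {v} τ x ⁆
       ≡ + v * unit-rows d l 0ℤ + (unit-rows d l 1ℤ - unit-rows d l 0ℤ)) ×
    (+ 2 * sumOnPairs (fourMinor W) ⁅ vertex {v} τ x ⁆
       ≡ + v * four-rows d l 0ℤ + (four-rows d l 1ℤ - four-rows d l 0ℤ))
  sumOnPairs-singleton false x =
    trans (sumOnPairs-left F₁-alt x) (trans (sum-cong-≗ (sum-unitMinor-I W-bal x)) (sum-at-I (unit-rows d l) x)) ,
    trans (sumOnPairs-left F₄-alt x) (trans (sum-cong-≗ (sum-fourMinor-I W-bal x)) (sum-at-I (four-rows d l) x))
  sumOnPairs-singleton true  y =
    trans (sumOnPairs-right F₁-alt y) (trans (sum-cong-≗ (sum-unitMinor-columns y)) (sum-at-I (unit-rows d l) y)) ,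
    trans (sumOnPairs-right F₄-alt y) (trans (sum-cong-≗ (sum-fourMinor-columns y)) (sum-at-I (four-rows d l) y))

  -- The cross sums involve the entry of `W` only through its square, so incidence alone decides
  -- them, whatever the sign of the entry.
  sumOnPairs-incident : ∀ {x y} → squares W x y ≡ 1ℤ →
    (sumOnPairs (unitMinor W) (⁅ vertex {v} false x ⁆ ∪ ⁅ vertex {v} true y ⁆)
       ≡ d * d + d * (+ v - + 2) - + 2 * l * (d - 1ℤ)) ×
    (sumOnPairs (fourMinor W) (⁅ vertex {v} false x ⁆ ∪ ⁅ vertex {v} true y ⁆) ≡ l * (d - 1ℤ))
  sumOnPairs-incident {x} {y} N≡1 =
    trans (sumOnPairs-left-right F₁-alt x y) (trans (sum-unitMinor-cross W-bal x y)
      (trans (cong (λ n → + v * (n * d) + d * d + (- (+ 2 * n)) * (l * d + (d - l) * n)) N≡1) (lemma₁ (+ v) d l))) ,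
    trans (sumOnPairs-left-right F₄-alt x y) (trans (sum-fourMinor-cross W-bal x y)
      (trans (lemma₄ d l (W x y)) (trans (cong (λ n → n * (l * d + (d - l) * n) - d * n) N≡1) (lemma₄′ d l))))
    where
    lemma₁ : ∀ v d l → v * (1ℤ * d) + d * d + (- (+ 2 * 1ℤ)) * (l * d + (d - l) * 1ℤ)
                         ≡ d * d + d * (v - + 2) - + 2 * l * (d - 1ℤ)
    lemma₁ = solve-∀
    lemma₄ : ∀ d l w → w * w * (l * d + (d - l) * (w * w)) + (- w) * (d * w)
                         ≡ w * w * (l * d + (d - l) * (w * w)) - d * (w * w)
    lemma₄ = solve-∀
    lemma₄′ : ∀ d l → 1ℤ * (l * d + (d - l) * 1ℤ) - d * 1ℤ ≡ l * (d - 1ℤ)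
    lemma₄′ = solve-∀

  sumOnPairs-non-incident : ∀ {x y} → squares W x y ≡ 0ℤ →
    (sumOnPairs (unitMinor W) (⁅ vertex {v} false x ⁆ ∪ ⁅ vertex {v} true y ⁆) ≡ d * d) ×
    (sumOnPairs (fourMinor W) (⁅ vertex {v} false x ⁆ ∪ ⁅ vertex {v} true y ⁆) ≡ 0ℤ)
  sumOnPairs-non-incident {x} {y} N≡0 =
    trans (sumOnPairs-left-right F₁-alt x y) (trans (sum-unitMinor-cross W-bal x y)
      (trans (cong (λ n → + v * (n * d) + d * d + (- (+ 2 * n)) * (l * d + (d - l) * n)) N≡0) (lemma₁ (+ v) d l))) ,
    trans (sumOnPairs-left-right F₄-alt x y) (trans (sum-fourMinor-cross W-bal x y)
      (trans (lemma₄ d l (W x y)) (trans (cong (λ n → n * (l * d + (d - l) * n) - d * n) N≡0) (lemma₄′ d l))))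
    where
    lemma₁ : ∀ v d l → v * (0ℤ * d) + d * d + (- (+ 2 * 0ℤ)) * (l * d + (d - l) * 0ℤ) ≡ d * d
    lemma₁ = solve-∀
    lemma₄ : ∀ d l w → w * w * (l * d + (d - l) * (w * w)) + (- w) * (d * w)
                         ≡ w * w * (l * d + (d - l) * (w * w)) - d * (w * w)
    lemma₄ = solve-∀
    lemma₄′ : ∀ d l → 0ℤ * (l * d + (d - l) * 0ℤ) - d * 0ℤ ≡ 0ℤ
    lemma₄′ = solve-∀

sum-zero-one-≢0 : (f : Fin n → ℤ) → (∀ i → f i ≡ 0ℤ ⊎ f i ≡ 1ℤ) → sum f ≢ 0ℤ → ∃[ i ] f i ≡ 1ℤ
sum-zero-one-≢0 f f∈01 Σ≢0 with Fin.any? (λ i → f i ℤₚ.≟ 1ℤ)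
... | yes ∃1 = ∃1
... | no  ∄1 = contradiction (sum-zero λ i → zero-at i (f∈01 i)) Σ≢0
  where
  zero-at : ∀ i → f i ≡ 0ℤ ⊎ f i ≡ 1ℤ → f i ≡ 0ℤ
  zero-at i (inj₁ f≡0) = f≡0
  zero-at i (inj₂ f≡1) = contradiction (i , f≡1) ∄1

sum-zero-one-≢n : (f : Fin n → ℤ) → (∀ i → f i ≡ 0ℤ ⊎ f i ≡ 1ℤ) → sum f ≢ + n → ∃[ i ] f i ≡ 0ℤ
sum-zero-one-≢n {n} f f∈01 Σ≢n with Fin.any? (λ i → f i ℤₚ.≟ 0ℤ)
... | yes ∃0 = ∃0
... | no  ∄0 = contradiction
  (trans (sum-cong-≗ λ i → one-at i (f∈01 i)) (trans (sum-const n 1ℤ) (ℤₚ.*-identityʳ (+ n)))) Σ≢n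
  where
  one-at : ∀ i → f i ≡ 0ℤ ⊎ f i ≡ 1ℤ → f i ≡ 1ℤ
  one-at i (inj₁ f≡0) = contradiction (i , f≡0) ∄0
  one-at i (inj₂ f≡1) = f≡1

-- Degrees of pairs and of vertices, and the design

module _ {v′ d l : ℕ} {W : Matrix (2 ℕ.+ v′) (2 ℕ.+ v′)} (W-bgw : IsBGW (2 ℕ.+ v′) d l W)
         {a : ℤ} (a∈01 : a ≡ 0ℤ ⊎ a ≡ 1ℤ) where

  private
    v : ℕ
    v = 2 ℕ.+ v′

    N : Matrix v v
    N = unsigned W

    W-bal : IsBalanced (+ d) (+ l) W
    W-bal = balanced-BGW W-bgw

    N≡ : ∀ x y → N x y ≡ squares W x y
    N≡ = unsigned≡squares W-bgw

    N-inc : IsIncidence (+ d) (+ l) N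
    N-inc = record
      { zero-one    = λ x y → subst (λ i → i ≡ 0ℤ ⊎ i ≡ 1ℤ) (sym (N≡ x y)) (ternary-square (ternary W-bal x y))
      ; row-sums    = λ x → trans (sum-cong-≗ (N≡ x)) (row-sum W-bal x)
      ; column-sums = λ y → trans (sum-cong-≗ λ x → N≡ x y) (col-sum W-bal y)
      ; row-grams   = λ x x′ → trans (sum-cong-≗ λ y → cong₂ _*_ (N≡ x y) (N≡ x′ y)) (squares-gram W-bal x x′)
      ; col-grams   = λ y y′ → trans (sum-cong-≗ λ x → cong₂ _*_ (N≡ x y) (N≡ x y′)) (squares-gram (transpose W-bal) y y′)
      }

    open IsIncidence N-inc
    open Scheme N-inc

    H : Hypergraph (v ℕ.+ v)
    H = 𝓗 (bipartite W) 4 a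

    d<v : d ℕ.< v
    d<v = block-size<v W-bgw (ℕ.s≤s (ℕ.s≤s ℕ.z≤n))

    d>0 : 0 ℕ.< d
    d>0 = block-size-positive W-bgw

    row-0 : sum (N 0F) ≡ + d
    row-0 = row-sums 0F

    incident-0 : ∃[ y ] N 0F y ≡ 1ℤ
    incident-0 = sum-zero-one-≢0 (N 0F) (zero-one 0F) λ Σ≡0 →
      ℕₚ.<⇒≢ d>0 (sym (ℤₚ.+-injective (trans (sym row-0) Σ≡0)))

    non-incident-0 : ∃[ y ] N 0F y ≡ 0ℤ
    non-incident-0 = sum-zero-one-≢n (N 0F) (zero-one 0F) λ Σ≡v →
      ℕₚ.<⇒≢ d<v (ℤₚ.+-injective (trans (sym row-0) Σ≡v))

    -- The first class needs d > 0, the second a further vertex on the same side, the third d < v.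
    -- All witnesses start at the first row vertex, which `degree-positive₁` relies on.
    inhabited : ∀ i → ∃₂ λ u w → R (𝓧₂ N) i u w
    inhabited 0F = vertex {v} false 0F , vertex {v} false 0F , refl
    inhabited 1F = let y , N≡1 = incident-0 in
      vertex {v} false 0F , vertex {v} true y , trans (𝓧₂-entry 1F false 0F true y) (cong (entry 1F true) N≡1)
    inhabited 2F = vertex {v} false 0F , vertex {v} false 1F , 𝓧₂-entry 2F false 0F false 1F
    inhabited 3F = let y , N≡0 = non-incident-0 in
      vertex {v} false 0F , vertex {v} true y , trans (𝓧₂-entry 3F false 0F true y) (cong (entry 3F true) N≡0)

    scheme : IsSymmetricAssociationScheme (𝓧₂ N)
    scheme = isScheme inhabited

    -- A loop lies in class 0, which is disjoint from the others.
    related⇒≢ : ∀ i {u w} → R (𝓧₂ N) (suc i) u w → u ≢ w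
    related⇒≢ i {u} r refl with IsSymmetricAssociationScheme.disjoint scheme (suc i) 0F u u r (I-refl u)
    ... | ()

    B : ℤ
    B = + ((v ℕ.+ v ℕ.∸ 2) C 2)

    pairs-through : ∀ i {u w} → R (𝓧₂ N) (suc i) u w → + 2 * + degree H (⁅ u ⁆ ∪ ⁅ w ⁆)
      ≡ weigh a B (sumOnPairs (fourMinor W) (⁅ u ⁆ ∪ ⁅ w ⁆)) (sumOnPairs (unitMinor W) (⁅ u ⁆ ∪ ⁅ w ⁆))
    pairs-through i {u} {w} r = trans
      (degree-𝓗 W (ternary W-bal) a∈01 S 2 (cong (ℕ._+ 2) |S|≡2))
      (cong (λ k → weigh a (+ (k C 2)) (sumOnPairs (fourMinor W) S) (sumOnPairs (unitMinor W) S))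
            (trans (∣∁p∣≡n∸∣p∣ S) (cong (v ℕ.+ v ℕ.∸_) |S|≡2)))
      where
      S = ⁅ u ⁆ ∪ ⁅ w ⁆
      |S|≡2 : ∣ S ∣ ≡ 2
      |S|≡2 = ∣pair∣≡2 (related⇒≢ i r)

    pairDegree : Fin (v ℕ.+ v) → Fin (v ℕ.+ v) → ℕ
    pairDegree u w = degree H (⁅ u ⁆ ∪ ⁅ w ⁆)

    Degree₁ Degree₂ Degree₃ : Fin (v ℕ.+ v) → Fin (v ℕ.+ v) → Set
    Degree₁ u w = + 2 * + degree H (⁅ u ⁆ ∪ ⁅ w ⁆) ≡ param₁ v d l a
    Degree₂ u w = + 2 * (+ 2 * + degree H (⁅ u ⁆ ∪ ⁅ w ⁆)) ≡ param₂ v d l a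
    Degree₃ u w = + 2 * + degree H (⁅ u ⁆ ∪ ⁅ w ⁆) ≡ param₃ v d l a

    degree₁-cross : ∀ x y → R (𝓧₂ N) 1F (vertex {v} false x) (vertex {v} true y) → Degree₁ (vertex {v} false x) (vertex {v} true y)
    degree₁-cross x y r =
      let F₁≡ , F₄≡ = sumOnPairs-incident W-bal (trans (sym (N≡ x y)) (sym (proj₂ (related⇒ 1F false x true y r)))) in
      trans (pairs-through 0F {vertex {v} false x} {vertex {v} true y} r) (cong₂ (weigh a B) F₄≡ F₁≡)

    degree₃-cross : ∀ x y → R (𝓧₂ N) 3F (vertex {v} false x) (vertex {v} true y) → Degree₃ (vertex {v} false x) (vertex {v} true y)
    degree₃-cross x y r =
      let F₁≡ , F₄≡ = sumOnPairs-non-incident W-bal (trans (sym (N≡ x y)) (sym (proj₂ (related⇒ 3F false x true y r)))) in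
      trans (pairs-through 2F {vertex {v} false x} {vertex {v} true y} r) (cong₂ (weigh a B) F₄≡ F₁≡)

    degree₂-side : ∀ τ x y → R (𝓧₂ N) 2F (vertex {v} τ x) (vertex {v} τ y) → x ≢ y → Degree₂ (vertex {v} τ x) (vertex {v} τ y)
    degree₂-side τ x y r x≢y =
      let F₁≡ , F₄≡ = sumOnPairs-same-side W-bal τ x≢y
          S = ⁅ vertex {v} τ x ⁆ ∪ ⁅ vertex {v} τ y ⁆ in
      trans (cong (+ 2 *_) (pairs-through 1F {vertex {v} τ x} {vertex {v} τ y} r))
        (trans (double-weigh a B (sumOnPairs (fourMinor W) S) (sumOnPairs (unitMinor W) S))
               (cong₂ (weigh a (+ 2 * B)) F₄≡ F₁≡))

    swap-pair : ∀ (P : ℕ → Set) u w → P (degree H (⁅ w ⁆ ∪ ⁅ u ⁆)) → P (degree H (⁅ u ⁆ ∪ ⁅ w ⁆))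
    swap-pair P u w = subst (λ S → P (degree H S)) (∪-comm ⁅ w ⁆ ⁅ u ⁆)

    degree₁ : ∀ u w → R (𝓧₂ N) 1F u w → Degree₁ u w
    degree₁ = on-vertices {v} (λ u w → R (𝓧₂ N) 1F u w → Degree₁ u w) go
      where
      go : ∀ τ x υ y → R (𝓧₂ N) 1F (vertex {v} τ x) (vertex {v} υ y) → Degree₁ (vertex {v} τ x) (vertex {v} υ y)
      go false x true  y r = degree₁-cross x y r
      go true  x false y r = swap-pair (λ k → + 2 * + k ≡ param₁ v d l a) (vertex {v} true x) (vertex {v} false y)
        (degree₁-cross y x (IsSymmetricAssociationScheme.symm scheme 1F (vertex {v} true x) (vertex {v} false y) r))
      go false x false y r = contradiction (proj₁ (related⇒ 1F false x false y r)) λ ()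
      go true  x true  y r = contradiction (proj₁ (related⇒ 1F true x true y r)) λ ()

    degree₃ : ∀ u w → R (𝓧₂ N) 3F u w → Degree₃ u w
    degree₃ = on-vertices {v} (λ u w → R (𝓧₂ N) 3F u w → Degree₃ u w) go
      where
      go : ∀ τ x υ y → R (𝓧₂ N) 3F (vertex {v} τ x) (vertex {v} υ y) → Degree₃ (vertex {v} τ x) (vertex {v} υ y)
      go false x true  y r = degree₃-cross x y r
      go true  x false y r = swap-pair (λ k → + 2 * + k ≡ param₃ v d l a) (vertex {v} true x) (vertex {v} false y)
        (degree₃-cross y x (IsSymmetricAssociationScheme.symm scheme 3F (vertex {v} true x) (vertex {v} false y) r))
      go false x false y r = contradiction (proj₁ (related⇒ 3F false x false y r)) λ ()
      go true  x true  y r = contradiction (proj₁ (related⇒ 3F true x true y r)) λ ()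

    degree₂ : ∀ u w → R (𝓧₂ N) 2F u w → Degree₂ u w
    degree₂ = on-vertices {v} (λ u w → R (𝓧₂ N) 2F u w → Degree₂ u w) go
      where
      go : ∀ τ x υ y → R (𝓧₂ N) 2F (vertex {v} τ x) (vertex {v} υ y) → Degree₂ (vertex {v} τ x) (vertex {v} υ y)
      go false x false y r = degree₂-side false x y r λ x≡y → related⇒≢ 1F r (cong (vertex {v} false) x≡y)
      go true  x true  y r = degree₂-side true x y r λ x≡y → related⇒≢ 1F r (cong (vertex {v} true) x≡y)
      go false x true  y r = contradiction (proj₁ (related⇒ 2F false x true y r)) λ ()
      go true  x false y r = contradiction (proj₁ (related⇒ 2F true x false y r)) λ ()

    unit-singleton four-singleton : ℤ
    unit-singleton = + v * unit-rows (+ d) (+ l) 0ℤ + (unit-rows (+ d) (+ l) 1ℤ - unit-rows (+ d) (+ l) 0ℤ)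
    four-singleton = + v * four-rows (+ d) (+ l) 0ℤ + (four-rows (+ d) (+ l) 1ℤ - four-rows (+ d) (+ l) 0ℤ)

    -- The right-hand side does not mention `u`, which gives the 1-design. It is the same for rows
    -- and columns because the Gram matrices agree.
    degree-vertex : ∀ u → + 2 * (+ 2 * + degree H ⁅ u ⁆)
                            ≡ weigh a (+ 2 * + ((v ℕ.+ v ℕ.∸ 1) C 3)) four-singleton unit-singleton
    degree-vertex u with vertex-surjective {v} u
    ... | τ , x , refl = begin
      + 2 * (+ 2 * + degree H S)
        ≡⟨ cong (+ 2 *_) (degree-𝓗 W (ternary W-bal) a∈01 S 3 (cong (ℕ._+ 3) (∣⁅x⁆∣≡1 (vertex {v} τ x)))) ⟩
      + 2 * weigh a (+ (∣ ∁ S ∣ C 3)) (sumOnPairs (fourMinor W) S) (sumOnPairs (unitMinor W) S)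
        ≡⟨ double-weigh a (+ (∣ ∁ S ∣ C 3)) (sumOnPairs (fourMinor W) S) (sumOnPairs (unitMinor W) S) ⟩
      weigh a (+ 2 * + (∣ ∁ S ∣ C 3)) (+ 2 * sumOnPairs (fourMinor W) S) (+ 2 * sumOnPairs (unitMinor W) S)
        ≡⟨ cong₂ (weigh a (+ 2 * + (∣ ∁ S ∣ C 3)))
             (proj₂ (sumOnPairs-singleton W-bal τ x)) (proj₁ (sumOnPairs-singleton W-bal τ x)) ⟩
      weigh a (+ 2 * + (∣ ∁ S ∣ C 3)) four-singleton unit-singleton
        ≡⟨ cong (λ k → weigh a (+ 2 * + (k C 3)) four-singleton unit-singleton)
             (trans (∣∁p∣≡n∸∣p∣ S) (cong (v ℕ.+ v ℕ.∸_) (∣⁅x⁆∣≡1 (vertex {v} τ x)))) ⟩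
      weigh a (+ 2 * + ((v ℕ.+ v ℕ.∸ 1) C 3)) four-singleton unit-singleton ∎
      where
      S = ⁅ vertex {v} τ x ⁆

  -- Each index is the degree of a representative pair; other pairs of the class have the same
  -- multiple of their degree, and the multiple cancels. Positivity is an argument because the two
  -- values of `a` require different proofs of it.
  isPBIBD : (positive : 0 ℕ.< degree (𝓗 (bipartite W) 4 a) ⁅ 0F ⁆) →
    ∃[ l₁ ] ∃[ l₂ ] ∃[ l₃ ]
      (fromℕ l₁ ≡ λ₁ v d l a × fromℕ l₂ ≡ λ₂ v d l a × fromℕ l₃ ≡ λ₃ v d l a ×
       IsPBIBD (v ℕ.+ v) 4 l₁ l₂ l₃ (𝓧₂ (unsigned W)) (𝓗 (bipartite W) 4 a))
  isPBIBD positive =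
    let u₁ , w₁ , r₁ = inhabited 1F
        u₂ , w₂ , r₂ = inhabited 2F
        u₃ , w₃ , r₃ = inhabited 3F in
    pairDegree u₁ w₁ , pairDegree u₂ w₂ , pairDegree u₃ w₃ ,
    param₁⇒λ₁ v d l a (pairDegree u₁ w₁) (degree₁ u₁ w₁ r₁) ,
    param₂⇒λ₂ v d l a (pairDegree u₂ w₂) (degree₂ u₂ w₂ r₂) ,
    param₃⇒λ₃ v d l a (pairDegree u₃ w₃) (degree₃ u₃ w₃ r₃) ,
    record
      { scheme   = scheme
      ; 1-design = degree H ⁅ 0F ⁆ , record
        { t-positive = ℕ.s≤s ℕ.z≤n
        ; v-positive = ℕ.s≤s ℕ.z≤n
        ; k-positive = ℕ.s≤s ℕ.z≤n
        ; l-positive = positive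
        ; uniform    = λ _ → proj₁
        ; balanced   = λ S |S|≡1 → let u , S≡⁅u⁆ = ∣p∣≡1⇒p≡⁅x⁆ S |S|≡1 in
            trans (cong (degree H) S≡⁅u⁆) (4*-injective (trans (degree-vertex u) (sym (degree-vertex 0F))))
        }
      ; pairs₁ = λ u w r → 2*-injective (trans (degree₁ u w r) (sym (degree₁ u₁ w₁ r₁)))
      ; pairs₂ = λ u w r → 4*-injective (trans (degree₂ u w r) (sym (degree₂ u₂ w₂ r₂)))
      ; pairs₃ = λ u w r → 2*-injective (trans (degree₃ u w r) (sym (degree₃ u₃ w₃ r₃)))
      }

  -- The representative of the third class contains vertex `0F` and lies in d² hyperedges, and every
  -- hyperedge through the pair passes through the vertex.
  degree-positive₁ : a ≡ 1ℤ → 0 ℕ.< degree (𝓗 (bipartite W) 4 a) ⁅ 0F ⁆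
  degree-positive₁ a≡1 =
    let u , w , r = inhabited 3F in
    ℕₚ.≤-trans (positive d>0 (subst (λ a → + 2 * + degree H (⁅ u ⁆ ∪ ⁅ w ⁆) ≡ param₃ v d l a) a≡1 (degree₃ u w r)))
               (degree-antitone H {⁅ u ⁆} {⁅ u ⁆ ∪ ⁅ w ⁆} (p⊆p∪q ⁅ w ⁆))
    where
    positive : ∀ {d k} → 0 ℕ.< d → + 2 * + k ≡ param₃ v d l 1ℤ → 0 ℕ.< k
    positive {k = suc k}    _ _  = ℕ.s≤s ℕ.z≤n
    positive {suc d} {zero} _ eq = contradiction (trans eq (lemma B (+ suc d))) λ ()
      where
      lemma : ∀ b d → (1ℤ - 1ℤ) * (+ 2 * b - 0ℤ) + (+ 2 * 1ℤ - 1ℤ) * (+ 2 * (d * d)) ≡ + 2 * (d * d)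
      lemma = solve-∀

-- One vertex on the first side and three on the second give a singular submatrix for any `W`; the
-- three vertices require v ≥ 3.
degree-positive₀ : ∀ {v′} (let v = 3 ℕ.+ v′) (W : Matrix v v) →
                   0 ℕ.< degree (𝓗 (bipartite W) 4 0ℤ) ⁅ 0F ⁆
degree-positive₀ {v′} W = degree-positive (𝓗 (bipartite W) 4 0ℤ) {⁅ 0F ⁆} {α} (|α|≡4 , det≡0) ⁅0⁆⊆α
  where
  β γ : Subset (3 ℕ.+ v′)
  β = ⁅ 0F ⁆
  γ = inside ∷ inside ∷ inside ∷ ⊥
  α = β Vec.++ γ

  elements-β : elements β ≡ 0F ∷ []
  elements-β = cong (λ xs → 0F ∷ List.map suc xs) (elements-⊥ (2 ℕ.+ v′))

  elements-γ : elements γ ≡ 0F ∷ 1F ∷ 2F ∷ []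
  elements-γ = cong (λ xs → 0F ∷ List.map suc (0F ∷ List.map suc (0F ∷ List.map suc xs))) (elements-⊥ v′)

  |α|≡4 : ∣ α ∣ ≡ 4
  |α|≡4 = trans (∣++∣≡length-merge β γ) (cong₂ (λ xs ys → length (merge xs ys)) elements-β elements-γ)

  det≡0 : det (principal (bipartite W) α) ≡ 0ℤ
  det≡0 = trans (det-principal-bipartite W β γ)
    (trans (cong₂ (λ xs ys → detOn (bipartiteEntry W) (merge xs ys)) elements-β elements-γ)
           (det-bipartite-1-3 W 0F 0F 1F 2F))

  ⁅0⁆⊆α : ⁅ 0F ⁆ ⊆ α
  ⁅0⁆⊆α x∈⁅0⁆ with x∈⁅y⁆⇒x≡y 0F x∈⁅0⁆
  ... | refl = Vec.lookup⇒[]= 0F α refl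

-- From 0 < d < 2 follows d = 1, and then flag counting reads 1 = 1 + l, against l > 0.
BGW-order≢2 : ∀ {d l} {W : Matrix 2 2} → ¬ IsBGW 2 d l W
BGW-order≢2 {d} {l} {W} W-bgw =
  go (block-size-positive W-bgw) (block-size<v W-bgw ℕₚ.≤-refl) (index-positive W-bgw) (flag-count (balanced-BGW W-bgw) 0F)
  where
  go : ∀ {d} → 0 ℕ.< d → d ℕ.< 2 → 0 ℕ.< l → + d * + d ≢ (+ d - + l) * 1ℤ + + 2 * + l
  go {suc zero}    _ _ l>0 eq = ℕₚ.<⇒≢ l>0 (sym (ℤₚ.+-injective (trans (lemma (+ l)) (cong (_- 1ℤ) (sym eq)))))
    where
    lemma : ∀ l → l ≡ (1ℤ - l) * 1ℤ + + 2 * l - 1ℤ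
    lemma = solve-∀
  go {suc (suc d)} _ (ℕ.s≤s (ℕ.s≤s ())) _ _

theorem3p12 : (v d l : ℕ) → 2 ℕ.≤ v → (W : Matrix v v) → IsBGW v d l W →
    (a : ℤ) → a ≡ 0ℤ ⊎ a ≡ 1ℤ →
    ∃[ l₁ ] ∃[ l₂ ] ∃[ l₃ ]
    (fromℕ l₁ ≡ λ₁ v d l a × fromℕ l₂ ≡ λ₂ v d l a × fromℕ l₃ ≡ λ₃ v d l a ×
    IsPBIBD (v ℕ.+ v) 4 l₁ l₂ l₃ (𝓧₂ (unsigned W)) (𝓗 (bipartite W) 4 a))
theorem3p12 1 d l (ℕ.s≤s ())
theorem3p12 (suc (suc v′)) d l _ W W-bgw a (inj₂ a≡1) =
  isPBIBD W-bgw (inj₂ a≡1) (degree-positive₁ W-bgw (inj₂ a≡1) a≡1)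
theorem3p12 2 d l _ W W-bgw a (inj₁ _) = contradiction W-bgw BGW-order≢2
theorem3p12 (suc (suc (suc v′))) d l _ W W-bgw .0ℤ (inj₁ refl) =
  isPBIBD W-bgw (inj₁ refl) (degree-positive₀ W)
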